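{- Let $p$ be a prime, let $A,\Gamma\subset\mathbb{F}_p^*$ be multiplicative subgroups with $|A|<\sqrt p$, and let $C,D\subseteq\mathbb{F}_p^*$ be arbitrary sets. Suppose that for some $\xi,\eta\in\mathbb{F}_p^*$ and $s\in\mathbb{F}_p$ one has $C\subseteq\xi A+s$, $D\subseteq\eta A+s$, $|C|\ge3$, and $$C-D\subseteq\Gamma\sqcup\{0\}.$$ Then $$|C|^8|D|^4|\Gamma|^2\ll|A|^8|S_\Gamma(C-C)|\,\mathsf{E}^+(\Gamma)\log^2|A|.$$ If moreover $|\Gamma|\ll p^{3/5-o(1)}$ then $|C|^4|D|^2\ll|A|^4|S_\Gamma(C-C)|^{2/3}\log|A|$.
   Context: $S_\Gamma(Q)$ is the minimal $\Gamma$-invariant set containing $Q$ (equivalently $\Gamma Q$). $\mathsf{E}^+(\Gamma)=|\{(x_1,x_2,x_3,x_4)\in\Gamma^4:x_1+x_2=x_3+x_4\}|$. $X\ll Y$ means $X\le cY$ with an absolute constant $c$. -}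

module Defs where

open import Data.Bool.Properties using (T-≡)
open import Data.Fin using (Fin; toℕ)
import Data.Fin.Properties as Fin
open import Data.Fin.Subset using (Subset; _∈_; _∉_; ⁅_⁆)
open import Data.Fin.Subset.Properties using (_∈?_)
open import Data.Integer using (+_; -[1+_])
open import Data.List using (List; allFin; cartesianProduct; filter; length)
open import Data.Nat using (ℕ; suc; NonZero; _+_; _*_; _∸_; _^_; _≤_)
open import Data.Nat.Logarithm using (⌊log₂_⌋)
open import Data.Nat.DivMod using (_mod_)
open import Data.Product using (∃₂; ∃-syntax; _×_; _,_)
open import Data.Rational using (ℚ; mkℚ; 0ℚ)
import Data.Rational as ℚ
open import Data.Vec using (tabulate; lookup)
open import Data.Vec.Properties using (lookup∘tabulate; []=⇒lookup; lookup⇒[]=)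
open import Function using (_⇔_; mk⇔; Equivalence)
open import Relation.Binary.PropositionalEquality using (_≡_; sym; trans)
open import Relation.Nullary.Decidable using (Dec; _×-dec_; isYes; toWitness; fromWitness)

-- 𝔽ₚ is Fin p with arithmetic modulo p.
module _ {p : ℕ} .{{_ : NonZero p}} where

  infixl 6 _+ₚ_ _-ₚ_ _⊕_ _⊖_
  infixl 7 _*ₚ_ _⊙_

  0ₚ 1ₚ : Fin p
  0ₚ = 0 mod p
  1ₚ = 1 mod p

  _+ₚ_ _-ₚ_ _*ₚ_ : Fin p → Fin p → Fin p
  x +ₚ y = (toℕ x + toℕ y) mod p
  x -ₚ y = (toℕ x + (p ∸ toℕ y)) mod p
  x *ₚ y = (toℕ x * toℕ y) mod p

  -- Multiplicative subgroups of 𝔽ₚ*.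
  record IsSubgroup (Γ : Subset p) : Set where
    field
      0∉       : 0ₚ ∉ Γ
      1∈       : 1ₚ ∈ Γ
      *-closed : ∀ {x y} → x ∈ Γ → y ∈ Γ → x *ₚ y ∈ Γ
      inverse  : ∀ {x} → x ∈ Γ → ∃[ y ] (y ∈ Γ × x *ₚ y ≡ 1ₚ)

  image₂? : (f : Fin p → Fin p → Fin p) (X Y : Subset p) (z : Fin p) →
            Dec (∃₂ λ x y → x ∈ X × y ∈ Y × f x y ≡ z)
  image₂? f X Y z = Fin.any? λ x → Fin.any? λ y →
    (x ∈? X) ×-dec ((y ∈? Y) ×-dec (f x y Fin.≟ z))

  image₂ : (Fin p → Fin p → Fin p) → Subset p → Subset p → Subset p
  image₂ f X Y = tabulate λ z → isYes (image₂? f X Y z)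

  ∈-image₂ : ∀ f X Y {z} →
             z ∈ image₂ f X Y ⇔ (∃₂ λ x y → x ∈ X × y ∈ Y × f x y ≡ z)
  ∈-image₂ f X Y {z} = mk⇔
    (λ z∈ → toWitness {a? = image₂? f X Y z} (Equivalence.from T-≡
      (trans (sym (lookup∘tabulate _ z)) ([]=⇒lookup z∈))))
    (λ w → lookup⇒[]= z _ (trans (lookup∘tabulate _ z)
      (Equivalence.to T-≡ (fromWitness {a? = image₂? f X Y z} w))))

  _⊕_ _⊖_ _⊙_ : Subset p → Subset p → Subset p
  _⊕_ = image₂ _+ₚ_
  _⊖_ = image₂ _-ₚ_
  _⊙_ = image₂ _*ₚ_

  -- The affine image ξA + s.
  affine : Fin p → Subset p → Fin p → Subset p
  affine ξ A s = (⁅ ξ ⁆ ⊙ A) ⊕ ⁅ s ⁆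

  -- ΓQ: for a subgroup Γ, the minimal Γ-invariant set containing Q.
  S[_] : Subset p → Subset p → Subset p
  S[ Γ ] Q = Γ ⊙ Q

  elements : Subset p → List (Fin p)
  elements X = filter (_∈? X) (allFin p)

  E⁺ : Subset p → ℕ
  E⁺ Γ = length (filter
    (λ ((x₁ , x₂) , (x₃ , x₄)) → (x₁ +ₚ x₂) Fin.≟ (x₃ +ₚ x₄))
    (cartesianProduct Γ² Γ²))
    where
    Γ² : List (Fin p × Fin p)
    Γ² = cartesianProduct (elements Γ) (elements Γ)

-- For n ≥ 2 this is within absolute constant factors of the real logarithm, so
-- it may replace log n under ≪.
log : ℕ → ℕ
log n = ⌊log₂ n ⌋

-- n ≤ c · x ^ q for a rational exponent q = a / b in lowest terms, b > 0,
-- with both sides raised to the power b and, when a < 0, multiplied by x ^ ∣ a ∣.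
-- This is the real inequality when x > 0.
_≤_·_^ℚ_ : ℕ → ℕ → ℕ → ℚ → Set
n ≤ c · x ^ℚ mkℚ (+ a)    b-1 _ = n ^ suc b-1 ≤ c ^ suc b-1 * x ^ a
n ≤ c · x ^ℚ mkℚ -[1+ a ] b-1 _ = n ^ suc b-1 * x ^ suc a ≤ c ^ suc b-1

-- δ(n) = o(1) as n → ∞.
IsLittleO1 : (ℕ → ℚ) → Set
IsLittleO1 δ = ∀ ε → 0ℚ ℚ.< ε → ∃[ N ] (∀ n → N ≤ n → ℚ.∣ δ n ∣ ℚ.≤ ε)

module Submission where

open import Defs
open import Algebra.Bundles using (CommutativeRing; CommutativeMonoid; RawRing)
open import Algebra.Solver.Ring.AlmostCommutativeRing using (fromCommutativeRing; _-Raw-AlmostCommutative⟶_)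
open import Algebra.Structures using (IsCommutativeRing)
open import Data.Bool using (true; false)
open import Data.Empty using (⊥-elim)
open import Data.Fin using (Fin; zero; suc; toℕ)
import Data.Fin as Fin
import Data.Fin.Properties as Fin
open import Data.Fin.Subset using (Subset; _∉_; _⊆_; _∪_; ⁅_⁆; ∣_∣)
import Data.Fin.Subset as Subset
import Data.Fin.Subset.Properties as Subset
open import Data.Integer using (ℤ; +_; -[1+_]; 0ℤ)
import Data.Integer as ℤ
import Data.Integer.Properties as ℤ
open import Data.List
  using (List; []; _∷_; _++_; length; map; take; filter; foldr; lookup; upTo; allFin; cartesianProduct)
import Data.List.Properties as List
open import Data.List.Membership.Propositional using (_∈_)
import Data.List.Membership.Propositional as List
import Data.List.Membership.DecPropositional as DecMembership
open import Data.List.Membership.Propositional.Properties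
  using ( ∈-length; ∈-allFin; ∈-upTo⁺; ∈-++⁺ˡ; ∈-++⁺ʳ; ∈-++⁻; ∈-map⁺; ∈-map⁻; ∈-filter⁺; ∈-filter⁻
        ; ∈-cartesianProduct⁺; ∈-cartesianProduct⁻)
open import Data.List.Relation.Unary.All using (All; []; _∷_)
import Data.List.Relation.Unary.All as All
import Data.List.Relation.Unary.All.Properties as All
open import Data.List.Relation.Unary.AllPairs using ([]; _∷_)
open import Data.List.Relation.Unary.Any using (here; there; index)
open import Data.List.Relation.Unary.Any.Properties using (lookup-index)
open import Data.List.Relation.Unary.Unique.Propositional using (Unique)
import Data.List.Relation.Unary.Unique.Propositional.Properties as Unique
open import Data.Maybe using (Maybe; just; nothing)
open import Data.Nat
  using ( ℕ; zero; suc; NonZero; ≢-nonZero; >-nonZero; nonTrivial⇒n>1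
        ; _+_; _*_; _∸_; _^_; _≤_; _<_; z≤n; s≤s)
import Data.Nat as ℕ
open import Data.Nat.Coprimality using (coprime-Bézout; prime⇒coprime)
open import Data.Nat.DivMod
  using ( _mod_; _%_; %-distribˡ-+; %-distribˡ-*; m%n<n; m<n⇒m%n≡m; [m+kn]%n≡m%n; m≡m%n+[m/n]*n
        ; m/n*n≤m; m/n≤m; m≥n⇒m/n>0)
open import Data.Nat.GCD using (module Bézout)
open import Data.Nat.ListAction using (sum)
open import Data.Nat.Logarithm using (⌊log₂_⌋; ⌊log₂⌋-mono-≤; ⌊log₂[2^n]⌋≡n)
open import Data.Nat.Primality using (Prime; prime⇒nonTrivial)
import Data.Nat.Properties as ℕ
open import Data.Nat.Solver using (module +-*-Solver)
open import Data.Nat.Tactic.RingSolver using (solve-∀)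
open import Data.Product using (Σ-syntax; ∃-syntax; ∃₂; _×_; _,_; proj₁; proj₂)
open import Data.Product.Properties using (,-injective; ≡-dec)
open import Data.Rational using (ℚ; 0ℚ; _/_; _-_)
import Data.Rational.Properties as ℚ
open import Data.Sum using (_⊎_; inj₁; inj₂; [_,_]′)
open import Data.Vec using ([]; _∷_)
open import Function using (_∘_; Equivalence)
open import Level using (0ℓ)
open import Relation.Binary using (Setoid)
open import Relation.Binary.Definitions using (DecidableEquality; tri<; tri≈; tri>)
open import Relation.Binary.PropositionalEquality
  using (_≡_; _≢_; refl; sym; trans; cong; cong₂; subst; subst₂; isEquivalence; module ≡-Reasoning)
open import Relation.Nullary using (¬_; Dec; yes; no; ¬?)
open import Relation.Nullary.Decidable using (_×-dec_)
open import Relation.Unary using (Pred; Decidable)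

-- Call x ∈ Γ good if x = (c′ − d)/(c − d) with c, c′ ∈ C and d ∈ D. Then
-- 1 − x = (c − c′)/(c − d) lies in S = S_Γ(C − C). So the good x lie in
-- X = {x ∈ Γ : 1 − x ∈ S}, and Cauchy–Schwarz for the map (d, c, c′) ↦ x gives
-- |C|⁴|D|² ≪ |X| Σ_{x ∈ X} n(x)², where n(x) counts the triples of ratio x. With
-- κ = η/ξ one has n(x) ≤ |A| r(x), where r(x) is the number of a ∈ A, a ≠ κ, which
-- the dilation of centre κ and ratio x maps into A. Everything else is Stepanov's
-- bound: if u ≠ 0, 1 ranges over distinct elements for which (uᵗ, (u − 1)ᵗ) takes at
-- most M values, there are ≪ (M t)^{2/3} such u as long as M ≪ t² and M t⁴ ≪ p³.
--   · With t = |A|, this bounds first the number M ≪ t²/τ³ of classes of the level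
--     set {r ≥ τ} and then its size, ≪ t²/τ²; dyadic summation gives
--     Σ r(x)² ≪ t² log t.
--   · With t = |Γ|, it gives |X|³ ≪ |S|², while (|X||Γ|)² ≤ |S| E⁺(Γ) is
--     Cauchy–Schwarz for (x, g) ↦ g (1 − x).
--
-- Stepanov's bound itself uses an auxiliary polynomial
-- Ψ = Σ_{b, c < B} (X − 1)^{tc} X^{tb} P_{bc} with deg P_{bc} < D, made to vanish to
-- order D at each u by the pigeonhole principle. The derivation θ = X (X − 1) d/dX
-- preserves the shape of Ψ, so the conditions at u depend only on (uᵗ, (u − 1)ᵗ).
-- Ψ ≠ 0 since a polynomial of degree < p with at most BD ≤ t terms is not divisible
-- by (X − 1)ᵗ. All products involved are by linear factors X − u, so polynomials form
-- only a module over the operators L u = X − u, and f(u) = 0 is read as L u ∣ f.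

-- A ratio x = (c′ - d)/(c - d) is seen in two ways. Multiplicatively, x is a quotient of two
-- elements of Γ, and 1 - x = (c - c′)/(c - d) lies in S_Γ(C - C), so x ∈ X. Affinely, put c = ξ a +
-- s, c′ = ξ a′ + s, d = η b + s. Then c - d = ξ b (a/b - κ) with κ = η/ξ, so ratio x means that the
-- dilation of centre κ and ratio x carries a/b to a′/b. As b, a/b and x determine the triple, at
-- most |A| r(x) triples have ratio x, and Cauchy-Schwarz with Σ r(x)² ≪ |A|² log |A| (`∑r²`) gives
-- |C|⁴ |D|² ≪ |X| |A|⁴ log |A| (`triples-bound`).
--
-- The two assertions follow from two bounds for |X|. In `energy-bound` a coincidence g (1 - x) = g′
-- (1 - x′) becomes the additive quadruple g + x′ g′ = g′ + x g of Γ. In `shift-bound`, |X|³ ≪ |S|²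
-- comes from Stepanov's method.
--
-- That method counts points u for which the pair of cosets of u and u - 1, modulo the group of
-- order t, takes only M values. The auxiliary polynomial has B² D free coefficients, while its
-- vanishing to order D costs 2 M D² conditions however many points there are; its degree, below 2 t
-- B + D, then bounds D times the number of points. With B about (M t)^{1/3} and D about t/B this
-- yields (M t)^{2/3} points. A level set of r takes two rounds, because its number M of classes is
-- not known in advance: the returns of class representatives are points that bound M, and the
-- method applied to the level set itself then bounds its size.

infix 8 _²
_² : ℕ → ℕ
n ² = n * n

infix 8 _³
_³ : ℕ → ℕ
n ³ = n * n * n

module Powers where
  open +-*-Solver

  n^2≡n² : ∀ n → n ^ 2 ≡ n ²
  n^2≡n² = solve 1 (λ n → n :^ 2 := n :* n) refl

  n^3≡n³ : ∀ n → n ^ 3 ≡ n ³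
  n^3≡n³ = solve 1 (λ n → n :^ 3 := n :* n :* n) refl

  n^4≡n²² : ∀ n → n ^ 4 ≡ (n ²) ²
  n^4≡n²² = solve 1 (λ n → n :^ 4 := n :* n :* (n :* n)) refl

  n^5≡n³n² : ∀ n → n ^ 5 ≡ n ³ * n ²
  n^5≡n³n² = solve 1 (λ n → n :^ 5 := n :* n :* n :* (n :* n)) refl

  n^8≡n^4² : ∀ n → n ^ 8 ≡ (n ^ 4) ²
  n^8≡n^4² = solve 1 (λ n → n :^ 8 := n :^ 4 :* n :^ 4) refl

open Powers

-- The case 1 makes the constant 1 of the ring solver evaluate to 1# itself.
numeral : {A : Set} → (A → A → A) → A → A → ℕ → A
numeral _⊹_ 0# 1# 0             = 0#
numeral _⊹_ 0# 1# 1             = 1#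
numeral _⊹_ 0# 1# (suc (suc n)) = 1# ⊹ numeral _⊹_ 0# 1# (suc n)

-- Prime fields as an interface, and a ring solver for them.

record PrimeField (p : ℕ) : Set where
  infixl 6 _+ᶠ_ _-ᶠ_
  infixl 7 _*ᶠ_
  infix  8 -ᶠ_
  field
    _+ᶠ_ _*ᶠ_ : Fin p → Fin p → Fin p
    -ᶠ_ _⁻¹   : Fin p → Fin p
    0ᶠ 1ᶠ     : Fin p
    isCommutativeRing : IsCommutativeRing _≡_ _+ᶠ_ _*ᶠ_ -ᶠ_ 0ᶠ 1ᶠ
    ⁻¹-inverse : ∀ {x} → x ≢ 0ᶠ → x *ᶠ x ⁻¹ ≡ 1ᶠ
    2≤p        : 2 ≤ p
    -- The characteristic enters through this field: differentiation multiplies coefficients by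
    -- numerals, which later have to be cancelled.
    numeral≢0  : ∀ {n} → 0 < n → n < p → numeral _+ᶠ_ 0ᶠ 1ᶠ n ≢ 0ᶠ

  ι : ℕ → Fin p
  ι = numeral _+ᶠ_ 0ᶠ 1ᶠ

  _-ᶠ_ : Fin p → Fin p → Fin p
  x -ᶠ y = x +ᶠ -ᶠ y

  commutativeRing : CommutativeRing 0ℓ 0ℓ
  commutativeRing = record { isCommutativeRing = isCommutativeRing }

module FieldProperties {p : ℕ} (𝔽 : PrimeField p) where
  open PrimeField 𝔽 public
  open CommutativeRing commutativeRing public
    using ( +-identityˡ; +-identityʳ; *-identityˡ; *-identityʳ; zeroˡ; zeroʳ; -‿inverseʳ
          ; *-comm; *-assoc; +-comm; +-assoc; commutativeSemiring)
  open import Algebra.Properties.CommutativeSemiring.Exp commutativeSemiring public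
    using (^-assocʳ; ^-distrib-*)
    renaming (_^_ to _^ᶠ_)

  ι-suc : ∀ n → ι (suc n) ≡ 1ᶠ +ᶠ ι n
  ι-suc zero    = sym (+-identityʳ 1ᶠ)
  ι-suc (suc n) = refl

  ι-+ : ∀ m n → ι (m + n) ≡ ι m +ᶠ ι n
  ι-+ zero    n = sym (+-identityˡ (ι n))
  ι-+ (suc m) n = begin
    ι (suc (m + n))     ≡⟨ ι-suc (m + n) ⟩
    1ᶠ +ᶠ ι (m + n)      ≡⟨ cong (1ᶠ +ᶠ_) (ι-+ m n) ⟩
    1ᶠ +ᶠ (ι m +ᶠ ι n)    ≡⟨ +-assoc _ _ _ ⟨
    1ᶠ +ᶠ ι m +ᶠ ι n      ≡⟨ cong (_+ᶠ ι n) (ι-suc m) ⟨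
    ι (suc m) +ᶠ ι n     ∎
    where open ≡-Reasoning

  private
    R = fromCommutativeRing commutativeRing

    open import Algebra.Properties.Ring (CommutativeRing.ring commutativeRing)
      using (-‿involutive; -‿distribˡ-*; -‿distribʳ-*; -0#≈0#; -‿+-comm)

    ι-* : ∀ m n → ι (m * n) ≡ ι m *ᶠ ι n
    ι-* zero    n = sym (zeroˡ (ι n))
    ι-* (suc m) n = begin
      ι (n + m * n)         ≡⟨ ι-+ n (m * n) ⟩
      ι n +ᶠ ι (m * n)       ≡⟨ cong₂ _+ᶠ_ (sym (*-identityˡ (ι n))) (ι-* m n) ⟩
      1ᶠ *ᶠ ι n +ᶠ ι m *ᶠ ι n  ≡⟨ CommutativeRing.distribʳ commutativeRing _ _ _ ⟨
      (1ᶠ +ᶠ ι m) *ᶠ ι n      ≡⟨ cong (_*ᶠ ι n) (ι-suc m) ⟨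
      ι (suc m) *ᶠ ι n       ∎
      where open ≡-Reasoning

    -- The canonical homomorphism from ℤ; with integers as coefficients the solver can cancel
    -- constants.
    ⟦_⟧ℤ : ℤ → Fin p
    ⟦ + n ⟧ℤ      = ι n
    ⟦ -[1+ n ] ⟧ℤ = -ᶠ ι (suc n)

    ⟦⟧-neg : ∀ i → ⟦ ℤ.- i ⟧ℤ ≡ -ᶠ ⟦ i ⟧ℤ
    ⟦⟧-neg (+ zero)    = sym -0#≈0#
    ⟦⟧-neg (+ (suc n)) = refl
    ⟦⟧-neg -[1+ n ]    = sym (-‿involutive _)

    cancel₁ : ∀ x y → x -ᶠ y ≡ (1ᶠ +ᶠ x) -ᶠ (1ᶠ +ᶠ y)
    cancel₁ x y = begin
      x -ᶠ y                             ≡⟨ +-identityˡ _ ⟨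
      0ᶠ +ᶠ (x -ᶠ y)                      ≡⟨ cong (_+ᶠ (x -ᶠ y)) (-‿inverseʳ 1ᶠ) ⟨
      (1ᶠ -ᶠ 1ᶠ) +ᶠ (x -ᶠ y)               ≡⟨ interchange 1ᶠ (-ᶠ 1ᶠ) x (-ᶠ y) ⟩
      (1ᶠ +ᶠ x) +ᶠ (-ᶠ 1ᶠ -ᶠ y)            ≡⟨ cong ((1ᶠ +ᶠ x) +ᶠ_) (-‿+-comm 1ᶠ y) ⟩
      (1ᶠ +ᶠ x) -ᶠ (1ᶠ +ᶠ y)              ∎
      where open ≡-Reasoning
            open import Algebra.Properties.CommutativeSemigroup
              (CommutativeMonoid.commutativeSemigroup (CommutativeRing.+-commutativeMonoid commutativeRing))

    ⟦⟧-⊖ : ∀ m n → ⟦ m ℤ.⊖ n ⟧ℤ ≡ ι m -ᶠ ι n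
    ⟦⟧-⊖ m zero = sym (trans (cong (ι m +ᶠ_) -0#≈0#) (+-identityʳ _))
    ⟦⟧-⊖ zero (suc n) = sym (+-identityˡ _)
    ⟦⟧-⊖ (suc m) (suc n) rewrite ℤ.[1+m]⊖[1+n]≡m⊖n m n | ι-suc m | ι-suc n =
      trans (⟦⟧-⊖ m n) (cancel₁ _ _)

    ⟦⟧-+ : ∀ i j → ⟦ i ℤ.+ j ⟧ℤ ≡ ⟦ i ⟧ℤ +ᶠ ⟦ j ⟧ℤ
    ⟦⟧-+ (+ m) (+ n)       = ι-+ m n
    ⟦⟧-+ (+ m) -[1+ n ]    = ⟦⟧-⊖ m (suc n)
    ⟦⟧-+ -[1+ m ] (+ n)    = trans (⟦⟧-⊖ n (suc m)) (+-comm _ _)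
    ⟦⟧-+ -[1+ m ] -[1+ n ] = begin
      -ᶠ ι (suc (suc (m + n)))        ≡⟨ cong (λ k → -ᶠ ι (suc k)) (ℕ.+-suc m n) ⟨
      -ᶠ ι (suc m + suc n)            ≡⟨ cong -ᶠ_ (ι-+ (suc m) (suc n)) ⟩
      -ᶠ (ι (suc m) +ᶠ ι (suc n))      ≡⟨ -‿+-comm _ _ ⟨
      -ᶠ ι (suc m) -ᶠ ι (suc n)        ∎
      where open ≡-Reasoning

    ⟦⟧-*-pos : ∀ m j → ⟦ + m ℤ.* j ⟧ℤ ≡ ι m *ᶠ ⟦ j ⟧ℤ
    ⟦⟧-*-pos m (+ n) = trans (cong ⟦_⟧ℤ (sym (ℤ.pos-* m n))) (ι-* m n)
    ⟦⟧-*-pos m -[1+ n ] = begin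
      ⟦ + m ℤ.* (ℤ.- (+ suc n)) ⟧ℤ   ≡⟨ cong ⟦_⟧ℤ (ℤ.neg-distribʳ-* (+ m) (+ suc n)) ⟨
      ⟦ ℤ.- (+ m ℤ.* + suc n) ⟧ℤ     ≡⟨ ⟦⟧-neg (+ m ℤ.* + suc n) ⟩
      -ᶠ ⟦ + m ℤ.* + suc n ⟧ℤ        ≡⟨ cong -ᶠ_ (⟦⟧-*-pos m (+ suc n)) ⟩
      -ᶠ (ι m *ᶠ ι (suc n))           ≡⟨ -‿distribʳ-* _ _ ⟩
      ι m *ᶠ (-ᶠ ι (suc n))           ∎
      where open ≡-Reasoning

    ⟦⟧-* : ∀ i j → ⟦ i ℤ.* j ⟧ℤ ≡ ⟦ i ⟧ℤ *ᶠ ⟦ j ⟧ℤ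
    ⟦⟧-* (+ m)    j = ⟦⟧-*-pos m j
    ⟦⟧-* -[1+ m ] j = begin
      ⟦ ℤ.- (+ suc m) ℤ.* j ⟧ℤ     ≡⟨ cong ⟦_⟧ℤ (ℤ.neg-distribˡ-* (+ suc m) j) ⟨
      ⟦ ℤ.- (+ suc m ℤ.* j) ⟧ℤ     ≡⟨ ⟦⟧-neg (+ suc m ℤ.* j) ⟩
      -ᶠ ⟦ + suc m ℤ.* j ⟧ℤ        ≡⟨ cong -ᶠ_ (⟦⟧-*-pos (suc m) j) ⟩
      -ᶠ (ι (suc m) *ᶠ ⟦ j ⟧ℤ)      ≡⟨ -‿distribˡ-* _ _ ⟩
      (-ᶠ ι (suc m)) *ᶠ ⟦ j ⟧ℤ      ∎
      where open ≡-Reasoning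

    ℤ-rawRing : RawRing 0ℓ 0ℓ
    ℤ-rawRing = CommutativeRing.rawRing ℤ.+-*-commutativeRing

    morphism : ℤ-rawRing -Raw-AlmostCommutative⟶ R
    morphism = record
      { ⟦_⟧ = ⟦_⟧ℤ ; +-homo = ⟦⟧-+ ; *-homo = ⟦⟧-* ; -‿homo = ⟦⟧-neg ; 0-homo = refl ; 1-homo = refl }

    _≟ᶜ_ : ∀ i j → Maybe (⟦ i ⟧ℤ ≡ ⟦ j ⟧ℤ)
    i ≟ᶜ j with i ℤ.≟ j
    ... | yes i≡j = just (cong ⟦_⟧ℤ i≡j)
    ... | no _    = nothing

  open import Algebra.Solver.Ring ℤ-rawRing R morphism _≟ᶜ_ public
    using (solve; con; _:=_; _:+_; _:*_; _:-_; :-_; Polynomial)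

  :1 : ∀ {n} → Polynomial n
  :1 = con (+ 1)

  *-cancelˡ : ∀ x {y z} → x ≢ 0ᶠ → x *ᶠ y ≡ x *ᶠ z → y ≡ z
  *-cancelˡ x {y} {z} x≢0 xy≡xz = begin
    y                     ≡⟨ *-identityˡ y ⟨
    1ᶠ *ᶠ y                ≡⟨ cong (_*ᶠ y) (⁻¹-inverse x≢0) ⟨
    x *ᶠ x ⁻¹ *ᶠ y          ≡⟨ solve 3 (λ x i y → x :* i :* y := i :* (x :* y)) refl x (x ⁻¹) y ⟩
    x ⁻¹ *ᶠ (x *ᶠ y)        ≡⟨ cong (x ⁻¹ *ᶠ_) xy≡xz ⟩
    x ⁻¹ *ᶠ (x *ᶠ z)        ≡⟨ solve 3 (λ x i y → i :* (x :* y) := x :* i :* y) refl x (x ⁻¹) z ⟩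
    x *ᶠ x ⁻¹ *ᶠ z          ≡⟨ cong (_*ᶠ z) (⁻¹-inverse x≢0) ⟩
    1ᶠ *ᶠ z                ≡⟨ *-identityˡ z ⟩
    z                     ∎
    where open ≡-Reasoning

  *-≢0 : ∀ {x y} → x ≢ 0ᶠ → y ≢ 0ᶠ → x *ᶠ y ≢ 0ᶠ
  *-≢0 {x} x≢0 y≢0 xy≡0 = y≢0 (*-cancelˡ x x≢0 (trans xy≡0 (sym (zeroʳ x))))

  1≢0 : 1ᶠ ≢ 0ᶠ
  1≢0 = numeral≢0 (s≤s z≤n) 2≤p

  ⁻¹-≢0 : ∀ {x} → x ≢ 0ᶠ → x ⁻¹ ≢ 0ᶠ
  ⁻¹-≢0 {x} x≢0 x⁻¹≡0 = 1≢0 (trans (sym (⁻¹-inverse x≢0)) (trans (cong (x *ᶠ_) x⁻¹≡0) (zeroʳ x)))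

  ^-≢0 : ∀ {x} n → x ≢ 0ᶠ → x ^ᶠ n ≢ 0ᶠ
  ^-≢0 zero    x≢0 = 1≢0
  ^-≢0 (suc n) x≢0 = *-≢0 x≢0 (^-≢0 n x≢0)

  -ᶠ≡0⇒≡ : ∀ {x y} → x -ᶠ y ≡ 0ᶠ → x ≡ y
  -ᶠ≡0⇒≡ {x} {y} x-y≡0 = begin
    x            ≡⟨ solve 2 (λ x y → x := x :- y :+ y) refl x y ⟩
    x -ᶠ y +ᶠ y   ≡⟨ cong (_+ᶠ y) x-y≡0 ⟩
    0ᶠ +ᶠ y       ≡⟨ +-identityˡ y ⟩
    y            ∎
    where open ≡-Reasoning

  -- The identity that places 1 - x in Γ (C - C) when c - d ∈ Γ.
  1-ratio : ∀ {c d} c′ → c ≢ d → 1ᶠ -ᶠ (c′ -ᶠ d) *ᶠ (c -ᶠ d) ⁻¹ ≡ (c -ᶠ d) ⁻¹ *ᶠ (c -ᶠ c′)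
  1-ratio {c} {d} c′ c≢d = trans
    (cong (_-ᶠ (c′ -ᶠ d) *ᶠ (c -ᶠ d) ⁻¹) (sym (⁻¹-inverse (λ c-d≡0 → c≢d (-ᶠ≡0⇒≡ c-d≡0)))))
    (solve 4 (λ c c′ d i → (c :- d) :* i :- (c′ :- d) :* i := i :* (c :- c′)) refl c c′ d ((c -ᶠ d) ⁻¹))

-- Arithmetic modulo p is a prime field.

module _ {p : ℕ} .{{_ : NonZero p}} where

  private
    π : ℕ → Fin p
    π n = n mod p

    π-cong : ∀ {m n} → m % p ≡ n % p → π m ≡ π n
    π-cong {m} {n} eq = Fin.toℕ-injective
      (trans (Fin.toℕ-fromℕ< (m%n<n m p)) (trans eq (sym (Fin.toℕ-fromℕ< (m%n<n n p)))))

    toℕ-π : ∀ n → toℕ (π n) ≡ n % p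
    toℕ-π n = Fin.toℕ-fromℕ< (m%n<n n p)

    π-toℕ : ∀ x → π (toℕ x) ≡ x
    π-toℕ x = Fin.toℕ-injective (trans (toℕ-π (toℕ x)) (m<n⇒m%n≡m (Fin.toℕ<n x)))

    π-+ : ∀ m n → π m +ₚ π n ≡ π (m + n)
    π-+ m n = π-cong (trans (cong₂ (λ a b → (a + b) % p) (toℕ-π m) (toℕ-π n)) (sym (%-distribˡ-+ m n p)))

    π-* : ∀ m n → π m *ₚ π n ≡ π (m * n)
    π-* m n = π-cong (trans (cong₂ (λ a b → (a * b) % p) (toℕ-π m) (toℕ-π n)) (sym (%-distribˡ-* m n p)))

    -- Every ring law is the image under π of the same law in ℕ.
    π-surj : ∀ x → ∃[ n ] π n ≡ x
    π-surj x = toℕ x , π-toℕ x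

    negₚ : Fin p → Fin p
    negₚ x = π (p ∸ toℕ x)

    πp≡0 : ∀ k → π (k * p) ≡ 0ₚ
    πp≡0 k = π-cong ([m+kn]%n≡m%n 0 k p)

    -ₚ-≡ : ∀ x y → x -ₚ y ≡ x +ₚ negₚ y
    -ₚ-≡ x y = trans (sym (π-+ (toℕ x) (p ∸ toℕ y))) (cong (_+ₚ negₚ y) (π-toℕ x))

    +ₚ-assoc : ∀ x y z → (x +ₚ y) +ₚ z ≡ x +ₚ (y +ₚ z)
    +ₚ-assoc x y z with π-surj x | π-surj y | π-surj z
    ... | a , refl | b , refl | c , refl = begin
      (π a +ₚ π b) +ₚ π c  ≡⟨ cong (_+ₚ π c) (π-+ a b) ⟩
      π (a + b) +ₚ π c     ≡⟨ π-+ (a + b) c ⟩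
      π (a + b + c)        ≡⟨ cong π (ℕ.+-assoc a b c) ⟩
      π (a + (b + c))      ≡⟨ π-+ a (b + c) ⟨
      π a +ₚ π (b + c)     ≡⟨ cong (π a +ₚ_) (π-+ b c) ⟨
      π a +ₚ (π b +ₚ π c)  ∎
      where open ≡-Reasoning

    *ₚ-assoc : ∀ x y z → (x *ₚ y) *ₚ z ≡ x *ₚ (y *ₚ z)
    *ₚ-assoc x y z with π-surj x | π-surj y | π-surj z
    ... | a , refl | b , refl | c , refl = begin
      (π a *ₚ π b) *ₚ π c  ≡⟨ cong (_*ₚ π c) (π-* a b) ⟩
      π (a * b) *ₚ π c     ≡⟨ π-* (a * b) c ⟩
      π (a * b * c)        ≡⟨ cong π (ℕ.*-assoc a b c) ⟩
      π (a * (b * c))      ≡⟨ π-* a (b * c) ⟨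
      π a *ₚ π (b * c)     ≡⟨ cong (π a *ₚ_) (π-* b c) ⟨
      π a *ₚ (π b *ₚ π c)  ∎
      where open ≡-Reasoning

    *ₚ-distribˡ : ∀ x y z → x *ₚ (y +ₚ z) ≡ x *ₚ y +ₚ x *ₚ z
    *ₚ-distribˡ x y z with π-surj x | π-surj y | π-surj z
    ... | a , refl | b , refl | c , refl = begin
      π a *ₚ (π b +ₚ π c)         ≡⟨ cong (π a *ₚ_) (π-+ b c) ⟩
      π a *ₚ π (b + c)            ≡⟨ π-* a (b + c) ⟩
      π (a * (b + c))             ≡⟨ cong π (ℕ.*-distribˡ-+ a b c) ⟩
      π (a * b + a * c)           ≡⟨ π-+ (a * b) (a * c) ⟨
      π (a * b) +ₚ π (a * c)      ≡⟨ cong₂ _+ₚ_ (π-* a b) (π-* a c) ⟨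
      π a *ₚ π b +ₚ π a *ₚ π c    ∎
      where open ≡-Reasoning

    +ₚ-comm : ∀ x y → x +ₚ y ≡ y +ₚ x
    +ₚ-comm x y = cong π (ℕ.+-comm (toℕ x) (toℕ y))

    *ₚ-comm : ∀ x y → x *ₚ y ≡ y *ₚ x
    *ₚ-comm x y = cong π (ℕ.*-comm (toℕ x) (toℕ y))

    +ₚ-identityˡ : ∀ x → 0ₚ +ₚ x ≡ x
    +ₚ-identityˡ x with π-surj x
    ... | a , refl = π-+ 0 a

    *ₚ-identityˡ : ∀ x → 1ₚ *ₚ x ≡ x
    *ₚ-identityˡ x with π-surj x
    ... | a , refl = trans (π-* 1 a) (cong π (ℕ.*-identityˡ a))

    +ₚ-inverseʳ : ∀ x → x +ₚ negₚ x ≡ 0ₚ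
    +ₚ-inverseʳ x = begin
      x +ₚ negₚ x                 ≡⟨ cong (_+ₚ negₚ x) (π-toℕ x) ⟨
      π (toℕ x) +ₚ π (p ∸ toℕ x)  ≡⟨ π-+ _ _ ⟩
      π (toℕ x + (p ∸ toℕ x))     ≡⟨ cong π (ℕ.m+[n∸m]≡n (ℕ.<⇒≤ (Fin.toℕ<n x))) ⟩
      π p                         ≡⟨ cong π (ℕ.*-identityˡ p) ⟨
      π (1 * p)                   ≡⟨ πp≡0 1 ⟩
      0ₚ                          ∎
      where open ≡-Reasoning

    isCommutativeRingₚ : IsCommutativeRing _≡_ _+ₚ_ _*ₚ_ negₚ 0ₚ 1ₚ
    isCommutativeRingₚ = record
      { isRing = record
        { +-isAbelianGroup = record
          { isGroup = record
            { isMonoid = record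
              { isSemigroup = record
                { isMagma = record { isEquivalence = isEquivalence ; ∙-cong = cong₂ _+ₚ_ }
                ; assoc = +ₚ-assoc }
              ; identity = +ₚ-identityˡ , λ x → trans (+ₚ-comm x 0ₚ) (+ₚ-identityˡ x) }
            ; inverse = (λ x → trans (+ₚ-comm (negₚ x) x) (+ₚ-inverseʳ x)) , +ₚ-inverseʳ
            ; ⁻¹-cong = cong negₚ }
          ; comm = +ₚ-comm }
        ; *-cong = cong₂ _*ₚ_
        ; *-assoc = *ₚ-assoc
        ; *-identity = *ₚ-identityˡ , λ x → trans (*ₚ-comm x 1ₚ) (*ₚ-identityˡ x)
        ; distrib = *ₚ-distribˡ , λ x y z → trans (*ₚ-comm (y +ₚ z) x)
            (trans (*ₚ-distribˡ x y z) (cong₂ _+ₚ_ (*ₚ-comm x y) (*ₚ-comm x z))) }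
      ; *-comm = *ₚ-comm }

    π≢0 : ∀ {n} → 0 < n → n < p → π n ≢ 0ₚ
    π≢0 {n} 0<n n<p eq = ℕ.<⇒≢ 0<n (sym (begin
      n          ≡⟨ m<n⇒m%n≡m n<p ⟨
      n % p      ≡⟨ toℕ-π n ⟨
      toℕ (π n)  ≡⟨ cong toℕ eq ⟩
      toℕ 0ₚ     ≡⟨ toℕ-π 0 ⟩
      0 % p      ≡⟨ m<n⇒m%n≡m (ℕ.<-trans 0<n n<p) ⟩
      0          ∎))
      where open ≡-Reasoning

    inverseₚ : Prime p → ∀ x → x ≢ 0ₚ → ∃[ y ] x *ₚ y ≡ 1ₚ
    inverseₚ pr x x≢0 = from-Bézout (coprime-Bézout (prime⇒coprime pr {{≢-nonZero tox≢0}} (Fin.toℕ<n x)))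
      where
      open ≡-Reasoning
      tox≢0 : toℕ x ≢ 0
      tox≢0 eq = x≢0 (trans (sym (π-toℕ x)) (cong π eq))
      n = toℕ x
      x*π : ∀ y → x *ₚ π y ≡ π (y * n)
      x*π y = begin
        x *ₚ π y      ≡⟨ cong (_*ₚ π y) (π-toℕ x) ⟨
        π n *ₚ π y    ≡⟨ π-* n y ⟩
        π (n * y)     ≡⟨ cong π (ℕ.*-comm n y) ⟩
        π (y * n)     ∎
      from-Bézout : Bézout.Identity 1 p n → ∃[ y ] x *ₚ y ≡ 1ₚ
      from-Bézout (Bézout.-+ a b eq) = π b , (begin
        x *ₚ π b               ≡⟨ x*π b ⟩
        π (b * n)              ≡⟨ cong π eq ⟨
        π (1 + a * p)          ≡⟨ π-cong ([m+kn]%n≡m%n 1 a p) ⟩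
        1ₚ                     ∎)
      -- Here 1 + b n = a p, so the inverse is -b.
      from-Bézout (Bézout.+- a b eq) = negₚ (π b) , (begin
        x *ₚ negₚ (π b)                          ≡⟨ +ₚ-identityˡ _ ⟨
        0ₚ +ₚ x *ₚ negₚ (π b)                    ≡⟨ cong (_+ₚ x *ₚ negₚ (π b)) (trans (cong π eq) (πp≡0 a)) ⟨
        π (1 + b * n) +ₚ x *ₚ negₚ (π b)         ≡⟨ cong (_+ₚ x *ₚ negₚ (π b)) (π-+ 1 (b * n)) ⟨
        1ₚ +ₚ π (b * n) +ₚ x *ₚ negₚ (π b)       ≡⟨ cong (λ z → 1ₚ +ₚ z +ₚ x *ₚ negₚ (π b)) (x*π b) ⟨
        1ₚ +ₚ x *ₚ π b +ₚ x *ₚ negₚ (π b)        ≡⟨ +ₚ-assoc _ _ _ ⟩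
        1ₚ +ₚ (x *ₚ π b +ₚ x *ₚ negₚ (π b))      ≡⟨ cong (1ₚ +ₚ_) (*ₚ-distribˡ x (π b) (negₚ (π b))) ⟨
        1ₚ +ₚ x *ₚ (π b +ₚ negₚ (π b))           ≡⟨ cong (λ z → 1ₚ +ₚ x *ₚ z) (+ₚ-inverseʳ (π b)) ⟩
        1ₚ +ₚ x *ₚ 0ₚ                            ≡⟨ cong (1ₚ +ₚ_) (*ₚ-comm x 0ₚ) ⟩
        1ₚ +ₚ 0ₚ *ₚ x                            ≡⟨ cong (1ₚ +ₚ_) (cong (0ₚ *ₚ_) (π-toℕ x)) ⟨
        1ₚ +ₚ 0ₚ *ₚ π n                          ≡⟨ cong (1ₚ +ₚ_) (π-* 0 n) ⟩
        1ₚ +ₚ 0ₚ                                 ≡⟨ π-+ 1 0 ⟩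
        1ₚ                                       ∎)

    inv : Prime p → Fin p → Fin p
    inv pr x with x Fin.≟ 0ₚ
    -- An arbitrary value; `inv-inverse` excludes x = 0.
    ... | yes _   = 0ₚ
    ... | no x≢0  = proj₁ (inverseₚ pr x x≢0)

    inv-inverse : ∀ pr {x} → x ≢ 0ₚ → x *ₚ inv pr x ≡ 1ₚ
    inv-inverse pr {x} x≢0 with x Fin.≟ 0ₚ
    ... | yes x≡0  = ⊥-elim (x≢0 x≡0)
    ... | no x≢0′  = proj₂ (inverseₚ pr x x≢0′)

    numeral≡π : ∀ n → numeral _+ₚ_ 0ₚ 1ₚ n ≡ π n
    numeral≡π 0             = refl
    numeral≡π 1             = refl
    numeral≡π (suc (suc n)) = trans (cong (1ₚ +ₚ_) (numeral≡π (suc n))) (π-+ 1 (suc n))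

  ℤ/p : Prime p → PrimeField p
  ℤ/p pr = record
    { _+ᶠ_ = _+ₚ_ ; _*ᶠ_ = _*ₚ_ ; -ᶠ_ = negₚ ; _⁻¹ = inv pr ; 0ᶠ = 0ₚ ; 1ᶠ = 1ₚ
    ; isCommutativeRing = isCommutativeRingₚ
    ; ⁻¹-inverse = inv-inverse pr
    ; 2≤p = nonTrivial⇒n>1 p {{prime⇒nonTrivial pr}}
    ; numeral≢0 = λ {n} 0<n n<p eq → π≢0 0<n n<p (trans (sym (numeral≡π n)) eq) }

  -ₚ-ℤ/p : (pr : Prime p) → ∀ x y → x -ₚ y ≡ PrimeField._-ᶠ_ (ℤ/p pr) x y
  -ₚ-ℤ/p pr = -ₚ-≡

-- Polynomials, linear operators on them, and degrees.

module Polynomials {p : ℕ} (𝔽 : PrimeField p) where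
  open FieldProperties 𝔽

  infix  4 _≈_
  infixl 6 _⊞_ _⊟_
  infixr 7 _⊡_
  infixr 8 _∙_

  -- `bound` need not be the degree, and `_≈_` ignores it; it is where the downward induction of
  -- `deg-L⁻` starts.
  record Poly : Set where
    no-eta-equality
    field
      coef   : ℕ → Fin p
      bound  : ℕ
      vanish : ∀ {n} → bound ≤ n → coef n ≡ 0ᶠ
  open Poly public

  record _≈_ (f g : Poly) : Set where
    constructor coefs
    field at : ∀ n → coef f n ≡ coef g n
  open _≈_ public

  ≈-refl : ∀ {f} → f ≈ f
  ≈-refl = coefs λ _ → refl

  ≈-sym : ∀ {f g} → f ≈ g → g ≈ f
  ≈-sym e = coefs λ n → sym (at e n)

  ≈-trans : ∀ {f g h} → f ≈ g → g ≈ h → f ≈ h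
  ≈-trans d e = coefs λ n → trans (at d n) (at e n)

  ≈-setoid : Setoid 0ℓ 0ℓ
  ≈-setoid = record
    { Carrier = Poly ; _≈_ = _≈_
    ; isEquivalence = record { refl = ≈-refl ; sym = ≈-sym ; trans = ≈-trans } }

  open import Relation.Binary.Reasoning.Setoid ≈-setoid

  𝟘 : Poly
  𝟘 .coef   _ = 0ᶠ
  𝟘 .bound    = 0
  𝟘 .vanish _ = refl

  _⊞_ : Poly → Poly → Poly
  (f ⊞ g) .coef   n   = coef f n +ᶠ coef g n
  (f ⊞ g) .bound      = bound f + bound g
  (f ⊞ g) .vanish b≤n = trans
    (cong₂ _+ᶠ_ (vanish f (ℕ.≤-trans (ℕ.m≤m+n _ _) b≤n)) (vanish g (ℕ.≤-trans (ℕ.m≤n+m _ _) b≤n)))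
    (+-identityˡ 0ᶠ)

  _⊡_ : Fin p → Poly → Poly
  (c ⊡ f) .coef   n   = c *ᶠ coef f n
  (c ⊡ f) .bound      = bound f
  (c ⊡ f) .vanish b≤n = trans (cong (c *ᶠ_) (vanish f b≤n)) (zeroʳ c)

  shift : Poly → Poly
  shift f .coef   zero    = 0ᶠ
  shift f .coef   (suc n) = coef f n
  shift f .bound          = suc (bound f)
  shift f .vanish (s≤s b≤n) = vanish f b≤n

  -- The derivation X d/dX, which unlike d/dX keeps every exponent in place.
  euler : Poly → Poly
  euler f .coef   n   = ι n *ᶠ coef f n
  euler f .bound      = bound f
  euler f .vanish b≤n = trans (cong (_ *ᶠ_) (vanish f b≤n)) (zeroʳ _)

  _⊟_ : Poly → Poly → Poly
  f ⊟ g = f ⊞ (-ᶠ 1ᶠ) ⊡ g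

  ⊞-cong : ∀ {f f′ g g′} → f ≈ f′ → g ≈ g′ → f ⊞ g ≈ f′ ⊞ g′
  ⊞-cong d e = coefs λ n → cong₂ _+ᶠ_ (at d n) (at e n)

  ⊡-cong : ∀ {c d f g} → c ≡ d → f ≈ g → c ⊡ f ≈ d ⊡ g
  ⊡-cong c≡d e = coefs λ n → cong₂ _*ᶠ_ c≡d (at e n)

  ⊟≈𝟘⇒≈ : ∀ {f g} → f ⊟ g ≈ 𝟘 → f ≈ g
  ⊟≈𝟘⇒≈ {f} {g} e = coefs λ n → -ᶠ≡0⇒≡
    (trans (solve 2 (λ x y → x :- y := x :+ :- :1 :* y) refl (coef f n) (coef g n)) (at e n))

  ≈⇒⊟≈𝟘 : ∀ {f g} → f ≈ g → f ⊟ g ≈ 𝟘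
  ≈⇒⊟≈𝟘 {f} {g} e = coefs λ n → trans (cong (_+ᶠ (-ᶠ 1ᶠ) *ᶠ coef g n) (at e n))
    (solve 1 (λ y → y :+ :- :1 :* y := con 0ℤ) refl (coef g n))

  record Linear : Set where
    field
      ap    : Poly → Poly
      ap-≈  : ∀ {f g} → f ≈ g → ap f ≈ ap g
      ap-⊞  : ∀ f g → ap (f ⊞ g) ≈ ap f ⊞ ap g
      ap-⊡  : ∀ c f → ap (c ⊡ f) ≈ c ⊡ ap f
  open Linear public

  _∙_ : Linear → Poly → Poly
  _∙_ = ap

  ap-⊟ : ∀ A f g → A ∙ (f ⊟ g) ≈ A ∙ f ⊟ A ∙ g
  ap-⊟ A f g = ≈-trans (ap-⊞ A f _) (⊞-cong ≈-refl (ap-⊡ A _ g))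

  ap-𝟘 : ∀ A → A ∙ 𝟘 ≈ 𝟘
  ap-𝟘 A = begin
    A ∙ 𝟘           ≈⟨ ap-≈ A (coefs λ n → sym (zeroˡ _)) ⟩
    A ∙ (0ᶠ ⊡ 𝟘)     ≈⟨ ap-⊡ A 0ᶠ 𝟘 ⟩
    0ᶠ ⊡ A ∙ 𝟘       ≈⟨ coefs (λ n → zeroˡ _) ⟩
    𝟘               ∎

  id : Linear
  id = record { ap = λ f → f ; ap-≈ = λ e → e ; ap-⊞ = λ _ _ → ≈-refl ; ap-⊡ = λ _ _ → ≈-refl }

  infixr 9 _⊚_
  _⊚_ : Linear → Linear → Linear
  A ⊚ B = record
    { ap = λ f → A ∙ B ∙ f
    ; ap-≈ = λ e → ap-≈ A (ap-≈ B e)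
    ; ap-⊞ = λ f g → ≈-trans (ap-≈ A (ap-⊞ B f g)) (ap-⊞ A _ _)
    ; ap-⊡ = λ c f → ≈-trans (ap-≈ A (ap-⊡ B c f)) (ap-⊡ A _ _) }

  infixl 6 _⊞ₗ_
  _⊞ₗ_ : Linear → Linear → Linear
  A ⊞ₗ B = record
    { ap = λ f → A ∙ f ⊞ B ∙ f
    ; ap-≈ = λ e → ⊞-cong (ap-≈ A e) (ap-≈ B e)
    ; ap-⊞ = λ f g → ≈-trans (⊞-cong (ap-⊞ A f g) (ap-⊞ B f g)) (coefs λ n →
        solve 4 (λ a b c d → (a :+ b) :+ (c :+ d) := (a :+ c) :+ (b :+ d)) refl
          (coef (A ∙ f) n) (coef (A ∙ g) n) (coef (B ∙ f) n) (coef (B ∙ g) n))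
    ; ap-⊡ = λ c f → ≈-trans (⊞-cong (ap-⊡ A c f) (ap-⊡ B c f)) (coefs λ n →
        solve 3 (λ c a b → c :* a :+ c :* b := c :* (a :+ b)) refl c (coef (A ∙ f) n) (coef (B ∙ f) n)) }

  infixr 7 _⊡ₗ_
  _⊡ₗ_ : Fin p → Linear → Linear
  c ⊡ₗ A = record
    { ap = λ f → c ⊡ A ∙ f
    ; ap-≈ = λ e → ⊡-cong refl (ap-≈ A e)
    ; ap-⊞ = λ f g → ≈-trans (⊡-cong refl (ap-⊞ A f g)) (coefs λ n →
        solve 3 (λ c a b → c :* (a :+ b) := c :* a :+ c :* b) refl c (coef (A ∙ f) n) (coef (A ∙ g) n))
    ; ap-⊡ = λ d f → ≈-trans (⊡-cong refl (ap-⊡ A d f)) (coefs λ n →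
        solve 3 (λ c d a → c :* (d :* a) := d :* (c :* a)) refl c d (coef (A ∙ f) n)) }

  pow : Linear → ℕ → Linear
  pow A zero    = id
  pow A (suc n) = A ⊚ pow A n

  pow-comm : ∀ A B → (∀ f → A ∙ B ∙ f ≈ B ∙ A ∙ f) → ∀ n f → A ∙ pow B n ∙ f ≈ pow B n ∙ A ∙ f
  pow-comm A B AB zero    f = ≈-refl
  pow-comm A B AB (suc n) f = ≈-trans (AB _) (ap-≈ B (pow-comm A B AB n f))

  pow-+ : ∀ A m n f → pow A (m + n) ∙ f ≈ pow A m ∙ pow A n ∙ f
  pow-+ A zero    n f = ≈-refl
  pow-+ A (suc m) n f = ap-≈ A (pow-+ A m n f)

  X : Linear
  X = record
    { ap = shift
    ; ap-≈ = λ e → coefs λ { zero → refl ; (suc n) → at e n }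
    ; ap-⊞ = λ f g → coefs λ { zero → sym (+-identityˡ 0ᶠ) ; (suc n) → refl }
    ; ap-⊡ = λ c f → coefs λ { zero → sym (zeroʳ c) ; (suc n) → refl } }

  E : Linear
  E = record
    { ap = euler
    ; ap-≈ = λ e → coefs λ n → cong (ι n *ᶠ_) (at e n)
    ; ap-⊞ = λ f g → coefs λ n →
        solve 3 (λ c a b → c :* (a :+ b) := c :* a :+ c :* b) refl (ι n) (coef f n) (coef g n)
    ; ap-⊡ = λ c f → coefs λ n →
        solve 3 (λ i c a → i :* (c :* a) := c :* (i :* a)) refl (ι n) c (coef f n) }

  L : Fin p → Linear
  L u = X ⊞ₗ (-ᶠ u) ⊡ₗ id

  θ : Linear
  θ = L 1ᶠ ⊚ E

  L-comm : ∀ u v f → L u ∙ L v ∙ f ≈ L v ∙ L u ∙ f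
  L-comm u v f = coefs λ
    { zero → solve 3 (λ u v a → con 0ℤ :+ :- u :* (con 0ℤ :+ :- v :* a) := con 0ℤ :+ :- v :*
        (con 0ℤ :+ :- u :* a)) refl u v (coef f 0)
    ; (suc n) → solve 5 (λ u v x a b → (x :+ :- v :* a) :+ :- u :* (a :+ :- v :* b)
                                    := (x :+ :- u :* a) :+ :- v :* (a :+ :- u :* b)) refl
                  u v (coef (X ∙ f) n) (coef f n) (coef f (suc n)) }

  L₀≈X : ∀ f → L 0ᶠ ∙ f ≈ X ∙ f
  L₀≈X f = coefs λ n → solve 2 (λ x a → x :+ :- con 0ℤ :* a := x) refl (coef (X ∙ f) n) (coef f n)

  -- Leibniz rule: X d/dX maps X - u to X.
  E-L : ∀ u f → E ∙ L u ∙ f ≈ L u ∙ E ∙ f ⊞ X ∙ f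
  E-L u f = coefs λ
    { zero → solve 2 (λ u a → con 0ℤ :* (con 0ℤ :+ :- u :* a) := con 0ℤ :+ :- u :* (con 0ℤ :* a) :+ con 0ℤ)
        refl u (coef f 0)
    ; (suc n) → trans (cong (_*ᶠ (coef f n +ᶠ -ᶠ u *ᶠ coef f (suc n))) (ι-suc n))
        (trans (solve 4 (λ u i a b → (:1 :+ i) :* (a :+ :- u :* b) := i :* a :+ :- u :* ((:1 :+ i) :* b) :+ a) refl
                 u (ι n) (coef f n) (coef f (suc n)))
               (cong (λ z → ι n *ᶠ coef f n +ᶠ -ᶠ u *ᶠ (z *ᶠ coef f (suc n)) +ᶠ coef f n) (sym (ι-suc n)))) }

  L-X : ∀ u f → L u ∙ X ∙ f ≈ X ∙ L u ∙ f
  L-X u f = begin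
    L u ∙ X ∙ f      ≈⟨ ap-≈ (L u) (L₀≈X f) ⟨
    L u ∙ L 0ᶠ ∙ f    ≈⟨ L-comm u 0ᶠ f ⟩
    L 0ᶠ ∙ L u ∙ f    ≈⟨ L₀≈X _ ⟩
    X ∙ L u ∙ f      ∎

  -- At n = 0 the last summand vanishes because ι 0 = 0.
  E-powL : ∀ u n f → E ∙ pow (L u) n ∙ f ≈ pow (L u) n ∙ E ∙ f ⊞ ι n ⊡ X ∙ pow (L u) (n ∸ 1) ∙ f
  E-powL u zero f = coefs λ n →
    solve 2 (λ a x → a := a :+ con 0ℤ :* x) refl (coef (E ∙ f) n) (coef (X ∙ f) n)
  E-powL u (suc n) f = begin
    E ∙ L u ∙ g                              ≈⟨ E-L u g ⟩
    L u ∙ E ∙ g ⊞ X ∙ g                      ≈⟨ ⊞-cong (ap-≈ (L u) (E-powL u n f)) ≈-refl ⟩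
    L u ∙ (pow (L u) n ∙ E ∙ f ⊞ ι n ⊡ X ∙ pow (L u) (n ∸ 1) ∙ f) ⊞ X ∙ g
      ≈⟨ ⊞-cong (ap-⊞ (L u) _ _) ≈-refl ⟩
    L u ∙ pow (L u) n ∙ E ∙ f ⊞ L u ∙ (ι n ⊡ X ∙ pow (L u) (n ∸ 1) ∙ f) ⊞ X ∙ g
      ≈⟨ ⊞-cong (⊞-cong ≈-refl (lower n)) ≈-refl ⟩
    L u ∙ pow (L u) n ∙ E ∙ f ⊞ ι n ⊡ X ∙ g ⊞ X ∙ g
      ≈⟨ coefs (λ m → trans (solve 3 (λ a i x → a :+ i :* x :+ x := a :+ (:1 :+ i) :* x) refl
           (coef (L u ∙ pow (L u) n ∙ E ∙ f) m) (ι n) (coef (X ∙ g) m))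
           (cong (λ z → coef (L u ∙ pow (L u) n ∙ E ∙ f) m +ᶠ z *ᶠ coef (X ∙ g) m) (sym (ι-suc n)))) ⟩
    pow (L u) (suc n) ∙ E ∙ f ⊞ ι (suc n) ⊡ X ∙ g  ∎
    where
    g = pow (L u) n ∙ f
    lower : ∀ n → L u ∙ (ι n ⊡ X ∙ pow (L u) (n ∸ 1) ∙ f) ≈ ι n ⊡ X ∙ pow (L u) n ∙ f
    lower zero    = ≈-trans (ap-⊡ (L u) _ _) (coefs λ m → trans (zeroˡ _) (sym (zeroˡ _)))
    lower (suc n) = ≈-trans (ap-⊡ (L u) _ _) (⊡-cong refl (L-X u _))

  -- Leibniz rule for a power, with θ (X - u) = X (X - 1).
  θ-powL : ∀ u n f → θ ∙ pow (L u) n ∙ f ≈ pow (L u) n ∙ θ ∙ f ⊞ ι n ⊡ X ∙ L 1ᶠ ∙ pow (L u) (n ∸ 1) ∙ f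
  θ-powL u n f = begin
    L 1ᶠ ∙ E ∙ pow (L u) n ∙ f  ≈⟨ ap-≈ (L 1ᶠ) (E-powL u n f) ⟩
    L 1ᶠ ∙ (pow (L u) n ∙ E ∙ f ⊞ ι n ⊡ X ∙ pow (L u) (n ∸ 1) ∙ f)  ≈⟨ ap-⊞ (L 1ᶠ) _ _ ⟩
    L 1ᶠ ∙ pow (L u) n ∙ E ∙ f ⊞ L 1ᶠ ∙ (ι n ⊡ X ∙ pow (L u) (n ∸ 1) ∙ f)
      ≈⟨ ⊞-cong (pow-comm (L 1ᶠ) (L u) (L-comm 1ᶠ u) n (E ∙ f))
          (≈-trans (ap-⊡ (L 1ᶠ) _ _) (⊡-cong refl (L-X 1ᶠ _))) ⟩
    pow (L u) n ∙ θ ∙ f ⊞ ι n ⊡ X ∙ L 1ᶠ ∙ pow (L u) (n ∸ 1) ∙ f  ∎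

  record DegreeBelow (n : ℕ) (f : Poly) : Set where
    constructor below
    field above : ∀ {m} → n ≤ m → coef f m ≡ 0ᶠ
  open DegreeBelow public

  deg-mono : ∀ {m n f} → m ≤ n → DegreeBelow m f → DegreeBelow n f
  deg-mono m≤n d = below λ n≤k → above d (ℕ.≤-trans m≤n n≤k)

  deg-≈ : ∀ {n f g} → f ≈ g → DegreeBelow n f → DegreeBelow n g
  deg-≈ e d = below λ {m} n≤m → trans (sym (at e m)) (above d n≤m)

  deg-𝟘 : ∀ {n} → DegreeBelow n 𝟘
  deg-𝟘 = below λ _ → refl

  deg-⊞ : ∀ {n f g} → DegreeBelow n f → DegreeBelow n g → DegreeBelow n (f ⊞ g)
  deg-⊞ d e = below λ n≤m → trans (cong₂ _+ᶠ_ (above d n≤m) (above e n≤m)) (+-identityˡ 0ᶠ)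

  deg-⊡ : ∀ {n f} c → DegreeBelow n f → DegreeBelow n (c ⊡ f)
  deg-⊡ c d = below λ n≤m → trans (cong (c *ᶠ_) (above d n≤m)) (zeroʳ c)

  deg-X : ∀ {n f} → DegreeBelow n f → DegreeBelow (suc n) (X ∙ f)
  deg-X d = below λ { {suc m} (s≤s n≤m) → above d n≤m }

  deg-L : ∀ {n f} u → DegreeBelow n f → DegreeBelow (suc n) (L u ∙ f)
  deg-L u d = deg-⊞ (deg-X d) (deg-⊡ _ (deg-mono (ℕ.n≤1+n _) d))

  deg-θ : ∀ {n f} → DegreeBelow n f → DegreeBelow (suc n) (θ ∙ f)
  deg-θ d = deg-L 1ᶠ (below λ {m} n≤m → trans (cong (ι m *ᶠ_) (above d n≤m)) (zeroʳ _))

  deg-pow : ∀ A → (∀ {n f} → DegreeBelow n f → DegreeBelow (suc n) (A ∙ f)) →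
            ∀ k {n f} → DegreeBelow n f → DegreeBelow (k + n) (pow A k ∙ f)
  deg-pow A h zero    d = d
  deg-pow A h (suc k) d = h (deg-pow A h k d)

  deg0⇒≈𝟘 : ∀ {f} → DegreeBelow 0 f → f ≈ 𝟘
  deg0⇒≈𝟘 d = coefs λ n → above d z≤n

  -- The coefficient of X^{m+1} in (X - u) f is f_m - u f_{m+1}, so vanishing descends from
  -- `bound f`. The truncation at n = 0 is intended: it says that (X - u) f = 0 forces f = 0, which
  -- is `L-cancel`.
  deg-L⁻ : ∀ u {n} f → DegreeBelow n (L u ∙ f) → DegreeBelow (n ∸ 1) f
  deg-L⁻ u {n} f d = below λ {m} n∸1≤m → down (bound f) m n∸1≤m (ℕ.m≤n+m _ m)
    where
    down : ∀ k m → n ∸ 1 ≤ m → bound f ≤ m + k → coef f m ≡ 0ᶠ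
    down zero    m _     b = vanish f (subst (bound f ≤_) (ℕ.+-identityʳ m) b)
    down (suc k) m n∸1≤m b = trans
      (trans (solve 2 (λ a u → a := a :+ :- u :* con 0ℤ) refl (coef f m) u)
             (cong (λ z → coef f m +ᶠ -ᶠ u *ᶠ z)
                (sym (down k (suc m) (ℕ.m≤n⇒m≤1+n n∸1≤m) (subst (bound f ≤_) (ℕ.+-suc m k) b)))))
      (above d (ℕ.≤-trans (ℕ.m≤n+m∸n n 1) (s≤s n∸1≤m)))

  L-cancel : ∀ u {f g} → L u ∙ f ≈ L u ∙ g → f ≈ g
  L-cancel u {f} {g} e = ⊟≈𝟘⇒≈ (deg0⇒≈𝟘 (deg-L⁻ u {0} (f ⊟ g)
    (deg-≈ (≈-sym (≈-trans (ap-⊟ (L u) f g) (≈⇒⊟≈𝟘 e))) deg-𝟘)))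

  powL-cancel : ∀ u n {f g} → pow (L u) n ∙ f ≈ pow (L u) n ∙ g → f ≈ g
  powL-cancel u zero    e = e
  powL-cancel u (suc n) e = powL-cancel u n (L-cancel u e)

  deg-powL⁻ : ∀ u k {n} f → DegreeBelow n (pow (L u) k ∙ f) → DegreeBelow (n ∸ k) f
  deg-powL⁻ u zero    f d = d
  deg-powL⁻ u (suc k) {n} f d = subst (λ m → DegreeBelow m f) (ℕ.∸-+-assoc n 1 k)
    (deg-powL⁻ u k f (deg-L⁻ u _ d))

-- Zeros with multiplicity, and polynomials with few terms.

module Multiplicity {p : ℕ} (𝔽 : PrimeField p) where
  open FieldProperties 𝔽
  open Polynomials 𝔽
  open import Relation.Binary.Reasoning.Setoid ≈-setoid

  infix 4 _≈_[mod_] [_]^_∣_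

  record _≈_[mod_] (f g : Poly) (u : Fin p) : Set where
    constructor _by_
    field
      quot  : Poly
      equal : f ≈ g ⊞ L u ∙ quot

  record [_]^_∣_ (u : Fin p) (k : ℕ) (f : Poly) : Set where
    constructor _by_
    field
      quot  : Poly
      equal : f ≈ pow (L u) k ∙ quot

  mod-≈ : ∀ {u f g} → f ≈ g → f ≈ g [mod u ]
  mod-≈ {u} {f} {g} e = 𝟘 by ≈-trans e (≈-trans
    (coefs λ n → sym (trans (+-comm _ _) (+-identityˡ (coef g n))))
    (⊞-cong ≈-refl (≈-sym (ap-𝟘 (L u)))))

  mod-trans : ∀ {u f g h} → f ≈ g [mod u ] → g ≈ h [mod u ] → f ≈ h [mod u ]
  mod-trans {u} {f} {g} {h} (q by d) (r by e) = (r ⊞ q) by (begin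
    f                            ≈⟨ d ⟩
    g ⊞ L u ∙ q                  ≈⟨ ⊞-cong e ≈-refl ⟩
    h ⊞ L u ∙ r ⊞ L u ∙ q        ≈⟨ coefs (λ n → +-assoc _ _ _) ⟩
    h ⊞ (L u ∙ r ⊞ L u ∙ q)      ≈⟨ ⊞-cong ≈-refl (ap-⊞ (L u) r q) ⟨
    h ⊞ L u ∙ (r ⊞ q)            ∎)

  mod-⊞ : ∀ {u f f′ g g′} → f ≈ f′ [mod u ] → g ≈ g′ [mod u ] → f ⊞ g ≈ f′ ⊞ g′ [mod u ]
  mod-⊞ {u} {f} {f′} {g} {g′} (q by d) (r by e) = (q ⊞ r) by (begin
    f ⊞ g                                  ≈⟨ ⊞-cong d e ⟩
    (f′ ⊞ L u ∙ q) ⊞ (g′ ⊞ L u ∙ r)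
      ≈⟨ coefs (λ n → solve 4 (λ a b c d → (a :+ b) :+ (c :+ d) := (a :+ c) :+ (b :+ d)) refl (coef f′ n)
          (coef (L u ∙ q) n) (coef g′ n) (coef (L u ∙ r) n)) ⟩
    (f′ ⊞ g′) ⊞ (L u ∙ q ⊞ L u ∙ r)        ≈⟨ ⊞-cong ≈-refl (ap-⊞ (L u) q r) ⟨
    f′ ⊞ g′ ⊞ L u ∙ (q ⊞ r)                ∎)

  -- X - v = (u - v) + (X - u). This takes the place of evaluation at u.
  mod-L : ∀ u v f → L v ∙ f ≈ (u -ᶠ v) ⊡ f [mod u ]
  mod-L u v f = f by coefs λ n →
    solve 4 (λ x a u v → x :+ :- v :* a := (u :- v) :* a :+ (x :+ :- u :* a)) refl (coef (X ∙ f) n) (coef f n) u v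

  mod-powL : ∀ u v k f → pow (L v) k ∙ f ≈ ((u -ᶠ v) ^ᶠ k) ⊡ f [mod u ]
  mod-powL u v zero f = mod-≈ (coefs λ n → sym (*-identityˡ _))
  mod-powL u v (suc k) f = mod-trans (mod-L u v (pow (L v) k ∙ f)) (scale (mod-powL u v k f))
    where
    scale : ∀ {g c h} → g ≈ c ⊡ h [mod u ] → (u -ᶠ v) ⊡ g ≈ ((u -ᶠ v) *ᶠ c) ⊡ h [mod u ]
    scale {g} {c} {h} (q by e) = ((u -ᶠ v) ⊡ q) by (begin
      (u -ᶠ v) ⊡ g                                       ≈⟨ ⊡-cong refl e ⟩
      (u -ᶠ v) ⊡ (c ⊡ h ⊞ L u ∙ q)
        ≈⟨ coefs (λ n → solve 4 (λ w c h q → w :* (c :* h :+ q) := w :* c :* h :+ w :* q) refl (u -ᶠ v) c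
            (coef h n) (coef (L u ∙ q) n)) ⟩
      ((u -ᶠ v) *ᶠ c) ⊡ h ⊞ (u -ᶠ v) ⊡ L u ∙ q           ≈⟨ ⊞-cong ≈-refl (ap-⊡ (L u) _ q) ⟨
      ((u -ᶠ v) *ᶠ c) ⊡ h ⊞ L u ∙ ((u -ᶠ v) ⊡ q)         ∎)

  ∣-≈ : ∀ {u k f g} → f ≈ g → [ u ]^ k ∣ f → [ u ]^ k ∣ g
  ∣-≈ e (q by d) = q by ≈-trans (≈-sym e) d

  mod-𝟘⇒∣ : ∀ {u f} → f ≈ 𝟘 [mod u ] → [ u ]^ 1 ∣ f
  mod-𝟘⇒∣ (q by e) = q by ≈-trans e (coefs λ n → +-identityˡ _)

  ∣-cancel-⊡ : ∀ {u k c f} → c ≢ 0ᶠ → [ u ]^ k ∣ c ⊡ f → [ u ]^ k ∣ f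
  ∣-cancel-⊡ {u} {k} {c} {f} c≢0 (q by e) = (c ⁻¹ ⊡ q) by (begin
    f
      ≈⟨ coefs (λ n → trans (sym (*-identityˡ _)) (cong (_*ᶠ coef f n) (sym (⁻¹-inverse c≢0)))) ⟩
    (c *ᶠ c ⁻¹) ⊡ f
      ≈⟨ coefs (λ n → solve 3 (λ c i a → c :* i :* a := i :* (c :* a)) refl c (c ⁻¹) (coef f n)) ⟩
    c ⁻¹ ⊡ (c ⊡ f)              ≈⟨ ⊡-cong refl e ⟩
    c ⁻¹ ⊡ pow (L u) k ∙ q      ≈⟨ ap-⊡ (pow (L u) k) _ q ⟨
    pow (L u) k ∙ (c ⁻¹ ⊡ q)    ∎)

  -- Because (u - v) f = (X - v) f - (X - u) f, with u - v invertible.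
  ∣L⇒∣ : ∀ {u v f} → u ≢ v → [ u ]^ 1 ∣ L v ∙ f → [ u ]^ 1 ∣ f
  ∣L⇒∣ {u} {v} {f} u≢v (q by e) = ∣-cancel-⊡ {c = u -ᶠ v} (λ eq → u≢v (-ᶠ≡0⇒≡ eq)) ((q ⊟ f) by (begin
    (u -ᶠ v) ⊡ f
      ≈⟨ coefs (λ n → solve 4 (λ x a u v → (u :- v) :* a := (x :+ :- v :* a) :+ :- :1 :* (x :+ :- u :* a))
          refl (coef (X ∙ f) n) (coef f n) u v) ⟩
    L v ∙ f ⊟ L u ∙ f   ≈⟨ ⊞-cong e ≈-refl ⟩
    L u ∙ q ⊟ L u ∙ f   ≈⟨ ap-⊟ (L u) q f ⟨
    L u ∙ (q ⊟ f)       ∎))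

  -- Induction on D, applied to both f and θ f. If f = (X - u)^{m+1} g and θ f = (X - u)^{m+1} r,
  -- the Leibniz rule and cancellation of (X - u)^m give (m + 1) X (X - 1) g = (X - u) (r - θ g). As
  -- u is neither 0 nor 1, X - u divides g.
  θ-vanishing⇒∣ : ∀ {u} → u ≢ 0ᶠ → u ≢ 1ᶠ → ∀ D → D ≤ p → ∀ f →
                  (∀ k → k < D → [ u ]^ 1 ∣ pow θ k ∙ f) → [ u ]^ D ∣ f
  θ-vanishing⇒∣ u≢0 u≢1 zero D≤p f h = f by ≈-refl
  θ-vanishing⇒∣ u≢0 u≢1 (suc zero) D≤p f h = h 0 (s≤s z≤n)
  θ-vanishing⇒∣ {u} u≢0 u≢1 (suc (suc m)) D≤p f h
    with θ-vanishing⇒∣ u≢0 u≢1 (suc m) (ℕ.<⇒≤ D≤p) f (λ k k<D → h k (ℕ.m<n⇒m<1+n k<D))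
       | θ-vanishing⇒∣ u≢0 u≢1 (suc m) (ℕ.<⇒≤ D≤p) (θ ∙ f)
           (λ k k<D → ∣-≈ (pow-comm θ θ (λ _ → ≈-refl) k f) (h (suc k) (s≤s k<D)))
  ... | g by e | r by d = extend (∣L⇒∣ {v = 1ᶠ} u≢1 (∣L⇒∣ {v = 0ᶠ} u≢0 L₀L₁g))
    where
    Lᵐ = pow (L u) m
    key : Lᵐ ∙ (ι (suc m) ⊡ L 0ᶠ ∙ L 1ᶠ ∙ g) ≈ Lᵐ ∙ L u ∙ (r ⊟ θ ∙ g)
    key = begin
      Lᵐ ∙ (ι (suc m) ⊡ L 0ᶠ ∙ L 1ᶠ ∙ g)       ≈⟨ ap-⊡ Lᵐ _ _ ⟩
      ι (suc m) ⊡ Lᵐ ∙ L 0ᶠ ∙ L 1ᶠ ∙ g         ≈⟨ ⊡-cong refl (pow-comm (L 0ᶠ) (L u) (L-comm 0ᶠ u) m _) ⟨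
      ι (suc m) ⊡ L 0ᶠ ∙ Lᵐ ∙ L 1ᶠ ∙ g
        ≈⟨ ⊡-cong refl (ap-≈ (L 0ᶠ) (pow-comm (L 1ᶠ) (L u) (L-comm 1ᶠ u) m g)) ⟨
      ι (suc m) ⊡ L 0ᶠ ∙ L 1ᶠ ∙ Lᵐ ∙ g         ≈⟨ ⊡-cong refl (L₀≈X _) ⟩
      ι (suc m) ⊡ X ∙ L 1ᶠ ∙ Lᵐ ∙ g
        ≈⟨ coefs (λ n → solve 2 (λ a b → b := (a :+ b) :+ :- :1 :* a) refl (coef (L u ∙ Lᵐ ∙ θ ∙ g) n)
            (coef (ι (suc m) ⊡ X ∙ L 1ᶠ ∙ Lᵐ ∙ g) n)) ⟩
      (L u ∙ Lᵐ ∙ θ ∙ g ⊞ ι (suc m) ⊡ X ∙ L 1ᶠ ∙ Lᵐ ∙ g) ⊟ L u ∙ Lᵐ ∙ θ ∙ g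
                                              ≈⟨ ⊞-cong (θ-powL u (suc m) g) ≈-refl ⟨
      θ ∙ L u ∙ Lᵐ ∙ g ⊟ L u ∙ Lᵐ ∙ θ ∙ g      ≈⟨ ⊞-cong (≈-trans (ap-≈ θ (≈-sym e)) d) ≈-refl ⟩
      L u ∙ Lᵐ ∙ r ⊟ L u ∙ Lᵐ ∙ θ ∙ g
        ≈⟨ ⊞-cong (pow-comm (L u) (L u) (λ _ → ≈-refl) m r)
            (⊡-cong refl (pow-comm (L u) (L u) (λ _ → ≈-refl) m _)) ⟩
      Lᵐ ∙ L u ∙ r ⊟ Lᵐ ∙ L u ∙ θ ∙ g          ≈⟨ ap-⊟ (Lᵐ ⊚ L u) r (θ ∙ g) ⟨
      Lᵐ ∙ L u ∙ (r ⊟ θ ∙ g)                  ∎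
    L₀L₁g : [ u ]^ 1 ∣ L 0ᶠ ∙ L 1ᶠ ∙ g
    -- Here D = m + 2 ≤ p, so the numeral m + 1 is nonzero.
    L₀L₁g = ∣-cancel-⊡ (numeral≢0 (s≤s z≤n) D≤p) ((r ⊟ θ ∙ g) by powL-cancel u m key)
    extend : [ u ]^ 1 ∣ g → [ u ]^ suc (suc m) ∣ f
    extend (q by e′) = q by (begin
      f                            ≈⟨ e ⟩
      L u ∙ Lᵐ ∙ g                 ≈⟨ ap-≈ (pow (L u) (suc m)) e′ ⟩
      L u ∙ Lᵐ ∙ L u ∙ q           ≈⟨ ap-≈ (L u) (pow-comm (L u) (L u) (λ _ → ≈-refl) m q) ⟨
      pow (L u) (suc (suc m)) ∙ q  ∎)

  -- Coprimality of X - u and X - v: by `∣L⇒∣` one factor X - u splits off f, is cancelled, and the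
  -- rest is induction.
  ∣^L⇒∣^ : ∀ {u v} → u ≢ v → ∀ k {f} → [ u ]^ k ∣ L v ∙ f → [ u ]^ k ∣ f
  ∣^L⇒∣^ u≢v zero {f} _ = f by ≈-refl
  ∣^L⇒∣^ {u} {v} u≢v (suc k) {f} (q by e) = split (∣L⇒∣ u≢v ((pow (L u) k ∙ q) by e))
    where
    extend : ∀ {g} → f ≈ L u ∙ g → [ u ]^ k ∣ g → [ u ]^ suc k ∣ f
    extend d (r by c) = r by ≈-trans d (ap-≈ (L u) c)
    split : [ u ]^ 1 ∣ f → [ u ]^ suc k ∣ f
    split (g by d) = extend d (∣^L⇒∣^ u≢v k {g} (q by L-cancel u (begin
      L u ∙ L v ∙ g           ≈⟨ L-comm u v g ⟩
      L v ∙ L u ∙ g           ≈⟨ ap-≈ (L v) d ⟨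
      L v ∙ f                 ≈⟨ e ⟩
      L u ∙ pow (L u) k ∙ q   ∎)))

  ∣^powL⇒∣^ : ∀ {u v} → u ≢ v → ∀ k n {f} → [ u ]^ k ∣ pow (L v) n ∙ f → [ u ]^ k ∣ f
  ∣^powL⇒∣^ u≢v k zero    d = d
  ∣^powL⇒∣^ u≢v k (suc n) d = ∣^powL⇒∣^ u≢v k n (∣^L⇒∣^ u≢v k d)

  rootProduct : ℕ → List (Fin p) → Linear
  rootProduct D = foldr (λ u A → pow (L u) D ⊚ A) id

  rootProduct-∣ : ∀ D us → Unique us → ∀ {f} → All (λ u → [ u ]^ D ∣ f) us → ∃[ g ] f ≈ rootProduct D us ∙ g
  rootProduct-∣ D [] _ {f} _ = f , ≈-refl
  rootProduct-∣ D (u ∷ us) (u≢us ∷ uniq) {f} ((q by e) ∷ ds)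
    with rootProduct-∣ D us uniq (All.map (λ { (u≢v , d) → ∣^powL⇒∣^ (u≢v ∘ sym) D D (∣-≈ e d) })
        (All.zip (u≢us , ds)))
  ... | g , e′ = g , ≈-trans e (ap-≈ (pow (L u) D) e′)

  deg-rootProduct⁻ : ∀ D us {n} g → DegreeBelow n (rootProduct D us ∙ g) → DegreeBelow (n ∸ D * length us) g
  deg-rootProduct⁻ D []       {n} g d = subst (λ k → DegreeBelow (n ∸ k) g) (sym (ℕ.*-zeroʳ D)) d
  deg-rootProduct⁻ D (u ∷ us) {n} g d = subst (λ k → DegreeBelow k g)
    (trans (ℕ.∸-+-assoc n D _) (cong (n ∸_) (sym (ℕ.*-suc D (length us)))))
    (deg-rootProduct⁻ D us g (deg-powL⁻ u D _ d))

  -- f is divisible by the product of all (X - u)^D. Were D * length us larger than n, the truncated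
  -- difference of degrees would be 0 and the quotient would vanish.
  multiplicity-bound : ∀ {D us n f} → Unique us → All (λ u → [ u ]^ D ∣ f) us →
                       DegreeBelow n f → ¬ (f ≈ 𝟘) → D * length us ≤ n
  multiplicity-bound {D} {us} {n} {f} uniq ds deg f≉𝟘 with D * length us ℕ.≤? n
  ... | yes le = le
  ... | no  ≰  with rootProduct-∣ D us uniq ds
  ... | g , e = ⊥-elim (f≉𝟘 (≈-trans e (≈-trans (ap-≈ (rootProduct D us) g≈𝟘) (ap-𝟘 (rootProduct D us)))))
    where
    g≈𝟘 : g ≈ 𝟘
    g≈𝟘 = deg0⇒≈𝟘 (subst (λ k → DegreeBelow k g) (ℕ.m≤n⇒m∸n≡0 (ℕ.<⇒≤ (ℕ.≰⇒> ≰)))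
      (deg-rootProduct⁻ D us g (deg-≈ e deg)))

  ι-separates : ∀ {m n} → m < n → n < p → ι m ≢ ι n
  ι-separates {m} {n} m<n n<p eq = numeral≢0 (ℕ.m<n⇒0<n∸m m<n) (ℕ.≤-<-trans (ℕ.m∸n≤m n m) n<p)
    (trans (solve 2 (λ a b → b := (a :+ b) :- a) refl (ι m) (ι (n ∸ m)))
      (trans (cong (_-ᶠ ι m) (trans (sym (ι-+ m (n ∸ m))) (trans (cong ι (ℕ.m+[n∸m]≡n (ℕ.<⇒≤ m<n))) (sym eq))))
        (-‿inverseʳ (ι m))))

  ι-injective : ∀ {m n} → m < p → n < p → ι m ≡ ι n → m ≡ n
  ι-injective {m} {n} m<p n<p eq with ℕ.<-cmp m n
  ... | tri< m<n _ _ = ⊥-elim (ι-separates m<n n<p eq)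
  ... | tri≈ _ m≡n _ = m≡n
  ... | tri> _ _ n<m = ⊥-elim (ι-separates n<m m<p (sym eq))

  SupportedOn : List ℕ → Poly → Set
  SupportedOn S f = ∀ n → n ∈ S ⊎ coef f n ≡ 0ᶠ

  -- The quotient h by X - 1 has degree below e, and its coefficients below e vanish successively by
  -- h_k = h_{k-1} - f_k; hence f_e = h_{e-1} - h_e = 0.
  monomial-not-divisible : ∀ {e f} → (∀ n → n ≡ e ⊎ coef f n ≡ 0ᶠ) → [ 1ᶠ ]^ 1 ∣ f → coef f e ≡ 0ᶠ
  monomial-not-divisible {e} {f} supp (h by eq) = trans (at eq e) (at-e e (λ k k<e → k<e) h-e)
    where
    low : ∀ k → k < e → coef f k ≡ 0ᶠ
    low k k<e with supp k
    ... | inj₁ refl = ⊥-elim (ℕ.<-irrefl refl k<e)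
    ... | inj₂ z    = z
    deg-f : DegreeBelow (suc e) f
    deg-f = below λ {m} e<m → [ (λ { refl → ⊥-elim (ℕ.<-irrefl refl e<m) }) , (λ z → z) ]′ (supp m)
    h-e : coef h e ≡ 0ᶠ
    h-e = above (deg-L⁻ 1ᶠ h (deg-≈ eq deg-f)) ℕ.≤-refl
    h-low : ∀ k → k < e → coef h k ≡ 0ᶠ
    h-low zero k<e = trans (solve 1 (λ a → a := :- (con 0ℤ :+ :- :1 :* a)) refl (coef h 0))
      (trans (cong -ᶠ_ (trans (sym (at eq 0)) (low 0 k<e))) (solve 0 (:- con 0ℤ := con 0ℤ) refl))
    h-low (suc k) k<e = trans (solve 2 (λ a b → b := a :- (a :+ :- :1 :* b)) refl (coef h k) (coef h (suc k)))
      (trans (cong₂ _-ᶠ_ (h-low k (ℕ.<⇒≤ k<e)) (trans (sym (at eq (suc k))) (low (suc k) k<e)))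
             (-‿inverseʳ 0ᶠ))
    at-e : ∀ m → (∀ k → k < m → k < e) → coef h m ≡ 0ᶠ → coef (L 1ᶠ ∙ h) m ≡ 0ᶠ
    at-e zero    _ z =
      trans (cong (λ a → 0ᶠ +ᶠ -ᶠ 1ᶠ *ᶠ a) z) (solve 0 (con 0ℤ :+ :- :1 :* con 0ℤ := con 0ℤ) refl)
    at-e (suc m) b z =
      trans (cong₂ (λ c a → c +ᶠ -ᶠ 1ᶠ *ᶠ a) (h-low m (b m ℕ.≤-refl)) z)
          (solve 0 (con 0ℤ :+ :- :1 :* con 0ℤ := con 0ℤ) refl)

  -- Applying X d/dX − e kills the term of degree e and costs one factor X − 1.
  sparse-vanish : ∀ S {f} → All (_< p) S → SupportedOn S f → [ 1ᶠ ]^ length S ∣ f → f ≈ 𝟘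
  sparse-vanish [] _ supp _ = coefs λ n → [ (λ ()) , (λ z → z) ]′ (supp n)
  sparse-vanish (e ∷ S) {f} (e<p ∷ S<p) supp (h by eq) = coefs λ n → zero-at n (n ℕ.≟ e)
    where
    g : Poly
    g = E ∙ f ⊞ (-ᶠ ι e) ⊡ f
    r = length S
    L₁ʳ = pow (L 1ᶠ) r
    g-supp : SupportedOn S g
    g-supp n with supp n
    ... | inj₁ (here refl) = inj₂ (solve 2 (λ i a → i :* a :+ :- i :* a := con 0ℤ) refl (ι n) (coef f n))
    ... | inj₁ (there n∈S) = inj₁ n∈S
    ... | inj₂ z           = inj₂ (trans (cong (λ a → ι n *ᶠ a +ᶠ -ᶠ ι e *ᶠ a) z)
                                 (solve 2 (λ i j → i :* con 0ℤ :+ :- j :* con 0ℤ := con 0ℤ) refl (ι n) (ι e)))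
    g-div : [ 1ᶠ ]^ r ∣ g
    g-div = (L 1ᶠ ∙ E ∙ h ⊞ ι (suc r) ⊡ X ∙ h ⊞ (-ᶠ ι e) ⊡ L 1ᶠ ∙ h) by (begin
      E ∙ f ⊞ (-ᶠ ι e) ⊡ f   ≈⟨ ⊞-cong (ap-≈ E eq) (⊡-cong refl eq) ⟩
      E ∙ L 1ᶠ ∙ L₁ʳ ∙ h ⊞ (-ᶠ ι e) ⊡ L 1ᶠ ∙ L₁ʳ ∙ h
        ≈⟨ ⊞-cong (E-powL 1ᶠ (suc r) h) ≈-refl ⟩
      L 1ᶠ ∙ L₁ʳ ∙ E ∙ h ⊞ ι (suc r) ⊡ X ∙ L₁ʳ ∙ h ⊞ (-ᶠ ι e) ⊡ L 1ᶠ ∙ L₁ʳ ∙ h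
        ≈⟨ ⊞-cong (⊞-cong (L-Lʳ _) (≈-trans (⊡-cong refl (pow-comm X (L 1ᶠ) (λ f → ≈-sym (L-X 1ᶠ f)) r h))
            (≈-sym (ap-⊡ L₁ʳ _ _))))
             (≈-trans (⊡-cong refl (L-Lʳ h)) (≈-sym (ap-⊡ L₁ʳ _ _))) ⟩
      L₁ʳ ∙ L 1ᶠ ∙ E ∙ h ⊞ L₁ʳ ∙ (ι (suc r) ⊡ X ∙ h) ⊞ L₁ʳ ∙ ((-ᶠ ι e) ⊡ L 1ᶠ ∙ h)
        ≈⟨ ≈-trans (ap-⊞ L₁ʳ _ _) (⊞-cong (ap-⊞ L₁ʳ _ _) ≈-refl) ⟨
      L₁ʳ ∙ (L 1ᶠ ∙ E ∙ h ⊞ ι (suc r) ⊡ X ∙ h ⊞ (-ᶠ ι e) ⊡ L 1ᶠ ∙ h) ∎)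
      where
      L-Lʳ : ∀ f → L 1ᶠ ∙ L₁ʳ ∙ f ≈ L₁ʳ ∙ L 1ᶠ ∙ f
      L-Lʳ = pow-comm (L 1ᶠ) (L 1ᶠ) (λ _ → ≈-refl) r
    g≈𝟘 : g ≈ 𝟘
    g≈𝟘 = sparse-vanish S S<p g-supp g-div
    off-e : ∀ n → n ≢ e → coef f n ≡ 0ᶠ
    off-e n n≢e with supp n
    ... | inj₂ z = z
    ... | inj₁ n∈ = *-cancelˡ (ι n -ᶠ ι e)
      (λ eq → n≢e (ι-injective (All.lookup (e<p ∷ S<p) n∈) e<p (-ᶠ≡0⇒≡ eq)))
      (trans (solve 3 (λ i j a → (i :- j) :* a := i :* a :+ :- j :* a) refl (ι n) (ι e) (coef f n))
             (trans (at g≈𝟘 n) (sym (zeroʳ _))))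
    zero-at : ∀ n → Dec (n ≡ e) → coef f n ≡ 0ᶠ
    zero-at n (no n≢e)   = off-e n n≢e
    -- Only the monomial of degree e is left, and a single factor X - 1 kills it.
    zero-at n (yes refl) = monomial-not-divisible {n} {f} (λ m → single m (m ℕ.≟ n)) ((L₁ʳ ∙ h) by eq)
      where
      single : ∀ m → Dec (m ≡ n) → m ≡ n ⊎ coef f m ≡ 0ᶠ
      single m (yes m≡n) = inj₁ m≡n
      single m (no m≢n)  = inj₂ (off-e m m≢n)

-- Stepanov's auxiliary polynomial.

module Stepanov {p : ℕ} (𝔽 : PrimeField p) where
  open FieldProperties 𝔽
  open Polynomials 𝔽
  open Multiplicity 𝔽
  open import Relation.Binary.Reasoning.Setoid ≈-setoid

  ∑ : ∀ {n} → (Fin n → Poly) → Poly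
  ∑ {zero}  f = 𝟘
  ∑ {suc n} f = f zero ⊞ ∑ (f ∘ suc)

  ∑-≈ : ∀ {n} {f g : Fin n → Poly} → (∀ i → f i ≈ g i) → ∑ f ≈ ∑ g
  ∑-≈ {zero}  e = ≈-refl
  ∑-≈ {suc n} e = ⊞-cong (e zero) (∑-≈ (e ∘ suc))

  ap-∑ : ∀ A {n} (f : Fin n → Poly) → A ∙ ∑ f ≈ ∑ (λ i → A ∙ f i)
  ap-∑ A {zero}  f = ap-𝟘 A
  ap-∑ A {suc n} f = ≈-trans (ap-⊞ A _ _) (⊞-cong ≈-refl (ap-∑ A (f ∘ suc)))

  ∑-⊟ : ∀ {n} (f g : Fin n → Poly) → ∑ (λ i → f i ⊟ g i) ≈ ∑ f ⊟ ∑ g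
  ∑-⊟ {zero}  f g = coefs λ n → solve 0 (con 0ℤ := con 0ℤ :+ :- :1 :* con 0ℤ) refl
  ∑-⊟ {suc n} f g = ≈-trans (⊞-cong ≈-refl (∑-⊟ (f ∘ suc) (g ∘ suc))) (coefs λ n →
    solve 4 (λ a b c d → (a :+ :- :1 :* b) :+ (c :+ :- :1 :* d) := (a :+ c) :+ :- :1 :* (b :+ d)) refl
      (coef (f zero) n) (coef (g zero) n) (coef (∑ (f ∘ suc)) n) (coef (∑ (g ∘ suc)) n))

  deg-∑ : ∀ {n m} {f : Fin n → Poly} → (∀ i → DegreeBelow m (f i)) → DegreeBelow m (∑ f)
  deg-∑ {zero}  d = deg-𝟘
  deg-∑ {suc n} d = deg-⊞ (d zero) (deg-∑ (d ∘ suc))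

  mod-∑ : ∀ {u n} {f g : Fin n → Poly} → (∀ i → f i ≈ g i [mod u ]) → ∑ f ≈ ∑ g [mod u ]
  mod-∑ {n = zero}  e = mod-≈ ≈-refl
  mod-∑ {n = suc n} e = mod-⊞ (e zero) (mod-∑ (e ∘ suc))

  ∑-supported : ∀ {n D} (f : Fin n → Poly) (S : Fin n → List ℕ) →
    (∀ i → length (S i) ≡ D) → (∀ i → All (_< p) (S i)) → (∀ i → SupportedOn (S i) (f i)) →
    ∃[ T ] length T ≡ n * D × All (_< p) T × SupportedOn T (∑ f)
  ∑-supported {zero}  f S len S<p supp = [] , refl , [] , λ _ → inj₂ refl
  ∑-supported {suc n} f S len S<p supp with ∑-supported (f ∘ suc) (S ∘ suc) (len ∘ suc) (S<p ∘ suc) (supp ∘ suc)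
  ... | T , lenT , T<p , suppT =
    S zero ++ T , trans (List.length-++ (S zero)) (cong₂ _+_ (len zero) lenT) , All.++⁺ (S<p zero) T<p , supp′
    where
    supp′ : SupportedOn (S zero ++ T) (∑ f)
    supp′ m with supp zero m | suppT m
    ... | inj₁ m∈ | _       = inj₁ (∈-++⁺ˡ m∈)
    ... | inj₂ z  | inj₁ m∈ = inj₁ (∈-++⁺ʳ (S zero) m∈)
    ... | inj₂ z  | inj₂ z′ = inj₂ (trans (cong₂ _+ᶠ_ z z′) (+-identityˡ 0ᶠ))

  powL-∑-suc : ∀ u t {n} (f : Fin (suc n) → Poly) →
    ∑ (λ i → pow (L u) (t * toℕ i) ∙ f i) ≈
    f zero ⊞ pow (L u) t ∙ ∑ (λ i → pow (L u) (t * toℕ i) ∙ f (suc i))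
  powL-∑-suc u t f = ⊞-cong
    (subst (λ k → pow (L u) k ∙ f zero ≈ f zero) (sym (ℕ.*-zeroʳ t)) ≈-refl)
    (≈-trans
      (∑-≈ (λ i → subst (λ k → pow (L u) k ∙ f (suc i) ≈ pow (L u) t ∙ pow (L u) (t * toℕ i) ∙ f (suc i))
        (sym (ℕ.*-suc t (toℕ i))) (pow-+ (L u) t (t * toℕ i) (f (suc i)))))
      (≈-sym (ap-∑ (pow (L u) t) (λ i → pow (L u) (t * toℕ i) ∙ f (suc i)))))

  ⊞≈𝟘ʳ : ∀ {f g} → f ≈ 𝟘 → f ⊞ g ≈ 𝟘 → g ≈ 𝟘
  ⊞≈𝟘ʳ d e = coefs λ n → trans (trans (sym (+-identityˡ _)) (cong (_+ᶠ _) (sym (at d n)))) (at e n)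

  powL-≈𝟘 : ∀ u n {f} → pow (L u) n ∙ f ≈ 𝟘 → f ≈ 𝟘
  powL-≈𝟘 u n e = powL-cancel u n (≈-trans e (≈-sym (ap-𝟘 (pow (L u) n))))

  powX-coef : ∀ n f m → coef (pow (L 0ᶠ) n ∙ f) (n + m) ≡ coef f m
  powX-coef zero    f m = refl
  powX-coef (suc n) f m = trans (at (L₀≈X (pow (L 0ᶠ) n ∙ f)) (suc (n + m))) (powX-coef n f m)

  powX-coef-low : ∀ n f {m} → m < n → coef (pow (L 0ᶠ) n ∙ f) m ≡ 0ᶠ
  powX-coef-low (suc n) f {zero}  _         = at (L₀≈X (pow (L 0ᶠ) n ∙ f)) 0
  powX-coef-low (suc n) f {suc m} (s≤s m<n) =
    trans (at (L₀≈X (pow (L 0ᶠ) n ∙ f)) (suc m)) (powX-coef-low n f m<n)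

  -- Since D ≤ t, the blocks occupy disjoint ranges of exponents: the coefficients below t give the
  -- first block, and then Xᵗ is cancelled.
  X-independent : ∀ {t D n} → D ≤ t → (f : Fin n → Poly) → (∀ i → DegreeBelow D (f i)) →
    ∑ (λ i → pow (L 0ᶠ) (t * toℕ i) ∙ f i) ≈ 𝟘 → ∀ i → f i ≈ 𝟘
  X-independent {t} {D} {suc n} D≤t f deg e =
    λ { zero → f₀≈𝟘 ; (suc i) → X-independent D≤t (f ∘ suc) (deg ∘ suc) rest≈𝟘 i }
    where
    rest = ∑ (λ i → pow (L 0ᶠ) (t * toℕ i) ∙ f (suc i))
    e′ : f zero ⊞ pow (L 0ᶠ) t ∙ rest ≈ 𝟘
    e′ = ≈-trans (≈-sym (powL-∑-suc 0ᶠ t f)) e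
    f₀-coef : ∀ m → Dec (m < t) → coef (f zero) m ≡ 0ᶠ
    f₀-coef m (no ≮)    = above (deg zero) (ℕ.≤-trans D≤t (ℕ.≮⇒≥ ≮))
    f₀-coef m (yes m<t) =
      trans (sym (trans (cong (coef (f zero) m +ᶠ_) (powX-coef-low t rest m<t)) (+-identityʳ _))) (at e′ m)
    f₀≈𝟘 : f zero ≈ 𝟘
    f₀≈𝟘 = coefs λ m → f₀-coef m (m ℕ.<? t)
    rest≈𝟘 : rest ≈ 𝟘
    rest≈𝟘 = powL-≈𝟘 0ᶠ t (⊞≈𝟘ʳ f₀≈𝟘 e′)

  powX-supported : ∀ {D f} k → DegreeBelow D f → SupportedOn (map (λ n → k + n) (upTo D)) (pow (L 0ᶠ) k ∙ f)
  powX-supported {D} {f} k deg n with n ℕ.<? k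
  ... | yes n<k = inj₂ (powX-coef-low k f n<k)
  ... | no  n≮k with n ∸ k | ℕ.m+[n∸m]≡n (ℕ.≮⇒≥ n≮k)
  ... | m | refl with m ℕ.<? D
  ... | yes m<D = inj₁ (∈-map⁺ (λ n → k + n) (∈-upTo⁺ m<D))
  ... | no  m≮D = inj₂ (trans (powX-coef k f m) (above deg (ℕ.≮⇒≥ m≮D)))

  module Auxiliary (t : ℕ) where

    term : ℕ → ℕ → Poly → Poly
    term c b f = pow (L 1ᶠ) (t * c) ∙ pow (L 0ᶠ) (t * b) ∙ f

    auxiliary : ∀ {B} → (Fin B → Fin B → Poly) → Poly
    auxiliary P = ∑ λ c → ∑ λ b → term (toℕ c) (toℕ b) (P c b)

    -- θ conjugated by (X - 1)^{tc} X^{tb}, as θ Xⁿ = n (X - 1) Xⁿ and θ (X - 1)ⁿ = n X (X - 1)ⁿ. It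
    -- raises the degree by at most one.
    Θ : ℕ → ℕ → Linear
    Θ c b = θ ⊞ₗ ι (t * b) ⊡ₗ L 1ᶠ ⊞ₗ ι (t * c) ⊡ₗ L 0ᶠ

    lower-pow : ∀ u n f → ι n ⊡ L u ∙ pow (L u) (n ∸ 1) ∙ f ≈ ι n ⊡ pow (L u) n ∙ f
    lower-pow u zero    f = coefs λ m → trans (zeroˡ _) (sym (zeroˡ _))
    lower-pow u (suc n) f = ≈-refl

    θ-powL₁ : ∀ n f → θ ∙ pow (L 1ᶠ) n ∙ f ≈ pow (L 1ᶠ) n ∙ (θ ∙ f ⊞ ι n ⊡ L 0ᶠ ∙ f)
    θ-powL₁ n f = begin
      θ ∙ pow (L 1ᶠ) n ∙ f ≈⟨ θ-powL 1ᶠ n f ⟩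
      pow (L 1ᶠ) n ∙ θ ∙ f ⊞ ι n ⊡ X ∙ L 1ᶠ ∙ pow (L 1ᶠ) (n ∸ 1) ∙ f
        ≈⟨ ⊞-cong ≈-refl (≈-sym (ap-⊡ X _ _)) ⟩
      pow (L 1ᶠ) n ∙ θ ∙ f ⊞ X ∙ (ι n ⊡ L 1ᶠ ∙ pow (L 1ᶠ) (n ∸ 1) ∙ f)
        ≈⟨ ⊞-cong ≈-refl (≈-trans (ap-≈ X (lower-pow 1ᶠ n f)) (≈-sym (L₀≈X _))) ⟩
      pow (L 1ᶠ) n ∙ θ ∙ f ⊞ L 0ᶠ ∙ (ι n ⊡ pow (L 1ᶠ) n ∙ f)
        ≈⟨ ⊞-cong ≈-refl (≈-trans (ap-⊡ (L 0ᶠ) _ _) (⊡-cong refl (pow-comm (L 0ᶠ) (L 1ᶠ) (L-comm 0ᶠ 1ᶠ) n f))) ⟩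
      pow (L 1ᶠ) n ∙ θ ∙ f ⊞ ι n ⊡ pow (L 1ᶠ) n ∙ L 0ᶠ ∙ f
        ≈⟨ ≈-trans (ap-⊞ (pow (L 1ᶠ) n) _ _) (⊞-cong ≈-refl (ap-⊡ (pow (L 1ᶠ) n) _ _)) ⟨
      pow (L 1ᶠ) n ∙ (θ ∙ f ⊞ ι n ⊡ L 0ᶠ ∙ f) ∎

    θ-powL₀ : ∀ n f → θ ∙ pow (L 0ᶠ) n ∙ f ≈ pow (L 0ᶠ) n ∙ (θ ∙ f ⊞ ι n ⊡ L 1ᶠ ∙ f)
    θ-powL₀ n f = begin
      θ ∙ pow (L 0ᶠ) n ∙ f ≈⟨ θ-powL 0ᶠ n f ⟩
      pow (L 0ᶠ) n ∙ θ ∙ f ⊞ ι n ⊡ X ∙ L 1ᶠ ∙ pow (L 0ᶠ) (n ∸ 1) ∙ f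
        ≈⟨ ⊞-cong ≈-refl (⊡-cong refl (≈-trans (≈-sym (L-X 1ᶠ _)) (ap-≈ (L 1ᶠ) (≈-sym (L₀≈X _))))) ⟩
      pow (L 0ᶠ) n ∙ θ ∙ f ⊞ ι n ⊡ L 1ᶠ ∙ L 0ᶠ ∙ pow (L 0ᶠ) (n ∸ 1) ∙ f
        ≈⟨ ⊞-cong ≈-refl (≈-sym (ap-⊡ (L 1ᶠ) _ _)) ⟩
      pow (L 0ᶠ) n ∙ θ ∙ f ⊞ L 1ᶠ ∙ (ι n ⊡ L 0ᶠ ∙ pow (L 0ᶠ) (n ∸ 1) ∙ f)
        ≈⟨ ⊞-cong ≈-refl (ap-≈ (L 1ᶠ) (lower-pow 0ᶠ n f)) ⟩
      pow (L 0ᶠ) n ∙ θ ∙ f ⊞ L 1ᶠ ∙ (ι n ⊡ pow (L 0ᶠ) n ∙ f)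
        ≈⟨ ⊞-cong ≈-refl (≈-trans (ap-⊡ (L 1ᶠ) _ _) (⊡-cong refl (pow-comm (L 1ᶠ) (L 0ᶠ) (L-comm 1ᶠ 0ᶠ) n f))) ⟩
      pow (L 0ᶠ) n ∙ θ ∙ f ⊞ ι n ⊡ pow (L 0ᶠ) n ∙ L 1ᶠ ∙ f
        ≈⟨ ≈-trans (ap-⊞ (pow (L 0ᶠ) n) _ _) (⊞-cong ≈-refl (ap-⊡ (pow (L 0ᶠ) n) _ _)) ⟨
      pow (L 0ᶠ) n ∙ (θ ∙ f ⊞ ι n ⊡ L 1ᶠ ∙ f) ∎

    θ-term : ∀ c b f → θ ∙ term c b f ≈ term c b (Θ c b ∙ f)
    θ-term c b f = begin
      θ ∙ L₁ᶜ ∙ L₀ᵇ ∙ f                                              ≈⟨ θ-powL₁ (t * c) _ ⟩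
      L₁ᶜ ∙ (θ ∙ L₀ᵇ ∙ f ⊞ ι (t * c) ⊡ L 0ᶠ ∙ L₀ᵇ ∙ f)               ≈⟨ ap-≈ L₁ᶜ (⊞-cong (θ-powL₀ (t * b) f)
        (≈-trans (⊡-cong refl (pow-comm (L 0ᶠ) (L 0ᶠ) (λ _ → ≈-refl) (t * b) f)) (≈-sym (ap-⊡ L₀ᵇ _ _)))) ⟩
      L₁ᶜ ∙ (L₀ᵇ ∙ (θ ∙ f ⊞ ι (t * b) ⊡ L 1ᶠ ∙ f) ⊞ L₀ᵇ ∙ (ι (t * c) ⊡ L 0ᶠ ∙ f))
        ≈⟨ ap-≈ L₁ᶜ (ap-⊞ L₀ᵇ _ _) ⟨
      L₁ᶜ ∙ L₀ᵇ ∙ (θ ∙ f ⊞ ι (t * b) ⊡ L 1ᶠ ∙ f ⊞ ι (t * c) ⊡ L 0ᶠ ∙ f)  ∎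
      where
      L₁ᶜ = pow (L 1ᶠ) (t * c)
      L₀ᵇ = pow (L 0ᶠ) (t * b)

    θ^k-auxiliary : ∀ k {B} (P : Fin B → Fin B → Poly) →
      pow θ k ∙ auxiliary P ≈ auxiliary (λ c b → pow (Θ (toℕ c) (toℕ b)) k ∙ P c b)
    θ^k-auxiliary zero    P = ≈-refl
    θ^k-auxiliary (suc k) P = begin
      θ ∙ pow θ k ∙ auxiliary P  ≈⟨ ap-≈ θ (θ^k-auxiliary k P) ⟩
      θ ∙ auxiliary Q            ≈⟨ ap-∑ θ (λ c → ∑ λ b → term (toℕ c) (toℕ b) (Q c b)) ⟩
      ∑ (λ c → θ ∙ ∑ λ b → term (toℕ c) (toℕ b) (Q c b))
        ≈⟨ ∑-≈ (λ c → ≈-trans (ap-∑ θ (λ b → term (toℕ c) (toℕ b) (Q c b)))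
            (∑-≈ λ b → θ-term (toℕ c) (toℕ b) (Q c b))) ⟩
      auxiliary (λ c b → Θ (toℕ c) (toℕ b) ∙ Q c b)  ∎
      where
      Q = λ c b → pow (Θ (toℕ c) (toℕ b)) k ∙ P c b

    -- Only Xᵗ and (X - 1)ᵗ are replaced by values; the P c b stay polynomials. If the result
    -- vanishes identically, Ψ vanishes at every u of the class (α, β) at once.
    evaluate : ∀ {B} → Fin p × Fin p → (Fin B → Fin B → Poly) → Poly
    evaluate (α , β) P = ∑ λ c → ∑ λ b → (β ^ᶠ toℕ c *ᶠ α ^ᶠ toℕ b) ⊡ P c b

    auxiliary-mod : ∀ {B} u (P : Fin B → Fin B → Poly) →
      auxiliary P ≈ evaluate (u ^ᶠ t , (u -ᶠ 1ᶠ) ^ᶠ t) P [mod u ]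
    auxiliary-mod u P = mod-∑ λ c → mod-∑ λ b → mod-trans
      (mod-powL u 1ᶠ (t * toℕ c) _)
      (rescale (mod-powL u 0ᶠ (t * toℕ b) (P c b))
        (cong₂ _*ᶠ_ (sym (^-assocʳ (u -ᶠ 1ᶠ) t (toℕ c)))
          (trans (cong (_^ᶠ (t * toℕ b)) (solve 1 (λ u → u :- con 0ℤ := u) refl u)) (sym (^-assocʳ u t (toℕ b))))))
      where
      rescale : ∀ {c d e f g} → f ≈ d ⊡ g [mod u ] → c *ᶠ d ≡ e → c ⊡ f ≈ e ⊡ g [mod u ]
      rescale {c} {d} {_} {f} {g} (q by eq) refl = (c ⊡ q) by (begin
        c ⊡ f                         ≈⟨ ⊡-cong refl eq ⟩
        c ⊡ (d ⊡ g ⊞ L u ∙ q)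
          ≈⟨ coefs (λ n → solve 4 (λ c d g q → c :* (d :* g :+ q) := c :* d :* g :+ c :* q) refl c d
              (coef g n) (coef (L u ∙ q) n)) ⟩
        (c *ᶠ d) ⊡ g ⊞ c ⊡ L u ∙ q    ≈⟨ ⊞-cong ≈-refl (ap-⊡ (L u) c q) ⟨
        (c *ᶠ d) ⊡ g ⊞ L u ∙ (c ⊡ q)  ∎)

    deg-auxiliary : ∀ {B D} {P : Fin B → Fin B → Poly} → (∀ c b → DegreeBelow D (P c b)) →
      DegreeBelow (t * B + (t * B + D)) (auxiliary P)
    deg-auxiliary {B} deg = deg-∑ λ c → deg-∑ λ b →
      deg-mono (ℕ.+-mono-≤ (exp≤ c) (ℕ.+-monoˡ-≤ _ (exp≤ b)))
        (deg-pow (L 1ᶠ) (deg-L 1ᶠ) (t * toℕ c) (deg-pow (L 0ᶠ) (deg-L 0ᶠ) (t * toℕ b) (deg c b)))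
      where
      exp≤ : (i : Fin B) → t * toℕ i ≤ t * B
      exp≤ i = ℕ.*-monoʳ-≤ t (ℕ.<⇒≤ (Fin.toℕ<n i))

    -- The relation makes (X - 1)ᵗ divide the first inner sum, which has at most B D ≤ t terms, all
    -- of degree below p; so that sum is 0 by `sparse-vanish`, and its blocks are 0 by
    -- `X-independent`. Cancel (X - 1)ᵗ and repeat.
    L₁-independent : ∀ {B n D} (P : Fin n → Fin B → Poly) → (∀ c b → DegreeBelow D (P c b)) →
      D ≤ t → B * D ≤ t → t * B ≤ p →
      ∑ (λ c → pow (L 1ᶠ) (t * toℕ c) ∙ ∑ (λ b → pow (L 0ᶠ) (t * toℕ b) ∙ P c b)) ≈ 𝟘 →
      ∀ c b → P c b ≈ 𝟘
    L₁-independent {B} {suc n} {D} P deg D≤t BD≤t tB≤p e = λ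
      { zero    → X-independent D≤t (P zero) (deg zero) F₀≈𝟘
      ; (suc c) → L₁-independent (P ∘ suc) (deg ∘ suc) D≤t BD≤t tB≤p rest≈𝟘 c }
      where
      F : Fin (suc n) → Poly
      F c = ∑ (λ b → pow (L 0ᶠ) (t * toℕ b) ∙ P c b)
      rest = ∑ (λ c → pow (L 1ᶠ) (t * toℕ c) ∙ F (suc c))
      e′ : F zero ⊞ pow (L 1ᶠ) t ∙ rest ≈ 𝟘
      e′ = ≈-trans (≈-sym (powL-∑-suc 1ᶠ t F)) e
      exp<p : (b : Fin B) → ∀ {m} → m < D → t * toℕ b + m < p
      exp<p b {m} m<D = ℕ.<-≤-trans (ℕ.+-monoʳ-< (t * toℕ b) (ℕ.<-≤-trans m<D D≤t))
        (ℕ.≤-trans (ℕ.≤-reflexive (trans (ℕ.+-comm (t * toℕ b) t) (sym (ℕ.*-suc t (toℕ b)))))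
          (ℕ.≤-trans (ℕ.*-monoʳ-≤ t (Fin.toℕ<n b)) tB≤p))
      F₀≈𝟘 : F zero ≈ 𝟘
      F₀≈𝟘 with ∑-supported {D = D} (λ b → pow (L 0ᶠ) (t * toℕ b) ∙ P zero b)
          (λ b → map (λ n → t * toℕ b + n) (upTo D))
                 (λ b → trans (List.length-map _ (upTo D)) (List.length-upTo D))
                 (λ b → All.map⁺ (All.map (exp<p b) (All.all-upTo D)))
                 (λ b → powX-supported (t * toℕ b) (deg zero b))
      ... | T , lenT , T<p , supp = sparse-vanish T T<p supp
        ((pow (L 1ᶠ) (t ∸ length T) ∙ ((-ᶠ 1ᶠ) ⊡ rest)) by (begin
          F zero
            ≈⟨ coefs (λ n → trans (solve 2 (λ a b → a := (a :+ b) :+ :- :1 :* b) refl (coef (F zero) n)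
                (coef (pow (L 1ᶠ) t ∙ rest) n))
                                                     (trans (cong (_+ᶠ (-ᶠ 1ᶠ) *ᶠ coef
                  (pow (L 1ᶠ) t ∙ rest) n) (at e′ n)) (+-identityˡ _))) ⟩
          (-ᶠ 1ᶠ) ⊡ pow (L 1ᶠ) t ∙ rest           ≈⟨ ap-⊡ (pow (L 1ᶠ) t) _ rest ⟨
          pow (L 1ᶠ) t ∙ ((-ᶠ 1ᶠ) ⊡ rest)
            ≈⟨ subst (λ k → pow (L 1ᶠ) k ∙ ((-ᶠ 1ᶠ) ⊡ rest) ≈ pow (L 1ᶠ) (length T) ∙ pow (L 1ᶠ)
                (t ∸ length T) ∙ ((-ᶠ 1ᶠ) ⊡ rest))
                                                       (ℕ.m+[n∸m]≡n (subst (_≤ t) (sym lenT) BD≤t))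
                                                           (pow-+ (L 1ᶠ) (length T) (t ∸ length T) _) ⟩
          pow (L 1ᶠ) (length T) ∙ pow (L 1ᶠ) (t ∸ length T) ∙ ((-ᶠ 1ᶠ) ⊡ rest)  ∎))
      rest≈𝟘 : rest ≈ 𝟘
      rest≈𝟘 = powL-≈𝟘 1ᶠ t (⊞≈𝟘ʳ F₀≈𝟘 e′)

    auxiliary-independent : ∀ {B D} (P : Fin B → Fin B → Poly) → (∀ c b → DegreeBelow D (P c b)) →
      D ≤ t → B * D ≤ t → t * B ≤ p → auxiliary P ≈ 𝟘 → ∀ c b → P c b ≈ 𝟘
    auxiliary-independent P deg D≤t BD≤t tB≤p e = L₁-independent P deg D≤t BD≤t tB≤p
      (≈-trans (∑-≈ λ c → ap-∑ (pow (L 1ᶠ) (t * toℕ c)) (λ b → pow (L 0ᶠ) (t * toℕ b) ∙ P c b)) e)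

    -- There are p^N arguments and only p^m values. This replaces solving a linear system: the
    -- difference of two colliding arguments will be a nonzero solution.
    collision : ∀ {N m} → m < N → (Λ : (Fin N → Fin p) → (Fin m → Fin p)) →
      ∃₂ λ v w → (∃[ i ] v i ≢ w i) × (∀ j → Λ v j ≡ Λ w j)
    collision {N} {m} m<N Λ
      with Fin.pigeonhole (ℕ.^-monoʳ-< p 2≤p m<N) (λ i → Fin.funToFin (Λ (Fin.finToFun i)))
    ... | i , j , i<j , eq =
        Fin.finToFun i , Fin.finToFun j , Fin.¬∀⟶∃¬ N _
            (λ k → Fin.finToFun i k Fin.≟ Fin.finToFun j k) differ , agree
      where
      differ : ¬ (∀ k → Fin.finToFun i k ≡ Fin.finToFun j k)
      differ same =
        Fin.<-irrefl {x = i} (trans (sym (Fin.funToFin-finToFin {N} {p} i))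
            (trans (funToFin-cong same) (Fin.funToFin-finToFin {N} {p} j))) i<j
        where
        funToFin-cong : ∀ {n} {f g : Fin n → Fin p} → (∀ k → f k ≡ g k) → Fin.funToFin f ≡ Fin.funToFin g
        funToFin-cong {zero}  e = refl
        funToFin-cong {suc n} e = cong₂ Fin.combine (e zero) (funToFin-cong (e ∘ suc))
      agree : ∀ k → Λ (Fin.finToFun i) k ≡ Λ (Fin.finToFun j) k
      agree k = trans (sym (Fin.finToFun-funToFin (Λ (Fin.finToFun i)) k))
        (trans (cong (λ z → Fin.finToFun z k) eq) (Fin.finToFun-funToFin (Λ (Fin.finToFun j)) k))

    coefficientsBelow : ∀ {D} → (Fin D → Fin p) → ℕ → Fin p
    coefficientsBelow {zero}  v _       = 0ᶠ
    coefficientsBelow {suc D} v zero    = v zero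
    coefficientsBelow {suc D} v (suc n) = coefficientsBelow (v ∘ suc) n

    coefficientsBelow-vanish : ∀ {D} (v : Fin D → Fin p) {n} → D ≤ n → coefficientsBelow v n ≡ 0ᶠ
    coefficientsBelow-vanish {zero}  v _         = refl
    coefficientsBelow-vanish {suc D} v (s≤s D≤n) = coefficientsBelow-vanish (v ∘ suc) D≤n

    coefficientsBelow-toℕ : ∀ {D} (v : Fin D → Fin p) i → coefficientsBelow v (toℕ i) ≡ v i
    coefficientsBelow-toℕ v zero    = refl
    coefficientsBelow-toℕ v (suc i) = coefficientsBelow-toℕ (v ∘ suc) i

    polynomial : ∀ {D} → (Fin D → Fin p) → Poly
    polynomial     v .coef   = coefficientsBelow v
    polynomial {D} v .bound  = D
    polynomial     v .vanish = coefficientsBelow-vanish v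

    deg-Θ^k : ∀ c b k {n f} → DegreeBelow n f → DegreeBelow (k + n) (pow (Θ c b) k ∙ f)
    deg-Θ^k c b = deg-pow (Θ c b) λ d → deg-⊞ (deg-⊞ (deg-θ d) (deg-⊡ _ (deg-L 1ᶠ d))) (deg-⊡ _ (deg-L 0ᶠ d))

    differentiated : ∀ {B} → ℕ → (Fin B → Fin B → Poly) → Fin B → Fin B → Poly
    differentiated k P c b = pow (Θ (toℕ c) (toℕ b)) k ∙ P c b

    evaluate-⊟ : ∀ {B} αβ k (P Q : Fin B → Fin B → Poly) →
      evaluate αβ (differentiated k (λ c b → P c b ⊟ Q c b)) ≈
      evaluate αβ (differentiated k P) ⊟ evaluate αβ (differentiated k Q)
    evaluate-⊟ {B} (α , β) k P Q = ≈-trans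
      (∑-≈ λ c → ≈-trans (∑-≈ λ b → ap-⊟ (weight c b ⊡ₗ pow (Θ (toℕ c) (toℕ b)) k) (P c b) (Q c b))
                         (∑-⊟ (λ b → weight c b ⊡ differentiated k P c b)
                             (λ b → weight c b ⊡ differentiated k Q c b)))
      (∑-⊟ (λ c → ∑ λ b → weight c b ⊡ differentiated k P c b) (λ c → ∑ λ b → weight c b ⊡ differentiated k Q c b))
      where
      weight : Fin B → Fin B → Fin p
      weight c b = β ^ᶠ toℕ c *ᶠ α ^ᶠ toℕ b

    module Conditions {B D : ℕ} (ws : List (Fin p × Fin p)) where

      poly : (Fin (B * (B * D)) → Fin p) → Fin B → Fin B → Poly
      poly v c b = polynomial λ l → v (Fin.combine c (Fin.combine b l))

      deg-poly : ∀ v c b → DegreeBelow D (poly v c b)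
      deg-poly v c b = below (vanish (poly v c b))

      G : (Fin (B * (B * D)) → Fin p) → Fin p × Fin p → ℕ → Poly
      G v αβ k = evaluate αβ (differentiated k (poly v))

      deg-G : ∀ v αβ k → k < D → DegreeBelow (D + D) (G v αβ k)
      deg-G v αβ k k<D = deg-∑ λ c → deg-∑ λ b → deg-⊡ _
        (deg-mono (ℕ.+-monoˡ-≤ D (ℕ.<⇒≤ k<D)) (deg-Θ^k (toℕ c) (toℕ b) k (deg-poly v c b)))

      -- One condition per class, per order k < D and per coefficient: the k-fold `Θ` adds at most k
      -- to the degree, so 2 D coefficients suffice.
      condition : (Fin (B * (B * D)) → Fin p) → Fin (length ws) × Fin D × Fin (D + D) → Fin p
      condition v (i , k , n) = coef (G v (lookup ws i) (toℕ k)) (toℕ n)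

      unpack : Fin (length ws * (D * (D + D))) → Fin (length ws) × Fin D × Fin (D + D)
      unpack j =
        proj₁ (Fin.remQuot {length ws} (D * (D + D)) j) , Fin.remQuot {D} (D + D)
            (proj₂ (Fin.remQuot {length ws} (D * (D + D)) j))

      unpack-combine : ∀ i k n → unpack (Fin.combine i (Fin.combine k n)) ≡ (i , k , n)
      unpack-combine i k n = trans
        (cong (λ q → proj₁ q , Fin.remQuot {D} (D + D) (proj₂ q)) (Fin.remQuot-combine i (Fin.combine k n)))
        (cong (i ,_) (Fin.remQuot-combine k n))

      G-≈ : ∀ {v w} → (∀ j → condition v (unpack j) ≡ condition w (unpack j)) →
            ∀ i k → k < D → G v (lookup ws i) k ≈ G w (lookup ws i) k
      G-≈ {v} {w} agree i k k<D = coefs λ n → coef≡ n (n ℕ.<? D + D)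
        where
        coef≡ : ∀ n → Dec (n < D + D) → coef (G v (lookup ws i) k) n ≡ coef (G w (lookup ws i) k) n
        coef≡ n (no n≮)  =
          trans (above (deg-G v (lookup ws i) k k<D) (ℕ.≮⇒≥ n≮))
              (sym (above (deg-G w (lookup ws i) k k<D) (ℕ.≮⇒≥ n≮)))
        coef≡ n (yes n<) = subst₂ (λ k n → coef (G v (lookup ws i) k) n ≡ coef (G w (lookup ws i) k) n)
          (Fin.toℕ-fromℕ< k<D) (Fin.toℕ-fromℕ< n<)
          (subst (λ ikn → condition v ikn ≡ condition w ikn) (unpack-combine i (Fin.fromℕ< k<D) (Fin.fromℕ< n<))
            (agree (Fin.combine i (Fin.combine (Fin.fromℕ< k<D) (Fin.fromℕ< n<)))))

      poly-⊟-nonzero : ∀ {v w i} → v i ≢ w i → ¬ (∀ c b → poly v c b ⊟ poly w c b ≈ 𝟘)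
      poly-⊟-nonzero {v} {w} {i} v≢w h = v≢w (subst (λ i → v i ≡ w i) eqᵢ
        (trans (sym (coefficientsBelow-toℕ (λ l → v (Fin.combine c (Fin.combine b l))) l))
               (trans (at (⊟≈𝟘⇒≈ (h c b)) (toℕ l)) (coefficientsBelow-toℕ
                   (λ l → w (Fin.combine c (Fin.combine b l))) l))))
        where
        c = proj₁ (Fin.remQuot {B} (B * D) i)
        b = proj₁ (Fin.remQuot {B} D (proj₂ (Fin.remQuot {B} (B * D) i)))
        l = proj₂ (Fin.remQuot {B} D (proj₂ (Fin.remQuot {B} (B * D) i)))
        eqᵢ : Fin.combine c (Fin.combine b l) ≡ i
        eqᵢ =
          trans (cong (Fin.combine c) (Fin.combine-remQuot {B} D (proj₂ (Fin.remQuot {B} (B * D) i))))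
              (Fin.combine-remQuot {B} (B * D) i)

    -- P is the difference of two distinct coefficient vectors with the same conditions; the
    -- conditions are linear, so P satisfies them with value 0.
    auxiliary-exists : ∀ {B D} (ws : List (Fin p × Fin p)) →
      length ws * (D * (D + D)) < B * (B * D) →
      Σ[ P ∈ (Fin B → Fin B → Poly) ] (∀ c b → DegreeBelow D (P c b)) × (¬ (∀ c b → P c b ≈ 𝟘)) ×
        (∀ {αβ} → αβ ∈ ws → ∀ k → k < D → evaluate αβ (differentiated k P) ≈ 𝟘)
    auxiliary-exists {B} {D} ws m<N = from-collision (collision m<N (λ v j → condition v (unpack j)))
      where
      open Conditions {B} {D} ws
      from-collision : (∃₂ λ v w → (∃[ i ] v i ≢ w i) ×
          (∀ j → condition v (unpack j) ≡ condition w (unpack j))) → _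
      from-collision (v , w , (i , v≢w) , agree) =
        (λ c b → poly v c b ⊟ poly w c b) ,
        (λ c b → deg-⊞ (deg-poly v c b) (deg-⊡ _ (deg-poly w c b))) ,
        poly-⊟-nonzero {v} {w} v≢w ,
        λ {αβ} αβ∈ k k<D → ≈-trans (evaluate-⊟ αβ k (poly v) (poly w))
          (≈⇒⊟≈𝟘 (subst (λ z → G v z k ≈ G w z k) (sym (lookup-index αβ∈)) (G-≈ {v} {w} agree (index αβ∈) k k<D)))

  -- Ψ is nonzero by independence and vanishes to order D at each u, so its degree bounds the number
  -- of zeros. D ≤ t ≤ p lets vanishing of the θ-derivatives count as multiplicity.
  stepanov-parametric : ∀ t B D (ws : List (Fin p × Fin p)) (us : List (Fin p)) →
    length ws * (D + D) < B * B → 0 < D → D ≤ t → B * D ≤ t → t * B ≤ p → t ≤ p → Unique us →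
    All (λ u → u ≢ 0ᶠ × u ≢ 1ᶠ × (u ^ᶠ t , (u -ᶠ 1ᶠ) ^ᶠ t) ∈ ws) us →
    D * length us ≤ t * B + (t * B + D)
  stepanov-parametric t B D ws us eqs<unknowns 0<D D≤t BD≤t tB≤p t≤p uniq us∈ =
    let P , deg , nonzero , vanishes = auxiliary-exists ws count in
    multiplicity-bound uniq (All.map (divides P vanishes) us∈) (deg-auxiliary deg)
      (λ e → nonzero (auxiliary-independent P deg D≤t BD≤t tB≤p e))
    where
    open Auxiliary t
    count : length ws * (D * (D + D)) < B * (B * D)
    count =
      ℕ.<-≤-trans (ℕ.≤-<-trans (ℕ.≤-reflexive (trans (cong (length ws *_) (ℕ.*-comm D (D + D)))
          (sym (ℕ.*-assoc (length ws) (D + D) D))))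
       (ℕ.*-monoˡ-< D {{>-nonZero 0<D}} eqs<unknowns)) (ℕ.≤-reflexive (ℕ.*-assoc B B D))
    divides : (P : Fin B → Fin B → Poly) →
      (∀ {αβ} → αβ ∈ ws → ∀ k → k < D → evaluate αβ (differentiated k P) ≈ 𝟘) →
      ∀ {u} → u ≢ 0ᶠ × u ≢ 1ᶠ × (u ^ᶠ t , (u -ᶠ 1ᶠ) ^ᶠ t) ∈ ws → [ u ]^ D ∣ auxiliary P
    divides P vanishes {u} (u≢0 , u≢1 , w∈) =
      θ-vanishing⇒∣ u≢0 u≢1 D (ℕ.≤-trans D≤t t≤p) (auxiliary P) λ k k<D →
      mod-𝟘⇒∣ (mod-trans (mod-≈ (θ^k-auxiliary k P)) (mod-trans (auxiliary-mod u (differentiated k P))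
          (mod-≈ (vanishes w∈ k k<D))))

-- Counting with duplicate-free lists, and Cauchy-Schwarz.

module Lists where

  private variable
    A B : Set

  remove : {x : A} {xs : List A} → x ∈ xs → List A
  remove {xs = _ ∷ xs} (here _)   = xs
  remove {xs = y ∷ _}  (there x∈) = y ∷ remove x∈

  length-remove : {x : A} {xs : List A} (x∈ : x ∈ xs) → length xs ≡ suc (length (remove x∈))
  length-remove (here _)   = refl
  length-remove (there x∈) = cong suc (length-remove x∈)

  ∈-remove : {x y : A} {xs : List A} (x∈ : x ∈ xs) → y ∈ xs → y ≢ x → y ∈ remove x∈
  ∈-remove (here refl) (here y≡x)  y≢x = ⊥-elim (y≢x y≡x)
  ∈-remove (here _)    (there y∈)  y≢x = y∈
  ∈-remove (there x∈)  (here y≡z)  y≢x = here y≡z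
  ∈-remove (there x∈)  (there y∈)  y≢x = there (∈-remove x∈ y∈ y≢x)

  length-⊆ : {xs ys : List A} → Unique xs → (∀ {x} → x ∈ xs → x ∈ ys) → length xs ≤ length ys
  length-⊆ {xs = []}     _            _  = z≤n
  length-⊆ {xs = x ∷ xs} (x≢ ∷ uniq) xs⊆ = subst (suc (length xs) ≤_) (sym (length-remove (xs⊆ (here refl))))
    (s≤s (length-⊆ uniq λ y∈ → ∈-remove (xs⊆ (here refl)) (xs⊆ (there y∈)) λ y≡x → All.lookup x≢ y∈ (sym y≡x)))

  InjectiveOn : (A → B) → List A → Set
  InjectiveOn f xs = ∀ {x y} → x ∈ xs → y ∈ xs → f x ≡ f y → x ≡ y

  unique-map : {f : A → B} {xs : List A} → Unique xs → InjectiveOn f xs → Unique (map f xs)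
  unique-map {xs = []}     _           _   = []
  unique-map {xs = x ∷ xs} (x≢ ∷ uniq) inj =
    All.map⁺ (All.tabulate λ y∈ fx≡fy → All.lookup x≢ y∈ (inj (here refl) (there y∈) fx≡fy)) ∷
    unique-map uniq (λ x∈ y∈ → inj (there x∈) (there y∈))

  unique-map⇒injectiveOn : {f : A → B} {xs : List A} → Unique (map f xs) → InjectiveOn f xs
  unique-map⇒injectiveOn _          (here refl) (here refl) _  = refl
  unique-map⇒injectiveOn (fx≢ ∷ _)  (here refl) (there y∈)  eq = ⊥-elim (All.lookup fx≢ (∈-map⁺ _ y∈) eq)
  unique-map⇒injectiveOn (fx≢ ∷ _)  (there x∈)  (here refl) eq =
    ⊥-elim (All.lookup fx≢ (∈-map⁺ _ x∈) (sym eq))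
  unique-map⇒injectiveOn (_ ∷ uniq) (there x∈)  (there y∈)  eq = unique-map⇒injectiveOn uniq x∈ y∈ eq

  length-injection : (f : A → B) {xs : List A} {ys : List B} → Unique xs → InjectiveOn f xs →
                     (∀ {x} → x ∈ xs → f x ∈ ys) → length xs ≤ length ys
  length-injection f {xs} {ys} uniq inj f∈ = subst (_≤ length ys) (List.length-map f xs)
    (length-⊆ (unique-map uniq inj) λ fx∈ → let x , x∈ , eq = ∈-map⁻ f fx∈ in subst (_∈ ys) (sym eq) (f∈ x∈))

  -- A transversal of the fibres of f; its length is the number of classes.
  representatives : (_≟_ : DecidableEquality B) (f : A → B) (xs : List A) →
    ∃[ rs ] (∀ {x} → x ∈ rs → x ∈ xs) × Unique (map f rs) × (∀ {x} → x ∈ xs → f x ∈ map f rs)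
  representatives _≟_ f [] = [] , (λ ()) , [] , λ ()
  representatives _≟_ f (x ∷ xs) with representatives _≟_ f xs
  ... | rs , rs⊆ , uniq , covers with DecMembership._∈?_ _≟_ (f x) (map f rs)
  ... | yes fx∈ = rs , there ∘ rs⊆ , uniq , λ { (here refl) → fx∈ ; (there y∈) → covers y∈ }
  ... | no  fx∉ = x ∷ rs , (λ { (here eq) → here eq ; (there y∈) → there (rs⊆ y∈) }) ,
    All.tabulate (λ y∈ eq → fx∉ (subst (_∈ map f rs) (sym eq) y∈)) ∷ uniq ,
    λ { (here refl) → here refl ; (there y∈) → there (covers y∈) }

  ∑[_] : List A → (A → ℕ) → ℕ
  ∑[ xs ] f = sum (map f xs)

  ∑-mono : ∀ xs {f g : A → ℕ} → (∀ {x} → x ∈ xs → f x ≤ g x) → ∑[ xs ] f ≤ ∑[ xs ] g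
  ∑-mono []       h = z≤n
  ∑-mono (x ∷ xs) h = ℕ.+-mono-≤ (h (here refl)) (∑-mono xs (h ∘ there))

  ∑-const : ∀ (xs : List A) c → ∑[ xs ] (λ _ → c) ≡ length xs * c
  ∑-const []       c = refl
  ∑-const (x ∷ xs) c = cong (λ n → c + n) (∑-const xs c)

  ∑-*ˡ : ∀ (xs : List A) c f → ∑[ xs ] (λ x → c * f x) ≡ c * ∑[ xs ] f
  ∑-*ˡ []       c f = sym (ℕ.*-zeroʳ c)
  ∑-*ˡ (x ∷ xs) c f = trans (cong (λ n → c * f x + n) (∑-*ˡ xs c f)) (sym (ℕ.*-distribˡ-+ c (f x) _))

  ∑-filter : ∀ {P : Pred A 0ℓ} (P? : Decidable P) xs f →
    ∑[ xs ] f ≡ ∑[ filter P? xs ] f + ∑[ filter (¬? ∘ P?) xs ] f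
  ∑-filter P? []       f = refl
  ∑-filter P? (x ∷ xs) f with P? x
  ... | yes _ = trans (cong (λ n → f x + n) (∑-filter P? xs f)) (sym (ℕ.+-assoc (f x) _ _))
  ... | no  _ =
      trans (cong (λ n → f x + n) (∑-filter P? xs f)) (x+[y+z]≡y+[x+z] (f x) (∑[ filter P? xs ] f) _)
    where
    x+[y+z]≡y+[x+z] : ∀ x y z → x + (y + z) ≡ y + (x + z)
    x+[y+z]≡y+[x+z] = solve-∀

  -- The disjoint union of the lists ℓ x, on which double counting is done.
  pairs : List A → (A → List B) → List (A × B)
  pairs []       ℓ = []
  pairs (x ∷ xs) ℓ = map (x ,_) (ℓ x) ++ pairs xs ℓ

  ∈-pairs⁺ : ∀ {xs} {ℓ : A → List B} {x y} → x ∈ xs → y ∈ ℓ x → (x , y) ∈ pairs xs ℓ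
  ∈-pairs⁺ (here refl)          y∈ = ∈-++⁺ˡ (∈-map⁺ _ y∈)
  ∈-pairs⁺ {xs = x ∷ _} (there x∈) y∈ = ∈-++⁺ʳ (map (x ,_) _) (∈-pairs⁺ x∈ y∈)

  ∈-pairs⁻ : ∀ xs {ℓ : A → List B} {x y} → (x , y) ∈ pairs xs ℓ → x ∈ xs × y ∈ ℓ x
  ∈-pairs⁻ (x ∷ xs) {ℓ} xy∈ with ∈-++⁻ (map (x ,_) (ℓ x)) xy∈
  ... | inj₂ xy∈′ = let x∈ , y∈ = ∈-pairs⁻ xs xy∈′ in there x∈ , y∈
  ... | inj₁ xy∈′ with ∈-map⁻ (x ,_) xy∈′
  ... | _ , y∈ , refl = here refl , y∈

  unique-pairs : ∀ {xs} {ℓ : A → List B} → Unique xs → (∀ {x} → x ∈ xs → Unique (ℓ x)) → Unique (pairs xs ℓ)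
  unique-pairs {xs = []}     _           _  = []
  unique-pairs {xs = x ∷ xs} (x≢ ∷ uniq) uℓ = Unique.++⁺
    (Unique.map⁺ (cong proj₂) (uℓ (here refl))) (unique-pairs uniq (uℓ ∘ there))
    λ { (xy∈ , xy∈′) → let _ , _ , eq = ∈-map⁻ (x ,_) xy∈ in
        All.lookup x≢ (proj₁ (∈-pairs⁻ xs xy∈′)) (sym (cong proj₁ eq)) }

  length-pairs : ∀ xs (ℓ : A → List B) → length (pairs xs ℓ) ≡ ∑[ xs ] (length ∘ ℓ)
  length-pairs []       ℓ = refl
  length-pairs (x ∷ xs) ℓ = trans (List.length-++ (map (x ,_) (ℓ x)))
    (cong₂ _+_ (List.length-map (x ,_) (ℓ x)) (length-pairs xs ℓ))

  length-pairs-≥ : ∀ xs {ℓ : A → List B} {n} → (∀ {x} → x ∈ xs → n ≤ length (ℓ x)) → length xs * n ≤ length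
      (pairs xs ℓ)
  length-pairs-≥ xs {ℓ} {n} h = ℕ.≤-trans (ℕ.≤-reflexive (sym (∑-const xs n)))
    (ℕ.≤-trans (∑-mono xs h) (ℕ.≤-reflexive (sym (length-pairs xs ℓ))))

  length-cartesianProduct : (xs : List A) (ys : List B) → length (cartesianProduct xs ys) ≡ length xs * length ys
  length-cartesianProduct []       ys = refl
  length-cartesianProduct (x ∷ xs) ys = trans (List.length-++ (map (x ,_) ys))
    (cong₂ _+_ (List.length-map (x ,_) ys) (length-cartesianProduct xs ys))

  2xy≤x²+y² : ∀ x y → 2 * (x * y) ≤ x ² + y ²
  2xy≤x²+y² x y =
    [ (λ x≤y → ordered x≤y) , (λ y≤x → subst₂ _≤_ (cong (2 *_) (ℕ.*-comm y x)) (ℕ.+-comm (y ²) (x ²))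
        (ordered y≤x)) ]′ (ℕ.≤-total x y)
    where
    expand : ∀ x d → 2 * (x * (x + d)) + d * d ≡ x * x + (x + d) * (x + d)
    expand = solve-∀
    ordered : ∀ {x y} → x ≤ y → 2 * (x * y) ≤ x ² + y ²
    ordered {x} {y} x≤y = subst (λ z → 2 * (x * z) ≤ x ² + z ²) (ℕ.m+[n∸m]≡n x≤y)
      (ℕ.≤-trans (ℕ.m≤m+n _ _) (ℕ.≤-reflexive (expand x (y ∸ x))))

  ∑-2xy : ∀ xs (f : A → ℕ) c → 2 * (c * ∑[ xs ] f) ≤ length xs * c ² + ∑[ xs ] (λ x → f x ²)
  ∑-2xy []       f c = ℕ.≤-reflexive (trans (cong (2 *_) (ℕ.*-zeroʳ c)) refl)
  ∑-2xy (x ∷ xs) f c = begin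
    2 * (c * (f x + ∑[ xs ] f))                              ≡⟨ split c (f x) _ ⟩
    2 * (c * f x) + 2 * (c * ∑[ xs ] f)
      ≤⟨ ℕ.+-mono-≤ (2xy≤x²+y² c (f x)) (∑-2xy xs f c) ⟩
    c ² + f x ² + (length xs * c ² + ∑[ xs ] (λ x → f x ²))  ≡⟨ regroup (c ²) (f x ²) (length xs * c ²) _ ⟩
    c ² + length xs * c ² + (f x ² + ∑[ xs ] (λ x → f x ²))  ∎
    where
    open ℕ.≤-Reasoning
    split : ∀ c a s → 2 * (c * (a + s)) ≡ 2 * (c * a) + 2 * (c * s)
    split = solve-∀
    regroup : ∀ a b c d → a + b + (c + d) ≡ a + c + (b + d)
    regroup = solve-∀

  -- By induction; `∑-2xy` bounds the cross terms of the new element by sums of two squares.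
  cauchy-schwarz : ∀ xs (f : A → ℕ) → (∑[ xs ] f) ² ≤ length xs * ∑[ xs ] (λ x → f x ²)
  cauchy-schwarz []       f = z≤n
  cauchy-schwarz (x ∷ xs) f = begin
    (f x + s) * (f x + s)                            ≡⟨ square (f x) s ⟩
    f x ² + 2 * (f x * s) + s ²
      ≤⟨ ℕ.+-mono-≤ (ℕ.+-monoʳ-≤ (f x ²) (∑-2xy xs f (f x))) (cauchy-schwarz xs f) ⟩
    f x ² + (length xs * f x ² + q) + length xs * q  ≡⟨ regroup (f x ²) (length xs) q ⟩
    (1 + length xs) * (f x ² + q)                    ∎
    where
    open ℕ.≤-Reasoning
    s = ∑[ xs ] f
    q = ∑[ xs ] (λ x → f x ²)
    square : ∀ a s → (a + s) * (a + s) ≡ a * a + 2 * (a * s) + s * s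
    square = solve-∀
    regroup : ∀ a n q → a + (n * a + q) + n * q ≡ (1 + n) * (a + q)
    regroup = solve-∀

  module Fibres (_≟_ : DecidableEquality B) where

    fibre : (A → B) → List A → B → List A
    fibre f xs y = filter (λ x → f x ≟ y) xs

    fibre-cauchy-schwarz : (f : A → B) {xs : List A} {ys : List B} → Unique xs → (∀ {x} → x ∈ xs → f x ∈ ys) →
      length xs ² ≤ length ys * ∑[ ys ] (λ y → length (fibre f xs y) ²)
    fibre-cauchy-schwarz f {xs} {ys} uniq f∈ = ℕ.≤-trans
      (ℕ.*-mono-≤ total total) (cauchy-schwarz ys (length ∘ fibre f xs))
      where
      total : length xs ≤ ∑[ ys ] (length ∘ fibre f xs)
      total = subst (length xs ≤_) (length-pairs ys (fibre f xs))
        (length-injection (λ x → f x , x) uniq (λ _ _ → cong proj₂)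
          λ x∈ → ∈-pairs⁺ (f∈ x∈) (∈-filter⁺ (λ x → f x ≟ _) x∈ refl))

  length-filter-≢ : (_≟_ : DecidableEquality A) {xs : List A} → Unique xs → ∀ y →
    length xs ≤ suc (length (filter (λ x → ¬? (x ≟ y)) xs))
  length-filter-≢ _≟_ {xs} uniq y = length-⊆ {ys = y ∷ filter (λ x → ¬? (x ≟ y)) xs} uniq
    λ {x} x∈ → split x∈ (x ≟ y)
    where
    split : ∀ {x} → x ∈ xs → Dec (x ≡ y) → x ∈ y ∷ filter (λ x → ¬? (x ≟ y)) xs
    split x∈ (yes x≡y) = here x≡y
    split x∈ (no x≢y)  = there (∈-filter⁺ (λ x → ¬? (x ≟ y)) x∈ x≢y)

  length-all-equal : {xs : List A} {y : A} → Unique xs → (∀ {x} → x ∈ xs → x ≡ y) → length xs ≤ 1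
  length-all-equal {y = y} uniq h = length-⊆ {ys = y ∷ []} uniq λ x∈ → here (h x∈)

  ∈-take : ∀ n {xs : List A} {x} → x ∈ take n xs → x ∈ xs
  ∈-take (suc n) {_ ∷ _} (here eq)  = here eq
  ∈-take (suc n) {_ ∷ _} (there x∈) = there (∈-take n x∈)

open Lists

-- Choice of the parameters B and D, and Stepanov's bound.

³-mono-≤ : ∀ {m n} → m ≤ n → m ³ ≤ n ³
³-mono-≤ m≤n = ℕ.*-mono-≤ (ℕ.*-mono-≤ m≤n m≤n) m≤n

³-cancel-≤ : ∀ {m n} → m ³ ≤ n ³ → m ≤ n
³-cancel-≤ {m} {n} m³≤n³ with m ℕ.≤? n
... | yes m≤n = m≤n
... | no  m≰n = ⊥-elim (ℕ.<⇒≱ (ℕ.*-mono-< (ℕ.*-mono-< n<m n<m) n<m) m³≤n³)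
  where n<m = ℕ.≰⇒> m≰n

²-mono-≤ : ∀ {m n} → m ≤ n → m ² ≤ n ²
²-mono-≤ m≤n = ℕ.*-mono-≤ m≤n m≤n

cube-root : ∀ n → ∃[ r ] r ³ ≤ n × n < (suc r) ³
cube-root zero = 0 , z≤n , s≤s z≤n
cube-root (suc n) with cube-root n
... | r , lo , hi with suc n ℕ.<? (suc r) ³
... | yes lt = r , ℕ.≤-trans lo (ℕ.n≤1+n n) , lt
... | no  ≮  = suc r , ℕ.≮⇒≥ ≮ , ℕ.≤-<-trans hi (ℕ.*-mono-< (ℕ.*-mono-< n<1+n n<1+n) n<1+n)
  where n<1+n = ℕ.n<1+n (suc r)

/-upper : ∀ m n .{{_ : NonZero n}} → m < suc (m ℕ./ n) * n
/-upper m n = subst (_< suc (m ℕ./ n) * n) (sym (m≡m%n+[m/n]*n m n)) (ℕ.+-monoˡ-< (m ℕ./ n * n) (m%n<n m n))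

-- The fields up to `equations` are the hypotheses of `stepanov-parametric` on B and D. `t≤2DB`
-- makes the degree O(D B²), and `B³≤16Mt` makes B² = O((M t)^{2/3}).
record Parameters (M t p : ℕ) : Set where
  field
    B D       : ℕ
    0<D       : 0 < D
    D≤t       : D ≤ t
    BD≤t      : B * D ≤ t
    tB≤p      : t * B ≤ p
    equations : M * (D + D) < B * B
    t≤2DB     : t ≤ 2 * (D * B)
    B³≤16Mt   : B ³ ≤ 16 * (M * t)

-- B is the least integer with B³ > 2 M t.
parameters : ∀ {M t p} → 0 < M → 0 < t → 16 * M ≤ t ² → 16 * M * (t ³ * t) ≤ p ³ → Parameters M t p
parameters {M} {t} {p} 0<M 0<t 16M≤t² 16Mt⁴≤p³ = record
  { B = B ; D = D ; 0<D = 0<D ; D≤t = m/n≤m t B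
  ; BD≤t = ℕ.≤-trans (ℕ.≤-reflexive (ℕ.*-comm B D)) DB≤t
  ; tB≤p = ³-cancel-≤ (begin
      (t * B) ³              ≡⟨ cube-* t B ⟩
      t ³ * B ³              ≤⟨ ℕ.*-monoʳ-≤ (t ³) B³≤16Mt ⟩
      t ³ * (16 * (M * t))   ≡⟨ shuffle M t ⟩
      16 * M * (t ³ * t)     ≤⟨ 16Mt⁴≤p³ ⟩
      p ³                    ∎)
  ; equations = ℕ.*-cancelʳ-< B (M * (D + D)) (B * B) (begin-strict
      M * (D + D) * B   ≡⟨ regroup M D B ⟩
      2 * (M * (D * B)) ≤⟨ ℕ.*-monoʳ-≤ 2 (ℕ.*-monoʳ-≤ M DB≤t) ⟩
      2 * (M * t)       <⟨ 2Mt<B³ ⟩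
      B * B * B         ∎)
  ; t≤2DB = begin
      t                 ≤⟨ ℕ.<⇒≤ (/-upper t B) ⟩
      suc D * B         ≡⟨⟩
      B + D * B         ≤⟨ ℕ.+-monoˡ-≤ (D * B) (ℕ.m≤n*m B D {{>-nonZero 0<D}}) ⟩
      D * B + D * B     ≡⟨ double (D * B) ⟩
      2 * (D * B)       ∎
  ; B³≤16Mt = B³≤16Mt }
  where
  open ℕ.≤-Reasoning
  root = cube-root (2 * (M * t))
  r = proj₁ root
  B = suc r
  -- The largest D with B D ≤ t; then 2 M D B ≤ 2 M t < B³.
  D = t ℕ./ B
  2Mt<B³ : 2 * (M * t) < B ³
  2Mt<B³ = proj₂ (proj₂ root)
  cube-* : ∀ a b → a * b * (a * b) * (a * b) ≡ a * a * a * (b * b * b)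
  cube-* = solve-∀
  shuffle : ∀ M t → t * t * t * (16 * (M * t)) ≡ 16 * M * (t * t * t * t)
  shuffle = solve-∀
  regroup : ∀ M D B → M * (D + D) * B ≡ 2 * (M * (D * B))
  regroup = solve-∀
  double : ∀ a → a + a ≡ 2 * a
  double = solve-∀
  cube-2 : ∀ a → 2 * a * (2 * a) * (2 * a) ≡ 8 * (a * a * a)
  cube-2 = solve-∀
  sixteen : ∀ a → 8 * (2 * a) ≡ 16 * a
  sixteen = solve-∀
  DB≤t : D * B ≤ t
  DB≤t = m/n*n≤m t B
  -- From r ≥ 1 follows B = r + 1 ≤ 2 r, whence B³ ≤ 8 r³ ≤ 16 M t.
  0<r : 0 < r
  0<r with r | proj₂ (proj₂ root)
  ... | zero  | lt = ⊥-elim (ℕ.<⇒≱ lt (ℕ.≤-trans (ℕ.*-mono-≤ 0<M 0<t) (ℕ.m≤n*m (M * t) 2)))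
  ... | suc _ | _  = s≤s z≤n
  B³≤16Mt : B ³ ≤ 16 * (M * t)
  B³≤16Mt = begin
    B ³                ≤⟨ ³-mono-≤ (ℕ.+-mono-≤ 0<r (ℕ.m≤m+n r 0)) ⟩
    (2 * r) ³          ≡⟨ cube-2 r ⟩
    8 * r ³            ≤⟨ ℕ.*-monoʳ-≤ 8 (proj₁ (proj₂ root)) ⟩
    8 * (2 * (M * t))  ≡⟨ sixteen (M * t) ⟩
    16 * (M * t)       ∎
  B≤t : B ≤ t
  B≤t = ³-cancel-≤ (begin
    B ³               ≤⟨ B³≤16Mt ⟩
    16 * (M * t)      ≡⟨ ℕ.*-assoc 16 M t ⟨
    16 * M * t        ≤⟨ ℕ.*-monoˡ-≤ t 16M≤t² ⟩
    t ³               ∎)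
  0<D : 0 < D
  0<D = m≥n⇒m/n>0 {t} {B} B≤t

abstract
  -- 5³ · 16², with 5 from n ≤ 5 B² and 16 from B³ ≤ 16 M t. It is abstract so that later constants
  -- do not compute.
  K₀ : ℕ
  K₀ = 32000

  5³16²≡K₀ : ∀ a → 125 * (16 * a * (16 * a)) ≡ K₀ * (a * a)
  5³16²≡K₀ = solve-∀

-- From t ≤ 2 D B, the degree 2 t B + D is at most 5 D B², so n ≤ 5 B².
parameters-bound : ∀ {M t p n} (ps : Parameters M t p) → let open Parameters ps in
  D * n ≤ t * B + (t * B + D) → n ³ ≤ K₀ * (M * t) ²
parameters-bound {M} {t} {p} {n} ps Dn≤ = begin
  n ³                              ≤⟨ ³-mono-≤ n≤5B² ⟩
  (5 * B ²) ³                      ≡⟨ sixth B ⟩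
  125 * (B ³) ²                    ≤⟨ ℕ.*-monoʳ-≤ 125 (²-mono-≤ B³≤16Mt) ⟩
  125 * (16 * (M * t)) ²           ≡⟨ 5³16²≡K₀ (M * t) ⟩
  K₀ * (M * t) ²                   ∎
  where
  open Parameters ps
  open ℕ.≤-Reasoning
  sixth : ∀ B → 5 * (B * B) * (5 * (B * B)) * (5 * (B * B)) ≡ 125 * (B * B * B * (B * B * B))
  sixth = solve-∀
  combine : ∀ D B → 2 * (D * B) * B + (2 * (D * B) * B + D * (B * B)) ≡ D * (5 * (B * B))
  combine = solve-∀
  0<B : 0 < B
  0<B with B | equations
  ... | suc _ | _ = s≤s z≤n
  tB≤ : t * B ≤ 2 * (D * B) * B
  tB≤ = ℕ.*-monoˡ-≤ B t≤2DB
  n≤5B² : n ≤ 5 * B ²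
  n≤5B² = ℕ.*-cancelˡ-≤ D {{>-nonZero 0<D}} (begin
    D * n                                                 ≤⟨ Dn≤ ⟩
    t * B + (t * B + D)
      ≤⟨ ℕ.+-mono-≤ tB≤ (ℕ.+-mono-≤ tB≤ (ℕ.m≤m*n D (B ²) {{>-nonZero (ℕ.*-mono-≤ 0<B 0<B)}})) ⟩
    2 * (D * B) * B + (2 * (D * B) * B + D * (B * B))     ≡⟨ combine D B ⟩
    D * (5 * B ²)                                         ∎)

module StepanovBound {p : ℕ} (𝔽 : PrimeField p) where
  open FieldProperties 𝔽
  open Stepanov 𝔽

  stepanov : ∀ {t} (ws : List (Fin p × Fin p)) (us : List (Fin p)) → 0 < t → t ≤ p →
    16 * length ws ≤ t ² → 16 * length ws * (t ³ * t) ≤ p ³ → Unique us →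
    All (λ u → u ≢ 0ᶠ × u ≢ 1ᶠ × (u ^ᶠ t , (u -ᶠ 1ᶠ) ^ᶠ t) ∈ ws) us →
    (length us) ³ ≤ K₀ * (length ws * t) ²
  stepanov _          []         _ _ _ _ _ _ = z≤n
  stepanov []         (_ ∷ _)    _ _ _ _ _ ((_ , _ , ()) ∷ _)
  stepanov {t} ws@(_ ∷ _) us@(_ ∷ _) 0<t t≤p 16M≤t² 16Mt⁴≤p³ uniq us∈ =
    parameters-bound ps (stepanov-parametric t B D ws us equations 0<D D≤t BD≤t tB≤p t≤p uniq us∈)
    where
    ps = parameters {length ws} {t} {p} (s≤s z≤n) 0<t 16M≤t² 16Mt⁴≤p³
    open Parameters ps

-- Multiplicative subgroups.

module Subgroups {p : ℕ} (𝔽 : PrimeField p) where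
  open FieldProperties 𝔽

  record MultiplicativeSubgroup (G : List (Fin p)) : Set where
    field
      unique    : Unique G
      nonzero   : ∀ {g} → g ∈ G → g ≢ 0ᶠ
      1∈        : 1ᶠ ∈ G
      *-closed  : ∀ {g h} → g ∈ G → h ∈ G → g *ᶠ h ∈ G
      ⁻¹-closed : ∀ {g} → g ∈ G → g ⁻¹ ∈ G

    0<order : 0 < length G
    0<order = ∈-length 1∈

  private
    product : List (Fin p) → Fin p
    product = foldr _*ᶠ_ 1ᶠ

    product-remove : ∀ {x xs} (x∈ : x ∈ xs) → product xs ≡ x *ᶠ product (remove x∈)
    product-remove (here refl) = refl
    product-remove {x} {y ∷ xs} (there x∈) = trans (cong (y *ᶠ_) (product-remove x∈))
      (solve 3 (λ x y π → y :* (x :* π) := x :* (y :* π)) refl x y _)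

    product-⊆ : ∀ {xs ys} → Unique xs → (∀ {x} → x ∈ xs → x ∈ ys) → length ys ≡ length xs → product xs ≡ product ys
    product-⊆ {[]}     {[]} _           _   _  = refl
    product-⊆ {x ∷ xs} {ys} (x≢ ∷ uniq) xs⊆ eq = trans
      (cong (x *ᶠ_) (product-⊆ uniq (λ y∈ → ∈-remove (xs⊆ (here refl))
          (xs⊆ (there y∈)) λ y≡x → All.lookup x≢ y∈ (sym y≡x))
        (ℕ.suc-injective (trans (sym (length-remove (xs⊆ (here refl)))) eq))))
      (sym (product-remove (xs⊆ (here refl))))

    product-map-* : ∀ g xs → product (map (g *ᶠ_) xs) ≡ g ^ᶠ length xs *ᶠ product xs
    product-map-* g []       = sym (*-identityˡ 1ᶠ)
    product-map-* g (x ∷ xs) = trans (cong (g *ᶠ x *ᶠ_) (product-map-* g xs))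
      (solve 4 (λ g x a b → g :* x :* (a :* b) := g :* a :* (x :* b)) refl g x _ _)

    product-≢0 : ∀ {xs} → (∀ {x} → x ∈ xs → x ≢ 0ᶠ) → product xs ≢ 0ᶠ
    product-≢0 {[]}     _   = 1≢0
    product-≢0 {x ∷ xs} ≢0 = *-≢0 (≢0 (here refl)) (product-≢0 (≢0 ∘ there))

  -- Multiplication by g permutes G, so the product of G is unchanged by the factor g^|G|.
  ^-order : ∀ {G} → MultiplicativeSubgroup G → ∀ {g} → g ∈ G → g ^ᶠ length G ≡ 1ᶠ
  ^-order {G} grp {g} g∈ = *-cancelˡ (product G) (product-≢0 nonzero) (begin
    product G *ᶠ g ^ᶠ length G  ≡⟨ *-comm _ _ ⟩
    g ^ᶠ length G *ᶠ product G  ≡⟨ product-map-* g G ⟨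
    product (map (g *ᶠ_) G)    ≡⟨ product-⊆ (Unique.map⁺ (*-cancelˡ g (nonzero g∈)) unique)
                  (λ gx∈ → let x , x∈ , eq = ∈-map⁻ (g *ᶠ_) gx∈ in subst (_∈ G) (sym eq) (*-closed g∈ x∈))
                                   (sym (List.length-map (g *ᶠ_) G)) ⟩
    product G                  ≡⟨ solve 1 (λ π → π := π :* :1) refl (product G) ⟩
    product G *ᶠ 1ᶠ             ∎)
    where
    open MultiplicativeSubgroup grp
    open ≡-Reasoning

-- Above the threshold τ₀ the classes of a level set are few enough for Stepanov's bound.
τ₀ : ℕ
τ₀ = 32 * K₀ + 4

-- `K₀` serves the levels above `τ₀`, the summand `τ₀` those below.
K₁ : ℕ
K₁ = K₀ + τ₀

-- 1 pays for x = 1; in 8, a factor 4 comes from (2 τ)² and a factor 2 from 1 + log t ≤ 2 log t.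
K₂ : ℕ
K₂ = 8 * K₁ + 1

-- The second moment of the number of returns of a dilation to G.

module Dilations {p : ℕ} (𝔽 : PrimeField p) where
  open FieldProperties 𝔽
  open Subgroups 𝔽
  open StepanovBound 𝔽
  open DecMembership (Fin._≟_ {p}) using (_∈?_)

  module _ {G : List (Fin p)} (grp : MultiplicativeSubgroup G) {κ : Fin p} (κ≢0 : κ ≢ 0ᶠ) where
    open MultiplicativeSubgroup grp

    private
      t : ℕ
      t = length G

    dilate : Fin p → Fin p → Fin p
    dilate x a = κ +ᶠ x *ᶠ (a -ᶠ κ)

    -- The centre κ is fixed by every dilation and is left out; any other a determines x together
    -- with its image.
    returns : Fin p → List (Fin p)
    returns x = filter (λ a → ¬? (a Fin.≟ κ) ×-dec (dilate x a ∈? G)) G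

    r : Fin p → ℕ
    r x = length (returns x)

    ∈-returns⁻ : ∀ {x a} → a ∈ returns x → a ∈ G × a ≢ κ × dilate x a ∈ G
    ∈-returns⁻ {x} a∈ = ∈-filter⁻ (λ a → ¬? (a Fin.≟ κ) ×-dec (dilate x a ∈? G)) a∈

    r≤t : ∀ x → r x ≤ t
    r≤t x = List.length-filter _ G

    unique-returns : ∀ x → Unique (returns x)
    unique-returns x = Unique.filter⁺ _ unique

    -- The pair of a and its image determines x, because a ≠ κ.
    length-pairs-returns : ∀ {xs} → Unique xs → length (pairs xs returns) ≤ t ²
    length-pairs-returns {xs} uniq = subst (length (pairs xs returns) ≤_) (length-cartesianProduct G G)
      (length-injection (λ { (x , a) → a , dilate x a }) (unique-pairs uniq (λ {x} _ → unique-returns x)) injective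
        (λ xa∈ → let a∈ , _ , xa∈G = ∈-returns⁻ (proj₂ (∈-pairs⁻ xs xa∈)) in ∈-cartesianProduct⁺ a∈ xa∈G))
      where
      injective : InjectiveOn (λ { (x , a) → a , dilate x a }) (pairs xs returns)
      injective {x , a} {y , b} xa∈ _ eq with ,-injective eq
      ... | refl , eq′ = cong (_, a) (*-cancelˡ (a -ᶠ κ) (λ a-κ≡0 → a≢κ (-ᶠ≡0⇒≡ a-κ≡0)) (begin
          (a -ᶠ κ) *ᶠ x      ≡⟨ solve 3 (λ a k x → (a :- k) :* x := (k :+ x :* (a :- k)) :- k) refl a κ x ⟩
          dilate x a -ᶠ κ   ≡⟨ cong (_-ᶠ κ) eq′ ⟩
          dilate y a -ᶠ κ   ≡⟨ solve 3 (λ a k x → (k :+ x :* (a :- k)) :- k := (a :- k) :* x) refl a κ y ⟩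
          (a -ᶠ κ) *ᶠ y      ∎))
        where
        open ≡-Reasoning
        a≢κ = proj₁ (proj₂ (∈-returns⁻ (proj₂ (∈-pairs⁻ xs xa∈))))

    -- The cosets of x and x - 1 modulo G, seen through t-th powers, which do not change under
    -- factors from G.
    ω : Fin p → Fin p × Fin p
    ω x = x ^ᶠ t , (x -ᶠ 1ᶠ) ^ᶠ t

    private
      z : Fin p → Fin p
      z x = ((x -ᶠ 1ᶠ) *ᶠ κ) ⁻¹

      ω′ : Fin p → Fin p × Fin p
      ω′ x = x ^ᶠ t *ᶠ z x ^ᶠ t , z x ^ᶠ t

      -- Dividing x a − (x − 1) κ = dilate x a by (x − 1) κ turns a return into a
      -- point u such that u and u − 1 lie in prescribed cosets of G.
      point : Fin p × Fin p → Fin p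
      point (x , a) = x *ᶠ a *ᶠ z x

      x-1≢0 : ∀ {x} → x ≢ 1ᶠ → x -ᶠ 1ᶠ ≢ 0ᶠ
      x-1≢0 x≢1 eq = x≢1 (-ᶠ≡0⇒≡ eq)

      z-inverse : ∀ {x} → x ≢ 1ᶠ → (x -ᶠ 1ᶠ) *ᶠ κ *ᶠ z x ≡ 1ᶠ
      z-inverse x≢1 = ⁻¹-inverse (*-≢0 (x-1≢0 x≢1) κ≢0)

      z≢0 : ∀ {x} → x ≢ 1ᶠ → z x ≢ 0ᶠ
      z≢0 x≢1 = ⁻¹-≢0 (*-≢0 (x-1≢0 x≢1) κ≢0)

      point-1 : ∀ {x} a → x ≢ 1ᶠ → point (x , a) -ᶠ 1ᶠ ≡ dilate x a *ᶠ z x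
      point-1 {x} a x≢1 = trans (cong (λ e → point (x , a) -ᶠ e) (sym (z-inverse x≢1)))
        (solve 4 (λ x a k z → x :* a :* z :- (x :- :1) :* k :* z := (k :+ x :* (a :- k)) :* z) refl x a κ (z x))

      ω-point : ∀ {x a} → x ≢ 1ᶠ → a ∈ returns x → ω (point (x , a)) ≡ ω′ x
      ω-point {x} {a} x≢1 a∈ = let a∈G , _ , xa∈G = ∈-returns⁻ a∈ in cong₂ _,_
        (begin
          (x *ᶠ a *ᶠ z x) ^ᶠ t              ≡⟨ ^-distrib-* (x *ᶠ a) (z x) t ⟩
          (x *ᶠ a) ^ᶠ t *ᶠ z x ^ᶠ t         ≡⟨ cong (_*ᶠ z x ^ᶠ t) (^-distrib-* x a t) ⟩
          x ^ᶠ t *ᶠ a ^ᶠ t *ᶠ z x ^ᶠ t      ≡⟨ cong (λ e → x ^ᶠ t *ᶠ e *ᶠ z x ^ᶠ t) (^-order grp a∈G) ⟩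
          x ^ᶠ t *ᶠ 1ᶠ *ᶠ z x ^ᶠ t          ≡⟨ cong (_*ᶠ z x ^ᶠ t) (*-identityʳ _) ⟩
          x ^ᶠ t *ᶠ z x ^ᶠ t               ∎)
        (begin
          (point (x , a) -ᶠ 1ᶠ) ^ᶠ t        ≡⟨ cong (_^ᶠ t) (point-1 a x≢1) ⟩
          (dilate x a *ᶠ z x) ^ᶠ t          ≡⟨ ^-distrib-* (dilate x a) (z x) t ⟩
          dilate x a ^ᶠ t *ᶠ z x ^ᶠ t       ≡⟨ cong (_*ᶠ z x ^ᶠ t) (^-order grp xa∈G) ⟩
          1ᶠ *ᶠ z x ^ᶠ t                    ≡⟨ *-identityˡ _ ⟩
          z x ^ᶠ t                         ∎)
        where open ≡-Reasoning

      -- The second component gives (x - 1)ᵗ, as κᵗ is fixed, and dividing the first by it gives xᵗ.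
      -- So points from different classes differ.
      ω′-injective : ∀ {x y} → x ≢ 1ᶠ → y ≢ 1ᶠ → ω′ x ≡ ω′ y → ω x ≡ ω y
      ω′-injective {x} {y} x≢1 y≢1 eq = cong₂ _,_
        (*-cancelˡ (z x ^ᶠ t) zᵗ≢0 (begin
          z x ^ᶠ t *ᶠ x ^ᶠ t   ≡⟨ *-comm _ _ ⟩
          x ^ᶠ t *ᶠ z x ^ᶠ t   ≡⟨ proj₁ (,-injective eq) ⟩
          y ^ᶠ t *ᶠ z y ^ᶠ t   ≡⟨ *-comm _ _ ⟩
          z y ^ᶠ t *ᶠ y ^ᶠ t   ≡⟨ cong (_*ᶠ y ^ᶠ t) zᵗ≡ ⟨
          z x ^ᶠ t *ᶠ y ^ᶠ t   ∎))
        (*-cancelˡ (κ ^ᶠ t *ᶠ z x ^ᶠ t) (*-≢0 (^-≢0 t κ≢0) zᵗ≢0) (begin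
          κ ^ᶠ t *ᶠ z x ^ᶠ t *ᶠ (x -ᶠ 1ᶠ) ^ᶠ t   ≡⟨ t-th x≢1 ⟩
          1ᶠ                                    ≡⟨ t-th y≢1 ⟨
          κ ^ᶠ t *ᶠ z y ^ᶠ t *ᶠ (y -ᶠ 1ᶠ) ^ᶠ t   ≡⟨ cong (λ e → κ ^ᶠ t *ᶠ e *ᶠ (y -ᶠ 1ᶠ) ^ᶠ t) zᵗ≡ ⟨
          κ ^ᶠ t *ᶠ z x ^ᶠ t *ᶠ (y -ᶠ 1ᶠ) ^ᶠ t   ∎))
        where
        open ≡-Reasoning
        zᵗ≢0 : z x ^ᶠ t ≢ 0ᶠ
        zᵗ≢0 = ^-≢0 t (z≢0 x≢1)
        zᵗ≡ : z x ^ᶠ t ≡ z y ^ᶠ t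
        zᵗ≡ = proj₂ (,-injective eq)
        1^ : ∀ n → 1ᶠ ^ᶠ n ≡ 1ᶠ
        1^ zero    = refl
        1^ (suc n) = trans (*-identityˡ _) (1^ n)
        t-th : ∀ {x} → x ≢ 1ᶠ → κ ^ᶠ t *ᶠ z x ^ᶠ t *ᶠ (x -ᶠ 1ᶠ) ^ᶠ t ≡ 1ᶠ
        t-th {x} x≢1 = begin
          κ ^ᶠ t *ᶠ z x ^ᶠ t *ᶠ (x -ᶠ 1ᶠ) ^ᶠ t
            ≡⟨ solve 3 (λ a b c → a :* b :* c := c :* a :* b) refl (κ ^ᶠ t) (z x ^ᶠ t) ((x -ᶠ 1ᶠ) ^ᶠ t) ⟩
          (x -ᶠ 1ᶠ) ^ᶠ t *ᶠ κ ^ᶠ t *ᶠ z x ^ᶠ t   ≡⟨ cong (_*ᶠ z x ^ᶠ t) (^-distrib-* (x -ᶠ 1ᶠ) κ t) ⟨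
          ((x -ᶠ 1ᶠ) *ᶠ κ) ^ᶠ t *ᶠ z x ^ᶠ t      ≡⟨ ^-distrib-* ((x -ᶠ 1ᶠ) *ᶠ κ) (z x) t ⟨
          ((x -ᶠ 1ᶠ) *ᶠ κ *ᶠ z x) ^ᶠ t          ≡⟨ cong (_^ᶠ t) (z-inverse x≢1) ⟩
          1ᶠ ^ᶠ t                              ≡⟨ 1^ t ⟩
          1ᶠ                                   ∎

    module _ (t²<p : t ² < p) where

      private
        t≤p : t ≤ p
        t≤p = ℕ.≤-trans (ℕ.m≤m*n t t {{>-nonZero 0<order}}) (ℕ.<⇒≤ t²<p)

        -- From 16 M ≤ t² and t² < p: the left side is at most t⁶ ≤ p³.
        16Mt⁴≤p³ : ∀ M → 16 * M ≤ t ² → 16 * M * (t ³ * t) ≤ p ³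
        16Mt⁴≤p³ M 16M≤t² = begin
          16 * M * (t ³ * t)   ≤⟨ ℕ.*-monoˡ-≤ (t ³ * t) 16M≤t² ⟩
          t ² * (t ³ * t)      ≡⟨ regroup t ⟩
          (t ²) ³              ≤⟨ ³-mono-≤ (ℕ.<⇒≤ t²<p) ⟩
          p ³                  ∎
          where
          open ℕ.≤-Reasoning
          regroup : ∀ t → t * t * (t * t * t * t) ≡ t * t * (t * t) * (t * t)
          regroup = solve-∀

      -- M elements of different classes, each with at least τ returns, give M τ distinct points
      -- falling into M classes. Stepanov's bound (M τ)³ ≤ K₀ (M t)² is then divided by M².
      class-bound : ∀ {ys τ} → (∀ {x} → x ∈ ys → x ≢ 0ᶠ × x ≢ 1ᶠ × τ ≤ r x) → Unique (map ω ys) →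
        16 * length ys ≤ t ² → length ys * τ ³ ≤ K₀ * t ²
      class-bound {[]} _ _ _ = z≤n
      class-bound {ys@(_ ∷ _)} {τ} h uniq 16M≤t² = ℕ.*-cancelˡ-≤ (M ²) (begin
        M ² * (M * τ ³)       ≡⟨ regroup M τ ⟩
        (M * τ) ³             ≤⟨ ³-mono-≤ (length-pairs-≥ ys {returns} (λ x∈ → proj₂ (proj₂ (h x∈)))) ⟩
        (length P) ³          ≡⟨ cong _³ (List.length-map point P) ⟨
        (length us) ³         ≤⟨ stepanov (map ω′ ys) us 0<order t≤p
                                  (subst (λ m → 16 * m ≤ t ²) (sym len) 16M≤t²)
                                  (subst (λ m → 16 * m * (t ³ * t) ≤ p ³) (sym len) (16Mt⁴≤p³ M 16M≤t²))
                                  (unique-map (unique-pairs (Unique.map⁻ uniq)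
                                      (λ {x} _ → unique-returns x)) injective)
                                  (All.map⁺ (All.tabulate good)) ⟩
        K₀ * (length (map ω′ ys) * t) ²  ≡⟨ cong (λ m → K₀ * (m * t) ²) len ⟩
        K₀ * (M * t) ²        ≡⟨ regroup′ K₀ M t ⟩
        M ² * (K₀ * t ²)      ∎)
        where
        open ℕ.≤-Reasoning
        M = length ys
        P = pairs ys returns
        us = map point P
        len : length (map ω′ ys) ≡ M
        len = List.length-map ω′ ys
        regroup : ∀ M τ → M * M * (M * (τ * τ * τ)) ≡ M * τ * (M * τ) * (M * τ)
        regroup = solve-∀
        regroup′ : ∀ K M t → K * (M * t * (M * t)) ≡ M * M * (K * (t * t))
        regroup′ = solve-∀
        injective : InjectiveOn point P
        injective {x , a} {y , b} xa∈ yb∈ eq = same x≡y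
          where
          x∈ = proj₁ (∈-pairs⁻ ys xa∈)
          y∈ = proj₁ (∈-pairs⁻ ys yb∈)
          x≢1 = proj₁ (proj₂ (h x∈))
          y≢1 = proj₁ (proj₂ (h y∈))
          x≡y : x ≡ y
          x≡y = unique-map⇒injectiveOn uniq x∈ y∈ (ω′-injective x≢1 y≢1
            (trans (sym (ω-point x≢1 (proj₂ (∈-pairs⁻ ys xa∈))))
                (trans (cong ω eq) (ω-point y≢1 (proj₂ (∈-pairs⁻ ys yb∈))))))
          same : x ≡ y → (x , a) ≡ (y , b)
          same refl = cong (x ,_) (*-cancelˡ (x *ᶠ z x) (*-≢0 (proj₁ (h x∈)) (z≢0 x≢1))
            (trans (solve 3 (λ x a z → x :* z :* a := x :* a :* z) refl x a (z x))
              (trans eq (solve 3 (λ x a z → x :* a :* z := x :* z :* a) refl x b (z x)))))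
        good : ∀ {xa} → xa ∈ P → point xa ≢ 0ᶠ × point xa ≢ 1ᶠ × ω (point xa) ∈ map ω′ ys
        good {x , a} xa∈ =
          *-≢0 (*-≢0 (proj₁ (h x∈)) (nonzero (proj₁ (∈-returns⁻ a∈)))) (z≢0 x≢1) ,
          (λ eq → *-≢0 (nonzero (proj₂ (proj₂ (∈-returns⁻ a∈)))) (z≢0 x≢1)
            (trans (sym (point-1 a x≢1)) (trans (cong (_-ᶠ 1ᶠ) eq) (-‿inverseʳ 1ᶠ)))) ,
          subst (_∈ map ω′ ys) (sym (ω-point x≢1 a∈)) (∈-map⁺ ω′ x∈)
          where
          x∈ = proj₁ (∈-pairs⁻ ys xa∈)
          a∈ = proj₂ (∈-pairs⁻ ys xa∈)
          x≢1 = proj₁ (proj₂ (h x∈))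

      -- Otherwise `class-bound` applies to the first m = ⌊t²/16⌋ elements; since t² ≤ 32 m it gives
      -- τ³ ≤ 32 K₀, against τ ≥ τ₀ > 32 K₀.
      few-classes : ∀ {ys τ} → τ₀ ≤ τ → (∀ {x} → x ∈ ys → x ≢ 0ᶠ × x ≢ 1ᶠ × τ ≤ r x) → Unique (map ω ys) →
        16 * length ys ≤ t ²
      few-classes {ys} {τ} τ₀≤τ h uniq with 16 * length ys ℕ.≤? t ²
      ... | yes le = le
      ... | no  ≰  = ⊥-elim (ℕ.<⇒≱ 32K₀<τ (ℕ.≤-trans (ℕ.m≤m*n τ (τ * τ) {{>-nonZero 0<τ²}}) τ³≤32K₀))
        where
        open ℕ.≤-Reasoning
        m = t ² ℕ./ 16
        zs = take m ys
        32K₀<τ : 32 * K₀ < τ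
        32K₀<τ = ℕ.<-≤-trans (ℕ.m<m+n (32 * K₀) {4} (s≤s z≤n)) τ₀≤τ
        0<τ : 0 < τ
        0<τ = ℕ.≤-<-trans z≤n 32K₀<τ
        0<τ² : 0 < τ * τ
        0<τ² = ℕ.*-mono-≤ 0<τ 0<τ
        τ≤t : τ ≤ t
        τ≤t = nonempty h (λ { refl → ≰ z≤n })
          where
          nonempty : ∀ {ys} → (∀ {x} → x ∈ ys → x ≢ 0ᶠ × x ≢ 1ᶠ × τ ≤ r x) → ys ≢ [] → τ ≤ t
          nonempty {[]}    h ≢[] = ⊥-elim (≢[] refl)
          nonempty {x ∷ _} h _   = ℕ.≤-trans (proj₂ (proj₂ (h (here refl)))) (r≤t x)
        -- The summand 4 in `τ₀` ensures t² ≥ 16, so that m ≥ 1.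
        4≤t : 4 ≤ t
        4≤t = ℕ.≤-trans (ℕ.m≤n+m 4 (32 * K₀)) (ℕ.≤-trans τ₀≤τ τ≤t)
        m*16≤t² : m * 16 ≤ t ²
        m*16≤t² = m/n*n≤m (t ²) 16
        16m≤t² : 16 * m ≤ t ²
        16m≤t² = subst (_≤ t ²) (ℕ.*-comm m 16) m*16≤t²
        len-zs : length zs ≡ m
        len-zs = trans (List.length-take m ys) (ℕ.m≤n⇒m⊓n≡m
          (ℕ.*-cancelˡ-≤ 16 (ℕ.≤-trans 16m≤t² (ℕ.<⇒≤ (ℕ.≰⇒> ≰)))))
        0<m : 0 < m
        0<m = m≥n⇒m/n>0 {t ²} {16} (²-mono-≤ 4≤t)
        bound : m * τ ³ ≤ K₀ * t ²
        bound = subst (λ l → l * τ ³ ≤ K₀ * t ²) len-zs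
          (class-bound {zs} {τ} (h ∘ ∈-take m)
            (subst Unique (List.take-map m ys) (Unique.take⁺ m uniq))
            (subst (λ l → 16 * l ≤ t ²) (sym len-zs) 16m≤t²))
        t²≤32m : t ² ≤ 32 * m
        t²≤32m = begin
          t ²            ≤⟨ ℕ.<⇒≤ (/-upper (t ²) 16) ⟩
          (1 + m) * 16   ≤⟨ ℕ.*-monoˡ-≤ 16 (ℕ.+-monoˡ-≤ m 0<m) ⟩
          (m + m) * 16   ≡⟨ double m ⟩
          32 * m         ∎
          where
          double : ∀ m → (m + m) * 16 ≡ 32 * m
          double = solve-∀
        τ³≤32K₀ : τ * (τ * τ) ≤ 32 * K₀
        τ³≤32K₀ = ℕ.*-cancelˡ-≤ m {{>-nonZero 0<m}} (begin
          m * (τ * (τ * τ))       ≡⟨ cong (m *_) (ℕ.*-assoc τ τ τ) ⟨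
          m * τ ³                 ≤⟨ bound ⟩
          K₀ * t ²                ≤⟨ ℕ.*-monoʳ-≤ K₀ t²≤32m ⟩
          K₀ * (32 * m)           ≡⟨ regroup K₀ m ⟩
          m * (32 * K₀)           ∎)
          where
          regroup : ∀ K m → K * (32 * m) ≡ m * (32 * K)
          regroup = solve-∀

      -- For small τ, the total number t² of returns suffices. For large τ, Stepanov's bound is used
      -- twice: M τ³ ≤ K₀ t² for the classes, then |xs|³ ≤ K₀ (M t)² for the level set; multiplying
      -- the latter by τ⁶ leaves (K₀ t²)³.
      level-bound : ∀ {xs τ} → Unique xs → (∀ {x} → x ∈ xs → x ≢ 0ᶠ × x ≢ 1ᶠ × τ ≤ r x) →
        length xs * τ ² ≤ K₁ * t ²
      level-bound {xs} {τ} uniq h = [ small , large ]′ (ℕ.≤-total τ τ₀)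
        where
        open ℕ.≤-Reasoning
        small : τ ≤ τ₀ → length xs * τ ² ≤ K₁ * t ²
        small τ≤τ₀ = begin
          length xs * (τ * τ)   ≡⟨ ℕ.*-assoc (length xs) τ τ ⟨
          length xs * τ * τ
            ≤⟨ ℕ.*-mono-≤ (ℕ.≤-trans (length-pairs-≥ xs {returns} (λ x∈ → proj₂ (proj₂ (h x∈))))
                (length-pairs-returns uniq)) τ≤τ₀ ⟩
          t ² * τ₀              ≡⟨ ℕ.*-comm (t ²) τ₀ ⟩
          τ₀ * t ²              ≤⟨ ℕ.*-monoˡ-≤ (t ²) (ℕ.m≤n+m τ₀ K₀) ⟩
          K₁ * t ²              ∎
        reps = representatives (≡-dec Fin._≟_ Fin._≟_) ω xs
        ys = proj₁ reps
        M = length ys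
        large : τ₀ ≤ τ → length xs * τ ² ≤ K₁ * t ²
        large τ₀≤τ = ℕ.≤-trans (³-cancel-≤ (begin
          (length xs * τ ²) ³                ≡⟨ regroup₁ (length xs) τ ⟩
          (length xs) ³ * (τ ³) ²            ≤⟨ ℕ.*-monoˡ-≤ ((τ ³) ²) (stepanov (map ω ys) xs 0<order t≤p
                                                 (subst (λ m → 16 * m ≤ t ²) (sym len) 16M≤t²)
                                                 (subst (λ m → 16 * m * (t ³ * t) ≤ p ³) (sym len)
                                                     (16Mt⁴≤p³ M 16M≤t²))
                                                 uniq
                                                 (All.tabulate λ x∈ → proj₁ (h x∈) , proj₁
                                                     (proj₂ (h x∈)) , proj₂ (proj₂ (proj₂ reps)) x∈)) ⟩
          K₀ * (length (map ω ys) * t) ² * (τ ³) ²  ≡⟨ cong (λ m → K₀ * (m * t) ² * (τ ³) ²) len ⟩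
          K₀ * (M * t) ² * (τ ³) ²           ≡⟨ regroup₂ K₀ M t (τ ³) ⟩
          K₀ * t ² * (M * τ ³) ²
            ≤⟨ ℕ.*-monoʳ-≤ (K₀ * t ²) (²-mono-≤ (class-bound {ys} {τ} h-ys (proj₁ (proj₂ (proj₂ reps))) 16M≤t²)) ⟩
          K₀ * t ² * (K₀ * t ²) ²            ≡⟨ ℕ.*-assoc (K₀ * t ²) (K₀ * t ²) (K₀ * t ²) ⟨
          (K₀ * t ²) ³                       ∎)) (ℕ.*-monoˡ-≤ (t ²) (ℕ.m≤m+n K₀ τ₀))
          where
          h-ys : ∀ {x} → x ∈ ys → x ≢ 0ᶠ × x ≢ 1ᶠ × τ ≤ r x
          h-ys y∈ = h (proj₁ (proj₂ reps) y∈)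
          16M≤t² : 16 * M ≤ t ²
          16M≤t² = few-classes {ys} {τ} τ₀≤τ h-ys (proj₁ (proj₂ (proj₂ reps)))
          len : length (map ω ys) ≡ M
          len = List.length-map ω ys
          regroup₁ : ∀ l τ → l * (τ * τ) * (l * (τ * τ)) * (l * (τ * τ)) ≡ l * l * l * (τ * τ * τ * (τ * τ * τ))
          regroup₁ = solve-∀
          regroup₂ : ∀ K M t c → K * (M * t * (M * t)) * (c * c) ≡ K * (t * t) * (M * c * (M * c))
          regroup₂ = solve-∀

      -- Each step removes the range 2^J ≤ r < 2^{J+1}, where r² ≤ 4 · 2^{2J} and `level-bound`
      -- counts the elements.
      dyadic : ∀ J {xs} → Unique xs → (∀ {x} → x ∈ xs → x ≢ 0ᶠ × x ≢ 1ᶠ × r x < 2 ^ J) →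
        ∑[ xs ] (λ x → r x ²) ≤ J * (4 * K₁ * t ²)
      dyadic zero {xs} uniq h =
        ℕ.≤-trans (∑-mono xs (λ {x} x∈ → ℕ.≤-reflexive (cong _² (ℕ.n<1⇒n≡0 (proj₂ (proj₂ (h x∈)))))))
        (ℕ.≤-reflexive (trans (∑-const xs 0) (ℕ.*-zeroʳ (length xs))))
      dyadic (suc J) {xs} uniq h = begin
        ∑[ xs ] (λ x → r x ²)                                    ≡⟨ ∑-filter big? xs (λ x → r x ²) ⟩
        ∑[ bigs ] (λ x → r x ²) + ∑[ smalls ] (λ x → r x ²)      ≤⟨ ℕ.+-mono-≤ big small ⟩
        4 * K₁ * t ² + J * (4 * K₁ * t ²)                        ∎
        where
        open ℕ.≤-Reasoning
        τ = 2 ^ J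
        big? = λ x → τ ℕ.≤? r x
        bigs = filter big? xs
        smalls = filter (¬? ∘ big?) xs
        regroup : ∀ l τ → l * (2 * τ * (2 * τ)) ≡ 4 * (l * (τ * τ))
        regroup = solve-∀
        big : ∑[ bigs ] (λ x → r x ²) ≤ 4 * K₁ * t ²
        big = begin
          ∑[ bigs ] (λ x → r x ²)
            ≤⟨ ∑-mono bigs (λ x∈ → ²-mono-≤ (ℕ.<⇒≤ (proj₂ (proj₂ (h (proj₁ (∈-filter⁻ big? x∈))))))) ⟩
          ∑[ bigs ] (λ _ → (2 * τ) ²)      ≡⟨ ∑-const bigs ((2 * τ) ²) ⟩
          length bigs * (2 * τ) ²          ≡⟨ regroup (length bigs) τ ⟩
          4 * (length bigs * τ ²)
            ≤⟨ ℕ.*-monoʳ-≤ 4 (level-bound {bigs} {τ} (Unique.filter⁺ big? uniq) λ x∈ →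
                  let x∈xs , τ≤r = ∈-filter⁻ big? x∈ in proj₁ (h x∈xs) , proj₁ (proj₂ (h x∈xs)) , τ≤r) ⟩
          4 * (K₁ * t ²)                   ≡⟨ ℕ.*-assoc 4 K₁ (t ²) ⟨
          4 * K₁ * t ²                     ∎
        small : ∑[ smalls ] (λ x → r x ²) ≤ J * (4 * K₁ * t ²)
        small = dyadic J (Unique.filter⁺ (¬? ∘ big?) uniq) λ x∈ →
          let x∈xs , ≰ = ∈-filter⁻ (¬? ∘ big?) x∈ in proj₁ (h x∈xs) , proj₁ (proj₂ (h x∈xs)) , ℕ.≰⇒> ≰

      -- x = 1, the identity dilation, escapes `level-bound` and is estimated by r ≤ t. The
      -- assumption on t makes log t ≥ 1.
      ∑r² : 2 ≤ t → ∀ {xs} → Unique xs → (∀ {x} → x ∈ xs → x ≢ 0ᶠ) →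
        ∑[ xs ] (λ x → r x ²) ≤ K₂ * t ² * ⌊log₂ t ⌋
      ∑r² 2≤t {xs} uniq ≢0 = begin
        ∑[ xs ] (λ x → r x ²)                                     ≡⟨ ∑-filter (Fin._≟ 1ᶠ) xs (λ x → r x ²) ⟩
        ∑[ ones ] (λ x → r x ²) + ∑[ others ] (λ x → r x ²)       ≤⟨ ℕ.+-mono-≤ one other ⟩
        t ² + (1 + l) * (4 * K₁ * t ²)
          ≤⟨ ℕ.+-mono-≤ (ℕ.m≤m*n (t ²) l {{>-nonZero 1≤l}}) (ℕ.*-monoˡ-≤ (4 * K₁ * t ²) (ℕ.+-monoˡ-≤ l 1≤l)) ⟩
        t ² * l + (l + l) * (4 * K₁ * t ²)                        ≡⟨ regroup (t ²) l K₁ ⟩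
        K₂ * t ² * l                                              ∎
        where
        open ℕ.≤-Reasoning
        l = ⌊log₂ t ⌋
        ones = filter (Fin._≟ 1ᶠ) xs
        others = filter (¬? ∘ (Fin._≟ 1ᶠ)) xs
        1≤l : 1 ≤ l
        1≤l = ⌊log₂⌋-mono-≤ 2≤t
        regroup : ∀ T l K → T * l + (l + l) * (4 * K * T) ≡ (8 * K + 1) * T * l
        regroup = solve-∀
        t<2^ : t < 2 ^ (1 + l)
        t<2^ with t ℕ.<? 2 ^ (1 + l)
        ... | yes lt = lt
        ... | no  ≮  =
            ⊥-elim (ℕ.<-irrefl refl (subst (_≤ l) (⌊log₂[2^n]⌋≡n (1 + l)) (⌊log₂⌋-mono-≤ (ℕ.≮⇒≥ ≮))))
        one : ∑[ ones ] (λ x → r x ²) ≤ t ²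
        one = begin
          ∑[ ones ] (λ x → r x ²)   ≤⟨ ∑-mono ones (λ {x} _ → ²-mono-≤ (r≤t x)) ⟩
          ∑[ ones ] (λ _ → t ²)     ≡⟨ ∑-const ones (t ²) ⟩
          length ones * t ²
            ≤⟨ ℕ.*-monoˡ-≤ (t ²) (length-all-equal (Unique.filter⁺ (Fin._≟ 1ᶠ) uniq)
                (proj₂ ∘ ∈-filter⁻ (Fin._≟ 1ᶠ) {xs = xs})) ⟩
          1 * t ²                   ≡⟨ ℕ.*-identityˡ (t ²) ⟩
          t ²                       ∎
        other : ∑[ others ] (λ x → r x ²) ≤ (1 + l) * (4 * K₁ * t ²)
        other = dyadic (1 + l) (Unique.filter⁺ (¬? ∘ (Fin._≟ 1ᶠ)) uniq) λ {x} x∈ →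
          let x∈xs , x≢1 = ∈-filter⁻ (¬? ∘ (Fin._≟ 1ᶠ)) x∈ in ≢0 x∈xs , x≢1 , ℕ.≤-<-trans (r≤t x) t<2^

-- Triples (d, c, c′) and their ratios.

module Triples {p : ℕ} (𝔽 : PrimeField p) where
  open FieldProperties 𝔽
  open Subgroups 𝔽
  open Dilations 𝔽
  open Fibres (Fin._≟_ {p})

  module _ {G : List (Fin p)} (grp : MultiplicativeSubgroup G) (t²<p : length G ² < p)
           {ξ η : Fin p} (ξ≢0 : ξ ≢ 0ᶠ) (η≢0 : η ≢ 0ᶠ) (s : Fin p)
           {C D : List (Fin p)} (uniqC : Unique C) (uniqD : Unique D)
           (C⊆ : ∀ {c} → c ∈ C → ∃[ a ] a ∈ G × c ≡ ξ *ᶠ a +ᶠ s)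
           (D⊆ : ∀ {d} → d ∈ D → ∃[ b ] b ∈ G × d ≡ η *ᶠ b +ᶠ s) where
    open MultiplicativeSubgroup grp

    private
      t = length G

      κ : Fin p
      κ = η *ᶠ ξ ⁻¹

      κ≢0 : κ ≢ 0ᶠ
      κ≢0 = *-≢0 η≢0 (⁻¹-≢0 ξ≢0)

      ξκ≡η : ξ *ᶠ κ ≡ η
      ξκ≡η = trans (solve 3 (λ x e i → x :* (e :* i) := e :* (x :* i)) refl ξ η (ξ ⁻¹))
                   (trans (cong (η *ᶠ_) (⁻¹-inverse ξ≢0)) (*-identityʳ η))

      others : Fin p → List (Fin p)
      others d = filter (λ c → ¬? (c Fin.≟ d)) C

      ∈-others⁻ : ∀ {c d} → c ∈ others d → c ∈ C × c ≢ d
      ∈-others⁻ {d = d} = ∈-filter⁻ (λ c → ¬? (c Fin.≟ d))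

      Triple : Set
      Triple = Fin p × Fin p × Fin p

    triples : List Triple
    triples = pairs D (λ d → cartesianProduct (others d) (others d))

    private
      ∈-triples⁻ : ∀ {d c c′} → (d , c , c′) ∈ triples → d ∈ D × (c ∈ C × c ≢ d) × (c′ ∈ C × c′ ≢ d)
      ∈-triples⁻ {d} z∈ = let d∈ , cc′∈ = ∈-pairs⁻ D z∈
                              c∈ , c′∈ = ∈-cartesianProduct⁻ (others d) (others d) cc′∈
                          in d∈ , ∈-others⁻ c∈ , ∈-others⁻ c′∈

      unique-triples : Unique triples
      unique-triples =
        unique-pairs uniqD λ _ → Unique.cartesianProduct⁺ (Unique.filter⁺ _ uniqC) (Unique.filter⁺ _ uniqC)

    -- Each d excludes at most one element of C.
    length-triples : length D * (length C ∸ 1) ² ≤ length triples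
    length-triples = length-pairs-≥ D {λ d → cartesianProduct (others d) (others d)} λ {d} _ →
      subst ((length C ∸ 1) ² ≤_) (sym (length-cartesianProduct (others d) (others d)))
        (²-mono-≤ (ℕ.m≤n+o⇒m∸n≤o (length C) 1 (length-filter-≢ Fin._≟_ uniqC d)))

    ratio : Triple → Fin p
    ratio (d , c , c′) = (c′ -ᶠ d) *ᶠ (c -ᶠ d) ⁻¹

    private
      normalise : Fin p → Fin p → Fin p
      normalise ζ c = (c -ᶠ s) *ᶠ ζ ⁻¹

      normalise-affine : ∀ {ζ} a → ζ ≢ 0ᶠ → normalise ζ (ζ *ᶠ a +ᶠ s) ≡ a
      normalise-affine {ζ} a ζ≢0 = trans
        (solve 4 (λ z a s i → (z :* a :+ s :- s) :* i := a :* (z :* i)) refl ζ a s (ζ ⁻¹))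
        (trans (cong (a *ᶠ_) (⁻¹-inverse ζ≢0)) (*-identityʳ a))

      affine-normalise : ∀ {ζ} c → ζ ≢ 0ᶠ → ζ *ᶠ normalise ζ c +ᶠ s ≡ c
      affine-normalise {ζ} c ζ≢0 = begin
        ζ *ᶠ ((c -ᶠ s) *ᶠ ζ ⁻¹) +ᶠ s
          ≡⟨ solve 4 (λ z c s i → z :* ((c :- s) :* i) :+ s := (c :- s) :* (z :* i) :+ s) refl ζ c s (ζ ⁻¹) ⟩
        (c -ᶠ s) *ᶠ (ζ *ᶠ ζ ⁻¹) +ᶠ s   ≡⟨ cong (λ e → (c -ᶠ s) *ᶠ e +ᶠ s) (⁻¹-inverse ζ≢0) ⟩
        (c -ᶠ s) *ᶠ 1ᶠ +ᶠ s            ≡⟨ solve 2 (λ c s → (c :- s) :* :1 :+ s := c) refl c s ⟩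
        c                            ∎
        where open ≡-Reasoning

      normalise-injective : ∀ {ζ c d} → ζ ≢ 0ᶠ → normalise ζ c ≡ normalise ζ d → c ≡ d
      normalise-injective {ζ} {c} {d} ζ≢0 eq =
        trans (sym (affine-normalise c ζ≢0)) (trans (cong (λ e → ζ *ᶠ e +ᶠ s) eq) (affine-normalise d ζ≢0))

      normalise∈ : ∀ {ζ c} → ζ ≢ 0ᶠ → (∃[ a ] a ∈ G × c ≡ ζ *ᶠ a +ᶠ s) → normalise ζ c ∈ G
      normalise∈ {ζ} ζ≢0 (a , a∈ , refl) = subst (_∈ G) (sym (normalise-affine a ζ≢0)) a∈

      -- The element a/b for c = ξ a + s and d = η b + s. From c - d = ξ b (a/b - κ), the relation
      -- c′ - d = x (c - d) says that the dilation of ratio x about κ sends a/b to a′/b.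
      quotient : Fin p → Fin p → Fin p
      quotient d c = normalise ξ c *ᶠ normalise η d ⁻¹

      code : Triple → Fin p × Fin p
      code (d , c , _) = normalise η d , quotient d c

      dilate-quotient : ∀ {d c c′ x} → normalise η d ≢ 0ᶠ → x *ᶠ (c -ᶠ d) ≡ c′ -ᶠ d →
        κ +ᶠ x *ᶠ (quotient d c -ᶠ κ) ≡ quotient d c′
      dilate-quotient {d} {c} {c′} {x} b≢0 eq = *-cancelˡ (ξ *ᶠ b) (*-≢0 ξ≢0 b≢0) (begin
        ξ *ᶠ b *ᶠ (κ +ᶠ x *ᶠ (a *ᶠ β -ᶠ κ))
          ≡⟨ solve 6 (λ X b k x a β → X :* b :* (k :+ x :* (a :* β :- k)) := X :* k :* b :+ x :*
              (X :* a :* (b :* β) :- X :* k :* b)) refl ξ b κ x a β ⟩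
        ξ *ᶠ κ *ᶠ b +ᶠ x *ᶠ (ξ *ᶠ a *ᶠ (b *ᶠ β) -ᶠ ξ *ᶠ κ *ᶠ b)
          ≡⟨ cong₂ (λ e f → e *ᶠ b +ᶠ x *ᶠ (ξ *ᶠ a *ᶠ f -ᶠ e *ᶠ b)) ξκ≡η (⁻¹-inverse b≢0) ⟩
        η *ᶠ b +ᶠ x *ᶠ (ξ *ᶠ a *ᶠ 1ᶠ -ᶠ η *ᶠ b)
          ≡⟨ solve 4 (λ h x k s → h :+ x :* (k :* :1 :- h) := h :+ x :* ((k :+ s) :- (h :+ s))) refl
              (η *ᶠ b) x (ξ *ᶠ a) s ⟩
        η *ᶠ b +ᶠ x *ᶠ ((ξ *ᶠ a +ᶠ s) -ᶠ (η *ᶠ b +ᶠ s))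
          ≡⟨ cong₂ (λ e f → η *ᶠ b +ᶠ x *ᶠ (e -ᶠ f)) (affine-normalise c ξ≢0) (affine-normalise d η≢0) ⟩
        η *ᶠ b +ᶠ x *ᶠ (c -ᶠ d)
          ≡⟨ cong (η *ᶠ b +ᶠ_) eq ⟩
        η *ᶠ b +ᶠ (c′ -ᶠ d)
          ≡⟨ cong₂ (λ e f → η *ᶠ b +ᶠ (e -ᶠ f)) (affine-normalise c′ ξ≢0) (affine-normalise d η≢0) ⟨
        η *ᶠ b +ᶠ ((ξ *ᶠ a′ +ᶠ s) -ᶠ (η *ᶠ b +ᶠ s))
          ≡⟨ solve 3 (λ h k s → h :+ ((k :+ s) :- (h :+ s)) := k :* :1) refl (η *ᶠ b) (ξ *ᶠ a′) s ⟩
        ξ *ᶠ a′ *ᶠ 1ᶠ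
          ≡⟨ cong (ξ *ᶠ a′ *ᶠ_) (⁻¹-inverse b≢0) ⟨
        ξ *ᶠ a′ *ᶠ (b *ᶠ β)
          ≡⟨ solve 4 (λ X a b β → X :* a :* (b :* β) := X :* b :* (a :* β)) refl ξ a′ b β ⟩
        ξ *ᶠ b *ᶠ (a′ *ᶠ β) ∎)
        where
        open ≡-Reasoning
        b = normalise η d
        β = b ⁻¹
        a = normalise ξ c
        a′ = normalise ξ c′

      quotient≢κ : ∀ {d c} → normalise η d ≢ 0ᶠ → c ≢ d → quotient d c ≢ κ
      quotient≢κ {d} {c} b≢0 c≢d eq = c≢d (begin
        c                                      ≡⟨ affine-normalise c ξ≢0 ⟨
        ξ *ᶠ normalise ξ c +ᶠ s                  ≡⟨ cong (λ e → e +ᶠ s) (sym (*-identityʳ _)) ⟩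
        ξ *ᶠ normalise ξ c *ᶠ 1ᶠ +ᶠ s
          ≡⟨ cong (λ e → ξ *ᶠ normalise ξ c *ᶠ e +ᶠ s) (⁻¹-inverse b≢0) ⟨
        ξ *ᶠ normalise ξ c *ᶠ (b *ᶠ b ⁻¹) +ᶠ s
          ≡⟨ solve 5 (λ X a b β s → X :* a :* (b :* β) :+ s := X :* (a :* β) :* b :+ s) refl ξ
              (normalise ξ c) b (b ⁻¹) s ⟩
        ξ *ᶠ quotient d c *ᶠ b +ᶠ s              ≡⟨ cong (λ e → ξ *ᶠ e *ᶠ b +ᶠ s) eq ⟩
        ξ *ᶠ κ *ᶠ b +ᶠ s                         ≡⟨ cong (λ e → e *ᶠ b +ᶠ s) ξκ≡η ⟩
        η *ᶠ b +ᶠ s                             ≡⟨ affine-normalise d η≢0 ⟩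
        d                                      ∎)
        where
        open ≡-Reasoning
        b = normalise η d

      ratio-equation : ∀ {d c c′ x} → c ≢ d → ratio (d , c , c′) ≡ x → x *ᶠ (c -ᶠ d) ≡ c′ -ᶠ d
      ratio-equation {d} {c} {c′} c≢d refl = trans
        (solve 3 (λ u v i → u :* i :* v := u :* (v :* i)) refl (c′ -ᶠ d) (c -ᶠ d) ((c -ᶠ d) ⁻¹))
        (trans (cong ((c′ -ᶠ d) *ᶠ_) (⁻¹-inverse (c≢d ∘ -ᶠ≡0⇒≡))) (*-identityʳ _))

    -- A triple of ratio x is coded by b ∈ G and the return a/b; these recover d and c, and then c′
    -- = d + x (c - d).
    length-fibre : ∀ x → length (fibre ratio triples x) ≤ t * r grp κ≢0 x
    length-fibre x = subst (length (fibre ratio triples x) ≤_) (length-cartesianProduct G (returns grp κ≢0 x))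
      (length-injection code (Unique.filter⁺ _ unique-triples) injective (code∈ ∘ ∈-fibre))
      where
      ∈-fibre : ∀ {z} → z ∈ fibre ratio triples x → z ∈ triples × ratio z ≡ x
      ∈-fibre = ∈-filter⁻ (λ z → ratio z Fin.≟ x)
      code∈ : ∀ {z} → z ∈ triples × ratio z ≡ x → code z ∈ cartesianProduct G (returns grp κ≢0 x)
      code∈ {d , c , c′} (z∈ , eq) =
        let d∈ , (c∈ , c≢d) , (c′∈ , _) = ∈-triples⁻ z∈
            b∈ = normalise∈ η≢0 (D⊆ d∈)
            quotient∈ : ∀ {c} → c ∈ C → quotient d c ∈ G
            quotient∈ c∈ = *-closed (normalise∈ ξ≢0 (C⊆ c∈)) (⁻¹-closed b∈)
        in ∈-cartesianProduct⁺ b∈ (∈-filter⁺ _ (quotient∈ c∈)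
             (quotient≢κ (nonzero b∈) c≢d ,
              subst (_∈ G) (sym (dilate-quotient (nonzero b∈) (ratio-equation c≢d eq))) (quotient∈ c′∈)))
      injective : InjectiveOn code (fibre ratio triples x)
      injective {d , c , c′} {e , f , f′} z∈ w∈ eq = same d≡e c≡f
        where
        zT = ∈-triples⁻ (proj₁ (∈-fibre z∈))
        wT = ∈-triples⁻ (proj₁ (∈-fibre w∈))
        d≡e : d ≡ e
        d≡e = normalise-injective η≢0 (proj₁ (,-injective eq))
        b⁻¹≢0 : normalise η d ⁻¹ ≢ 0ᶠ
        b⁻¹≢0 = ⁻¹-≢0 (nonzero (normalise∈ η≢0 (D⊆ (proj₁ zT))))
        c≡f : c ≡ f
        c≡f = normalise-injective ξ≢0 (*-cancelˡ (normalise η d ⁻¹) b⁻¹≢0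
          (trans (*-comm _ _) (trans (proj₂ (,-injective eq))
              (trans (*-comm _ _) (cong (λ e → normalise η e ⁻¹ *ᶠ normalise ξ f) (sym d≡e))))))
        same : d ≡ e → c ≡ f → (d , c , c′) ≡ (e , f , f′)
        same refl refl = cong (λ u → d , c , u) (begin
          c′                       ≡⟨ solve 2 (λ c d → c := (c :- d) :+ d) refl c′ d ⟩
          (c′ -ᶠ d) +ᶠ d
            ≡⟨ cong (_+ᶠ d) (ratio-equation (proj₂ (proj₁ (proj₂ zT))) (proj₂ (∈-fibre z∈))) ⟨
          x *ᶠ (c -ᶠ d) +ᶠ d
            ≡⟨ cong (_+ᶠ d) (ratio-equation (proj₂ (proj₁ (proj₂ wT))) (proj₂ (∈-fibre w∈))) ⟩
          (f′ -ᶠ d) +ᶠ d            ≡⟨ solve 2 (λ c d → (c :- d) :+ d := c) refl f′ d ⟩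
          f′                       ∎)
          where open ≡-Reasoning

    -- Cauchy-Schwarz over the fibres of `ratio`, each at most t r(x), followed by `∑r²`.
    triples-bound : 2 ≤ t → ∀ {X} → Unique X → (∀ {x} → x ∈ X → x ≢ 0ᶠ) →
      (∀ {d c c′} → d ∈ D → c ∈ C → c ≢ d → c′ ∈ C → c′ ≢ d → ratio (d , c , c′) ∈ X) →
      (length D * (length C ∸ 1) ²) ² ≤ length X * (K₂ * (t ² * t ²) * ⌊log₂ t ⌋)
    triples-bound 2≤t {X} uniqX X≢0 ratio∈ = begin
      (length D * (length C ∸ 1) ²) ²                               ≤⟨ ²-mono-≤ length-triples ⟩
      length triples ²
        ≤⟨ fibre-cauchy-schwarz ratio unique-triples (λ z∈ →
                  let d∈ , (c∈ , c≢d) , (c′∈ , c′≢d) = ∈-triples⁻ z∈ in ratio∈ d∈ c∈ c≢d c′∈ c′≢d) ⟩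
      length X * ∑[ X ] (λ x → length (fibre ratio triples x) ²)
        ≤⟨ ℕ.*-monoʳ-≤ (length X) (∑-mono X λ {x} _ → ²-mono-≤ (length-fibre x)) ⟩
      length X * ∑[ X ] (λ x → (t * r′ x) ²)
        ≤⟨ ℕ.*-monoʳ-≤ (length X) (∑-mono X λ {x} _ → ℕ.≤-reflexive (square-* t (r′ x))) ⟩
      length X * ∑[ X ] (λ x → t ² * r′ x ²)
        ≡⟨ cong (length X *_) (∑-*ˡ X (t ²) (λ x → r′ x ²)) ⟩
      length X * (t ² * ∑[ X ] (λ x → r′ x ²))
        ≤⟨ ℕ.*-monoʳ-≤ (length X) (ℕ.*-monoʳ-≤ (t ²) (∑r² grp κ≢0 t²<p 2≤t uniqX X≢0)) ⟩
      length X * (t ² * (K₂ * t ² * ⌊log₂ t ⌋))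
        ≡⟨ cong (length X *_) (regroup (t ²) K₂ ⌊log₂ t ⌋) ⟩
      length X * (K₂ * (t ² * t ²) * ⌊log₂ t ⌋)                     ∎
      where
      open ℕ.≤-Reasoning
      r′ = r grp κ≢0
      square-* : ∀ t r → t * r * (t * r) ≡ t * t * (r * r)
      square-* = solve-∀
      regroup : ∀ T K l → T * (K * T * l) ≡ K * (T * T) * l
      regroup = solve-∀

-- The three summands before 1 belong to the three cases of `us-bound`; 8 and 1 pay for returning x
-- = 1 to X.
K₃ : ℕ → ℕ
K₃ e = 8 * (K₀ + 16 + 256 * e ² + 1)

-- Elements x of a subgroup with 1 - x in a given invariant set.

module Shifts {p : ℕ} (𝔽 : PrimeField p) where
  open FieldProperties 𝔽
  open Subgroups 𝔽
  open StepanovBound 𝔽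
  open Fibres (Fin._≟_ {p})

  additiveQuadruples : List (Fin p) → List ((Fin p × Fin p) × (Fin p × Fin p))
  additiveQuadruples G = filter (λ ((x₁ , x₂) , (x₃ , x₄)) → (x₁ +ᶠ x₂) Fin.≟ (x₃ +ᶠ x₄))
    (cartesianProduct (cartesianProduct G G) (cartesianProduct G G))

  module _ {G : List (Fin p)} (grp : MultiplicativeSubgroup G)
           {S : List (Fin p)} (uniqS : Unique S) (GS⊆S : ∀ {g y} → g ∈ G → y ∈ S → g *ᶠ y ∈ S)
           {X : List (Fin p)} (uniqX : Unique X) (X⊆G : ∀ {x} → x ∈ X → x ∈ G)
           (1-X⊆S : ∀ {x} → x ∈ X → 1ᶠ -ᶠ x ∈ S) where
    open MultiplicativeSubgroup grp

    private
      t = length G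

    -- Cauchy-Schwarz for (x, g) ↦ g (1 - x) ∈ S. A coincidence g (1 - x) = g′ (1 - x′) is g + x′ g′
    -- = g′ + x g, whose four terms lie in G and give back x, g, x′, g′ by division.
    energy-bound : (length X * t) ² ≤ length S * length (additiveQuadruples G)
    energy-bound = begin
      (length X * t) ²                                      ≡⟨ cong _² (length-cartesianProduct X G) ⟨
      length XG ²
        ≤⟨ fibre-cauchy-schwarz f (Unique.cartesianProduct⁺ uniqX unique)
                  (λ xg∈ → let x∈ , g∈ = ∈-cartesianProduct⁻ X G xg∈ in GS⊆S g∈ (1-X⊆S x∈)) ⟩
      length S * ∑[ S ] (λ y → length (fibre f XG y) ²)     ≤⟨ ℕ.*-monoʳ-≤ (length S) collisions ⟩
      length S * length (additiveQuadruples G)              ∎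
      where
      open ℕ.≤-Reasoning
      XG = cartesianProduct X G
      f : Fin p × Fin p → Fin p
      f (x , g) = g *ᶠ (1ᶠ -ᶠ x)
      fibre² : Fin p → List ((Fin p × Fin p) × (Fin p × Fin p))
      fibre² y = cartesianProduct (fibre f XG y) (fibre f XG y)
      quadruple : Fin p × (Fin p × Fin p) × (Fin p × Fin p) → (Fin p × Fin p) × (Fin p × Fin p)
      quadruple (_ , (x , g) , (x′ , g′)) = (g , x′ *ᶠ g′) , (g′ , x *ᶠ g)
      ∈-fibre : ∀ {x g y} → (x , g) ∈ fibre f XG y → (x ∈ X × g ∈ G) × f (x , g) ≡ y
      ∈-fibre {y = y} xg∈ = let xg∈XG , eq = ∈-filter⁻ (λ z → f z Fin.≟ y) xg∈ in ∈-cartesianProduct⁻ X G xg∈XG , eq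
      ∈-P⁻ : ∀ {y x g x′ g′} → (y , (x , g) , (x′ , g′)) ∈ pairs S fibre² →
             ((x ∈ X × g ∈ G) × f (x , g) ≡ y) × ((x′ ∈ X × g′ ∈ G) × f (x′ , g′) ≡ y)
      ∈-P⁻ {y} z∈ =
        let u∈ , v∈ = ∈-cartesianProduct⁻ (fibre f XG y) (fibre f XG y) (proj₂ (∈-pairs⁻ S z∈)) in ∈-fibre u∈ , ∈-fibre v∈
      injective : InjectiveOn quadruple (pairs S fibre²)
      injective {y , (x , g) , (x′ , g′)} {w , (u , h) , (u′ , h′)} z∈ w∈ eq =
        same (proj₁ (,-injective (proj₁ (,-injective eq)))) (proj₁ (,-injective (proj₂ (,-injective eq))))
             (proj₂ (,-injective (proj₁ (,-injective eq)))) (proj₂ (,-injective (proj₂ (,-injective eq))))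
        where
        zP = ∈-P⁻ z∈
        wP = ∈-P⁻ w∈
        finish : g ≡ h → g′ ≡ h′ → x′ ≡ u′ → x ≡ u → (y , (x , g) , (x′ , g′)) ≡ (w , (u , h) , (u′ , h′))
        finish refl refl refl refl =
          cong (_, (x , g) , (x′ , g′)) (trans (sym (proj₂ (proj₁ zP))) (proj₂ (proj₁ wP)))
        same : g ≡ h → g′ ≡ h′ → x′ *ᶠ g′ ≡ u′ *ᶠ h′ → x *ᶠ g ≡ u *ᶠ h → (y , (x , g) , (x′ , g′)) ≡
            (w , (u , h) , (u′ , h′))
        same g≡h g′≡h′ e′ e = finish g≡h g′≡h′
          (*-cancelˡ g′ (nonzero (proj₂ (proj₁ (proj₂ zP))))
              (trans (*-comm _ _) (trans e′ (trans (*-comm _ _) (cong (_*ᶠ u′) (sym g′≡h′))))))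
          (*-cancelˡ g (nonzero (proj₂ (proj₁ (proj₁ zP))))
              (trans (*-comm _ _) (trans e (trans (*-comm _ _) (cong (_*ᶠ u) (sym g≡h))))))
      quadruple∈ : ∀ {z} → z ∈ pairs S fibre² → quadruple z ∈ additiveQuadruples G
      quadruple∈ {y , (x , g) , (x′ , g′)} z∈ =
        let ((x∈ , g∈) , eq) , ((x′∈ , g′∈) , eq′) = ∈-P⁻ z∈ in
        ∈-filter⁺ (λ ((x₁ , x₂) , (x₃ , x₄)) → (x₁ +ᶠ x₂) Fin.≟ (x₃ +ᶠ x₄))
          (∈-cartesianProduct⁺ (∈-cartesianProduct⁺ g∈ (*-closed (X⊆G x′∈) g′∈))
              (∈-cartesianProduct⁺ g′∈ (*-closed (X⊆G x∈) g∈)))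
          (sum≡ (trans eq (sym eq′)))
        where
        sum≡ : f (x , g) ≡ f (x′ , g′) → g +ᶠ x′ *ᶠ g′ ≡ g′ +ᶠ x *ᶠ g
        sum≡ e =
          trans (solve 4 (λ x g x′ g′ → g :+ x′ :* g′ := g :* (:1 :- x) :+ (x :* g :+ x′ :* g′)) refl x g x′ g′)
          (trans (cong (_+ᶠ (x *ᶠ g +ᶠ x′ *ᶠ g′)) e)
            (solve 4 (λ x g x′ g′ → g′ :* (:1 :- x′) :+ (x :* g :+ x′ :* g′) := g′ :+ x :* g) refl x g x′ g′))
      collisions : ∑[ S ] (λ y → length (fibre f XG y) ²) ≤ length (additiveQuadruples G)
      collisions = begin
        ∑[ S ] (λ y → length (fibre f XG y) ²)
          ≤⟨ ∑-mono S (λ {y} _ → ℕ.≤-reflexive (sym (length-cartesianProduct (fibre f XG y) (fibre f XG y)))) ⟩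
        ∑[ S ] (length ∘ fibre²)                 ≡⟨ length-pairs S fibre² ⟨
        length (pairs S fibre²)                  ≤⟨ length-injection quadruple
          (unique-pairs uniqS λ _ → Unique.cartesianProduct⁺
              (Unique.filter⁺ _ (Unique.cartesianProduct⁺ uniqX unique))
                  (Unique.filter⁺ _ (Unique.cartesianProduct⁺ uniqX unique)))
          injective quadruple∈ ⟩
        length (additiveQuadruples G)            ∎

    private
      us : List (Fin p)
      us = filter (λ x → ¬? (x Fin.≟ 1ᶠ)) X

      uniq-us : Unique us
      uniq-us = Unique.filter⁺ _ uniqX

      ∈-us⁻ : ∀ {u} → u ∈ us → u ∈ X × u ≢ 1ᶠ
      ∈-us⁻ = ∈-filter⁻ (λ x → ¬? (x Fin.≟ 1ᶠ))

      ω : Fin p → Fin p × Fin p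
      ω u = u ^ᶠ t , (u -ᶠ 1ᶠ) ^ᶠ t

      reps = representatives (≡-dec Fin._≟_ Fin._≟_) ω us
      rs = proj₁ reps
      M = length rs

      f : Fin p × Fin p → Fin p
      f (u , g) = g *ᶠ (1ᶠ -ᶠ u)

      1-u : ∀ u → (1ᶠ -ᶠ u) ^ᶠ t ≡ (-ᶠ 1ᶠ) ^ᶠ t *ᶠ (u -ᶠ 1ᶠ) ^ᶠ t
      1-u u =
        trans (cong (_^ᶠ t) (solve 1 (λ u → :1 :- u := :- :1 :* (u :- :1)) refl u))
            (^-distrib-* (-ᶠ 1ᶠ) (u -ᶠ 1ᶠ) t)

      -1≢0 : -ᶠ 1ᶠ ≢ 0ᶠ
      -1≢0 eq =
        1≢0 (trans (solve 0 (:1 := :- (:- :1)) refl) (trans (cong -ᶠ_ eq) (solve 0 (:- con 0ℤ := con 0ℤ) refl)))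

      f-power : ∀ {u g} → g ∈ G → f (u , g) ^ᶠ t ≡ (-ᶠ 1ᶠ) ^ᶠ t *ᶠ (u -ᶠ 1ᶠ) ^ᶠ t
      f-power {u} {g} g∈ = begin
        (g *ᶠ (1ᶠ -ᶠ u)) ^ᶠ t         ≡⟨ ^-distrib-* g (1ᶠ -ᶠ u) t ⟩
        g ^ᶠ t *ᶠ (1ᶠ -ᶠ u) ^ᶠ t      ≡⟨ cong (_*ᶠ (1ᶠ -ᶠ u) ^ᶠ t) (^-order grp g∈) ⟩
        1ᶠ *ᶠ (1ᶠ -ᶠ u) ^ᶠ t          ≡⟨ *-identityˡ _ ⟩
        (1ᶠ -ᶠ u) ^ᶠ t               ≡⟨ 1-u u ⟩
        (-ᶠ 1ᶠ) ^ᶠ t *ᶠ (u -ᶠ 1ᶠ) ^ᶠ t ∎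
        where open ≡-Reasoning

      ∈-rs : ∀ {u} → u ∈ rs → (u ∈ X × u ≢ 1ᶠ)
      ∈-rs u∈ = ∈-us⁻ (proj₁ (proj₂ reps) u∈)

      injective : InjectiveOn f (cartesianProduct rs G)
      injective {u , g} {v , h} ug∈ vh∈ eq = same u≡v
        where
        ugM = ∈-cartesianProduct⁻ rs G ug∈
        vhM = ∈-cartesianProduct⁻ rs G vh∈
        power : ∀ {u} → u ∈ rs → u ^ᶠ t ≡ 1ᶠ
        power u∈ = ^-order grp (X⊆G (proj₁ (∈-rs u∈)))
        u≡v : u ≡ v
        u≡v = unique-map⇒injectiveOn (proj₁ (proj₂ (proj₂ reps))) (proj₁ ugM) (proj₁ vhM)
          (cong₂ _,_ (trans (power (proj₁ ugM)) (sym (power (proj₁ vhM))))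
            (*-cancelˡ ((-ᶠ 1ᶠ) ^ᶠ t) (^-≢0 t -1≢0)
              (trans (sym (f-power (proj₂ ugM))) (trans (cong (_^ᶠ t) eq) (f-power (proj₂ vhM))))))
        same : u ≡ v → (u , g) ≡ (v , h)
        same refl = cong (u ,_) (*-cancelˡ (1ᶠ -ᶠ u) (λ e → proj₂ (∈-rs (proj₁ ugM)) (sym (-ᶠ≡0⇒≡ e)))
          (trans (*-comm _ _) (trans eq (*-comm _ _))))

      -- S contains the coset G (1 - u) of every representative u. These cosets are disjoint: t-th
      -- powers on them are (-1)ᵗ (u - 1)ᵗ, while uᵗ = 1 throughout.
      Mt≤S : M * t ≤ length S
      Mt≤S = subst (_≤ length S) (length-cartesianProduct rs G)
        (length-injection f (Unique.cartesianProduct⁺ (Unique.map⁻ (proj₁ (proj₂ (proj₂ reps)))) unique) injective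
          λ ug∈ → let u∈ , g∈ = ∈-cartesianProduct⁻ rs G ug∈ in GS⊆S g∈ (1-X⊆S (proj₁ (∈-rs u∈))))

      us≤t : length us ≤ t
      us≤t = length-⊆ uniq-us (X⊆G ∘ proj₁ ∘ ∈-us⁻)

    module _ {e : ℕ} (t⁵≤ep³ : t ³ * t ² ≤ e * p ³) (t≤p : t ≤ p) where

      private
        open ℕ.≤-Reasoning

        K = K₀ + 16 + 256 * e ²

        generic : 16 * M ≤ t ² → 16 * M * (t ³ * t) ≤ p ³ → length us ³ ≤ K * length S ²
        generic 16M≤t² 16Mt⁴≤p³ = begin
          length us ³                      ≤⟨ stepanov (map ω rs) us 0<order t≤p
                                                (subst (λ m → 16 * m ≤ t ²) (sym len) 16M≤t²)
                                                (subst (λ m → 16 * m * (t ³ * t) ≤ p ³) (sym len) 16Mt⁴≤p³)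
                                                uniq-us
                                                (All.tabulate λ u∈ → nonzero
                                                    (X⊆G (proj₁ (∈-us⁻ u∈))) , proj₂ (∈-us⁻ u∈) , proj₂
                                                        (proj₂ (proj₂ reps)) u∈) ⟩
          K₀ * (length (map ω rs) * t) ²   ≡⟨ cong (λ m → K₀ * (m * t) ²) len ⟩
          K₀ * (M * t) ²
            ≤⟨ ℕ.*-mono-≤ (ℕ.≤-trans (ℕ.m≤m+n K₀ 16) (ℕ.m≤m+n (K₀ + 16) _)) (²-mono-≤ Mt≤S) ⟩
          K * length S ²                   ∎
          where
          len : length (map ω rs) ≡ M
          len = List.length-map ω rs

        many-classes : t ² ≤ 16 * M → length us ³ ≤ K * length S ²
        many-classes t²≤16M = begin
          length us ³               ≤⟨ ³-mono-≤ us≤t ⟩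
          t ² * t                   ≤⟨ ℕ.*-monoˡ-≤ t t²≤16M ⟩
          16 * M * t                ≡⟨ ℕ.*-assoc 16 M t ⟩
          16 * (M * t)              ≤⟨ ℕ.*-monoʳ-≤ 16 (ℕ.≤-trans Mt≤S (n≤n² (length S))) ⟩
          16 * length S ²
            ≤⟨ ℕ.*-monoˡ-≤ (length S ²) (ℕ.≤-trans (ℕ.m≤n+m 16 K₀) (ℕ.m≤m+n (K₀ + 16) _)) ⟩
          K * length S ²            ∎
          where
          n≤n² : ∀ n → n ≤ n ²
          n≤n² zero    = z≤n
          n≤n² (suc n) = ℕ.m≤m*n (suc n) (suc n)

        -- The size condition on the group enters here: with t⁵ ≤ e p³ it gives t² ≤ 16 e M t ≤ 16 e
        -- |S|, and then |us|³ ≤ t³ ≤ t⁴ is enough.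
        large-group : p ³ ≤ 16 * M * (t ³ * t) → length us ³ ≤ K * length S ²
        large-group p³≤16Mt⁴ = begin
          length us ³               ≤⟨ ³-mono-≤ us≤t ⟩
          t ³                       ≤⟨ ℕ.m≤m*n (t ³) t {{>-nonZero 0<order}} ⟩
          t ³ * t                   ≡⟨ ℕ.*-assoc (t ²) t t ⟩
          (t ²) ²                   ≤⟨ ²-mono-≤ t²≤16eMt ⟩
          (16 * e * (M * t)) ²      ≤⟨ ²-mono-≤ (ℕ.*-monoʳ-≤ (16 * e) Mt≤S) ⟩
          (16 * e * length S) ²     ≡⟨ regroup₁ e (length S) ⟩
          256 * e ² * length S ²    ≤⟨ ℕ.*-monoˡ-≤ (length S ²) (ℕ.m≤n+m (256 * e ²) (K₀ + 16)) ⟩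
          K * length S ²            ∎
          where
          regroup₁ : ∀ e s → 16 * e * s * (16 * e * s) ≡ 256 * (e * e) * (s * s)
          regroup₁ = solve-∀
          regroup₂ : ∀ e M t → e * (16 * M * (t * t * t * t)) ≡ t * t * t * (16 * e * (M * t))
          regroup₂ = solve-∀
          0<t³ : 0 < t ³
          0<t³ = ℕ.*-mono-≤ (ℕ.*-mono-≤ 0<order 0<order) 0<order
          t²≤16eMt : t ² ≤ 16 * e * (M * t)
          t²≤16eMt = ℕ.*-cancelˡ-≤ (t ³) {{>-nonZero 0<t³}} (begin
            t ³ * t ²                    ≤⟨ t⁵≤ep³ ⟩
            e * p ³                      ≤⟨ ℕ.*-monoʳ-≤ e p³≤16Mt⁴ ⟩
            e * (16 * M * (t ³ * t))     ≡⟨ regroup₂ e M t ⟩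
            t ³ * (16 * e * (M * t))     ∎)

        -- Either Stepanov's bound applies, with M t ≤ |S|, or S is so large that |us| ≤ t suffices.
        us-bound : length us ³ ≤ K * length S ²
        us-bound =
          [ many-classes , (λ few → [ generic few , large-group ]′ (ℕ.≤-total (16 * M * (t ³ * t)) (p ³))) ]′
          (ℕ.≤-total (t ²) (16 * M))

        cube-suc : ∀ n → (suc n) ³ ≤ 8 * (n ³ + 1)
        cube-suc zero    = s≤s z≤n
        cube-suc n@(suc m) = begin
          (suc n) ³         ≤⟨ ³-mono-≤ (ℕ.+-monoˡ-≤ n {1} {n} (s≤s z≤n)) ⟩
          (n + n) ³         ≡⟨ double n ⟩
          8 * n ³           ≤⟨ ℕ.*-monoʳ-≤ 8 (ℕ.m≤m+n (n ³) 1) ⟩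
          8 * (n ³ + 1)     ∎
          where
          double : ∀ n → (n + n) * (n + n) * (n + n) ≡ 8 * (n * n * n)
          double = solve-∀

      -- Restores x = 1 through (n + 1)³ ≤ 8 (n³ + 1); the additional 1 is absorbed by |S|² ≥ 1.
      shift-bound : 0 < length S → length X ³ ≤ K₃ e * length S ²
      shift-bound 0<S = begin
        length X ³                              ≤⟨ ³-mono-≤ (length-filter-≢ Fin._≟_ uniqX 1ᶠ) ⟩
        (suc (length us)) ³                     ≤⟨ cube-suc (length us) ⟩
        8 * (length us ³ + 1)                   ≤⟨ ℕ.*-monoʳ-≤ 8 (ℕ.+-mono-≤ us-bound (ℕ.*-mono-≤ 0<S 0<S)) ⟩
        8 * (K * length S ² + length S ²)       ≡⟨ regroup K (length S ²) ⟩
        8 * (K + 1) * length S ²                ∎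
        where
        regroup : ∀ K s → 8 * (K * s + s) ≡ 8 * (K + 1) * s
        regroup = solve-∀

-- From subsets of `Fin p` to duplicate-free lists.

∣∣≡length-filter : ∀ {n} (X : Subset n) → ∣ X ∣ ≡ length (filter (Subset._∈? X) (allFin n))
∣∣≡length-filter []      = refl
∣∣≡length-filter {suc n} (b ∷ X) =
  trans (head b) (cong (λ l → length (filter (Subset._∈? (b ∷ X)) (zero ∷ l))) (List.map-tabulate (λ i → i) suc))
  where
  tail : ∀ b xs → length (filter (Subset._∈? (b ∷ X)) (map suc xs)) ≡ length (filter (Subset._∈? X) xs)
  tail b []       = refl
  tail b (x ∷ xs) with x Subset.∈? X
  ... | yes _ = cong suc (tail b xs)
  ... | no  _ = tail b xs
  head : ∀ b → ∣ b ∷ X ∣ ≡ length (filter (Subset._∈? (b ∷ X)) (zero ∷ map suc (allFin n)))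
  head true  = cong suc (trans (∣∣≡length-filter X) (sym (tail true (allFin n))))
  head false = trans (∣∣≡length-filter X) (sym (tail false (allFin n)))

module _ {p : ℕ} .{{_ : NonZero p}} where

  ∣∣≡length : ∀ (X : Subset p) → ∣ X ∣ ≡ length (elements X)
  ∣∣≡length = ∣∣≡length-filter

  ∈-elements⁺ : ∀ {X : Subset p} {x} → x Subset.∈ X → x List.∈ elements X
  ∈-elements⁺ {X} {x} x∈ = ∈-filter⁺ (Subset._∈? X) (∈-allFin x) x∈

  ∈-elements⁻ : ∀ {X : Subset p} {x} → x List.∈ elements X → x Subset.∈ X
  ∈-elements⁻ {X} x∈ = proj₂ (∈-filter⁻ (Subset._∈? X) {xs = allFin p} x∈)

  unique-elements : ∀ (X : Subset p) → Unique (elements X)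
  unique-elements X = Unique.filter⁺ (Subset._∈? X) (Unique.allFin⁺ p)

  ∈-image₂⁺ : ∀ f (X Y : Subset p) {x y} → x Subset.∈ X → y Subset.∈ Y → f x y Subset.∈ image₂ f X Y
  ∈-image₂⁺ f X Y {x} {y} x∈ y∈ = Equivalence.from (∈-image₂ f X Y) (x , y , x∈ , y∈ , refl)

  ∈-image₂⁻ : ∀ f (X Y : Subset p) {z} → z Subset.∈ image₂ f X Y → ∃₂ λ x y
      → x Subset.∈ X × y Subset.∈ Y × f x y ≡ z
  ∈-image₂⁻ f X Y = Equivalence.to (∈-image₂ f X Y)

  ∈-affine⁻ : ∀ {ξ} {A : Subset p} {s c} → c Subset.∈ affine ξ A s → ∃[ a ] a Subset.∈ A × c ≡ ξ *ₚ a +ₚ s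
  ∈-affine⁻ {ξ} {A} {s} c∈ with ∈-image₂⁻ _+ₚ_ (⁅ ξ ⁆ ⊙ A) ⁅ s ⁆ c∈
  ... | y , s′ , y∈ , s′∈ , refl with ∈-image₂⁻ _*ₚ_ ⁅ ξ ⁆ A y∈
  ... | ξ′ , a , ξ′∈ , a∈ , refl =
      a , a∈ , cong₂ (λ ξ s → ξ *ₚ a +ₚ s) (Subset.x∈⁅y⁆⇒x≡y ξ ξ′∈) (Subset.x∈⁅y⁆⇒x≡y s s′∈)

  module _ (pr : Prime p) where
    private
      𝔽 = ℤ/p pr
    open FieldProperties 𝔽
    open Subgroups 𝔽

    elements-subgroup : ∀ {A : Subset p} → IsSubgroup A → MultiplicativeSubgroup (elements A)
    elements-subgroup {A} grp = record
      { unique    = unique-elements A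
      ; nonzero   = nonzero ∘ ∈-elements⁻
      ; 1∈        = ∈-elements⁺ 1∈
      ; *-closed  = λ g∈ h∈ → ∈-elements⁺ (*-closed (∈-elements⁻ g∈) (∈-elements⁻ h∈))
      ; ⁻¹-closed = λ {g} g∈ → let y , y∈ , gy≡1 = inverse (∈-elements⁻ g∈) in
          ∈-elements⁺ (subst (Subset._∈ A) (*-cancelˡ g (nonzero (∈-elements⁻ g∈))
            (trans gy≡1 (sym (⁻¹-inverse (nonzero (∈-elements⁻ g∈)))))) y∈) }
      where
      open IsSubgroup grp
      nonzero : ∀ {g} → g Subset.∈ A → g ≢ 0ₚ
      nonzero g∈ refl = 0∉ g∈

-- The two inequalities for C and D.

module ShiftedSubgroups {p : ℕ} .{{_ : NonZero p}} (pr : Prime p)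
  {A Γ : Subset p} (grpA : IsSubgroup A) (grpΓ : IsSubgroup Γ) (∣A∣²<p : ∣ A ∣ ^ 2 < p)
  {C D : Subset p} {ξ η s : Fin p} (ξ≢0 : ξ ≢ 0ₚ) (η≢0 : η ≢ 0ₚ)
  (C⊆ : C ⊆ affine ξ A s) (D⊆ : D ⊆ affine η A s) (3≤∣C∣ : 3 ≤ ∣ C ∣)
  (C⊖D⊆ : C ⊖ D ⊆ Γ ∪ ⁅ 0ₚ ⁆) where

  private
    𝔽 = ℤ/p pr
  open FieldProperties 𝔽
  open Subgroups 𝔽
  open Triples 𝔽
  open Shifts 𝔽

  private
    G = elements A
    t = length G
    S = S[ Γ ] (C ⊖ C)
    grp = elements-subgroup pr grpA
    grp′ = elements-subgroup pr grpΓ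
    open MultiplicativeSubgroup grp′ using (*-closed; ⁻¹-closed; nonzero)

    t²<p : t ² < p
    t²<p = subst (_< p) (trans (cong (_^ 2) (∣∣≡length A)) (n^2≡n² t)) ∣A∣²<p

    affine-elements : ∀ {ζ} {Y : Subset p} → Y ⊆ affine ζ A s →
      ∀ {y} → y List.∈ elements Y → ∃[ a ] a List.∈ G × y ≡ ζ *ᶠ a +ᶠ s
    affine-elements Y⊆ y∈ = let a , a∈ , eq = ∈-affine⁻ (Y⊆ (∈-elements⁻ y∈)) in a , ∈-elements⁺ a∈ , eq

    C∖D⊆Γ : ∀ {c d} → c List.∈ elements C → d List.∈ elements D → c ≢ d → (c -ᶠ d) List.∈ elements Γ
    C∖D⊆Γ {c} {d} c∈ d∈ c≢d = [ ∈-elements⁺ , (λ z∈ → ⊥-elim (c≢d (-ᶠ≡0⇒≡ (Subset.x∈⁅y⁆⇒x≡y 0ₚ z∈)))) ]′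
      (Subset.x∈p∪q⁻ Γ ⁅ 0ₚ ⁆ (C⊖D⊆ (subst (Subset._∈ C ⊖ D) (-ₚ-ℤ/p pr c d)
          (∈-image₂⁺ _-ₚ_ C D (∈-elements⁻ c∈) (∈-elements⁻ d∈)))))

    X : List (Fin p)
    X = filter (λ x → (1ᶠ -ᶠ x) Subset.∈? S) (elements Γ)

    uniqX : Unique X
    uniqX = Unique.filter⁺ _ (unique-elements Γ)

    X⊆Γ : ∀ {x} → x List.∈ X → x List.∈ elements Γ
    X⊆Γ = proj₁ ∘ ∈-filter⁻ (λ x → (1ᶠ -ᶠ x) Subset.∈? S)

    1-X⊆S : ∀ {x} → x List.∈ X → (1ᶠ -ᶠ x) List.∈ elements S
    1-X⊆S x∈ = ∈-elements⁺ (proj₂ (∈-filter⁻ (λ x → (1ᶠ -ᶠ x) Subset.∈? S) {xs = elements Γ} x∈))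

    ∈-S : ∀ {g c c′} → g Subset.∈ Γ → c Subset.∈ C → c′ Subset.∈ C → g *ᶠ (c -ᶠ c′) Subset.∈ S
    ∈-S {c = c} {c′} g∈ c∈ c′∈ = ∈-image₂⁺ _*ₚ_ Γ (C ⊖ C) g∈
      (subst (Subset._∈ C ⊖ C) (-ₚ-ℤ/p pr c c′) (∈-image₂⁺ _-ₚ_ C C c∈ c′∈))

    ΓS⊆S : ∀ {g y} → g List.∈ elements Γ → y List.∈ elements S → (g *ᶠ y) List.∈ elements S
    ΓS⊆S {g} g∈ y∈ with ∈-image₂⁻ _*ₚ_ Γ (C ⊖ C) (∈-elements⁻ y∈)
    ... | h , q , h∈ , q∈ , refl = ∈-elements⁺ (subst (Subset._∈ S) (*-assoc g h q)
      (∈-image₂⁺ _*ₚ_ Γ (C ⊖ C) (IsSubgroup.*-closed grpΓ (∈-elements⁻ g∈) h∈) q∈))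

    -- Both differences are nonzero, hence in Γ, and so is their quotient; `1-ratio` writes 1 - x as
    -- (c - d)⁻¹ (c - c′).
    ratio∈X : ∀ {d c c′} → d List.∈ elements D → c List.∈ elements C → c ≢ d → c′ List.∈ elements C → c′ ≢ d →
      ((c′ -ᶠ d) *ᶠ (c -ᶠ d) ⁻¹) List.∈ X
    ratio∈X {d} {c} {c′} d∈ c∈ c≢d c′∈ c′≢d = ∈-filter⁺ (λ x → (1ᶠ -ᶠ x) Subset.∈? S)
      (*-closed (C∖D⊆Γ c′∈ d∈ c′≢d) inverse∈)
      (subst (Subset._∈ S) (sym (1-ratio c′ c≢d)) (∈-S (∈-elements⁻ inverse∈) (∈-elements⁻ c∈) (∈-elements⁻ c′∈)))
      where
      inverse∈ = ⁻¹-closed (C∖D⊆Γ c∈ d∈ c≢d)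

    3≤C : 3 ≤ length (elements C)
    3≤C = subst (3 ≤_) (∣∣≡length C) 3≤∣C∣

    3≤t : 3 ≤ t
    3≤t = ℕ.≤-trans 3≤C (subst (length (elements C) ≤_) (List.length-map _ G)
      (length-⊆ {ys = map (λ a → ξ *ᶠ a +ᶠ s) G} (unique-elements C)
        λ c∈ → let a , a∈ , eq = affine-elements C⊆ c∈ in subst (List._∈ _) (sym eq) (∈-map⁺ _ a∈)))

    0<S : 0 < length (elements S)
    0<S with elements C in eq
    ... | [] = ⊥-elim (ℕ.<⇒≱ (s≤s z≤n) (subst (λ l → 3 ≤ length l) eq 3≤C))
    -- The witness is 1 · (c - c) = 0.
    ... | c ∷ _ = ∈-length (∈-elements⁺ (∈-S {c = c} {c} (IsSubgroup.1∈ grpΓ) c∈ c∈))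
      where
      c∈ : c Subset.∈ C
      c∈ = ∈-elements⁻ (subst (c List.∈_) (sym eq) (here refl))

    3n∸3≥2n : ∀ {n} → 3 ≤ n → 2 * n ≤ 3 * (n ∸ 1)
    3n∸3≥2n {suc (suc (suc n))} _ = subst₂ _≤_ (eq₁ n) (eq₂ n) (ℕ.m≤m+n (6 + 2 * n) n)
      where
      eq₁ : ∀ n → 6 + 2 * n ≡ 2 * (3 + n)
      eq₁ = solve-∀
      eq₂ : ∀ n → 6 + 2 * n + n ≡ 3 * (2 + n)
      eq₂ = solve-∀
    3n∸3≥2n {suc (suc zero)} (s≤s (s≤s ()))
    3n∸3≥2n {suc zero} (s≤s ())

  -- |C| ≥ 3 gives 2 |C| ≤ 3 (|C| - 1). The fourth power of 3 is the 81; that of 2 is discarded.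
  count-bound : ∣ C ∣ ^ 4 * ∣ D ∣ ^ 2 ≤ 81 * K₂ * (length X * (∣ A ∣ ^ 4 * log ∣ A ∣))
  count-bound =
    subst (λ a → ∣ C ∣ ^ 4 * ∣ D ∣ ^ 2 ≤ 81 * K₂ * (length X * (a ^ 4 * log a))) (sym (∣∣≡length A))
    (subst₂ (λ n m → n ^ 4 * m ^ 2 ≤ 81 * K₂ * (length X * (t ^ 4 * log t))) (sym (∣∣≡length C))
        (sym (∣∣≡length D)) (begin
      n ^ 4 * m ^ 2                                        ≡⟨ cong₂ _*_ (n^4≡n²² n) (n^2≡n² m) ⟩
      (n ²) ² * m ²                                        ≤⟨ ℕ.m≤n*m ((n ²) ² * m ²) 16 ⟩
      16 * ((n ²) ² * m ²)                                 ≡⟨ regroup₁ n m ⟩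
      (m * (2 * n) ²) ²
        ≤⟨ ²-mono-≤ (ℕ.*-monoʳ-≤ m (²-mono-≤ (3n∸3≥2n 3≤C))) ⟩
      (m * (3 * (n ∸ 1)) ²) ²                              ≡⟨ regroup₂ m (n ∸ 1) ⟩
      81 * (m * (n ∸ 1) ²) ²                               ≤⟨ ℕ.*-monoʳ-≤ 81 (triples-bound grp t²<p ξ≢0 η≢0 s
                                                                (unique-elements C) (unique-elements D)
                                                                (affine-elements C⊆) (affine-elements D⊆)
                                                                (ℕ.<⇒≤ 3≤t) uniqX (nonzero ∘ X⊆Γ) ratio∈X) ⟩
      81 * (length X * (K₂ * (t ² * t ²) * log t))         ≡⟨ regroup₃ (length X) K₂ (t ²) (log t) ⟩
      81 * K₂ * (length X * ((t ²) ² * log t))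
        ≡⟨ cong (λ a → 81 * K₂ * (length X * (a * log t))) (n^4≡n²² t) ⟨
      81 * K₂ * (length X * (t ^ 4 * log t))               ∎))
    where
    open ℕ.≤-Reasoning
    n = length (elements C)
    m = length (elements D)
    regroup₁ : ∀ n m → 16 * (n * n * (n * n) * (m * m)) ≡ m * (2 * n * (2 * n)) * (m * (2 * n * (2 * n)))
    regroup₁ = solve-∀
    regroup₂ : ∀ m k → m * (3 * k * (3 * k)) * (m * (3 * k * (3 * k))) ≡ 81 * (m * (k * k) * (m * (k * k)))
    regroup₂ = solve-∀
    regroup₃ : ∀ Y K T l → 81 * (Y * (K * (T * T) * l)) ≡ 81 * K * (Y * (T * T * l))
    regroup₃ = solve-∀

  -- Square `count-bound`, multiply by |Γ|², and replace (|X| |Γ|)² by |S| E⁺(Γ).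
  first-bound : ∣ C ∣ ^ 8 * ∣ D ∣ ^ 4 * ∣ Γ ∣ ^ 2 ≤ (81 * K₂) ² * (∣ A ∣ ^ 8 * ∣ S ∣ * E⁺ Γ * log ∣ A ∣ ^ 2)
  first-bound = combine (81 * K₂) (∣ C ∣) (∣ D ∣) (∣ Γ ∣) (∣ A ∣) (log ∣ A ∣) (length X) count-bound
    -- `E⁺ Γ` unfolds to the length of `additiveQuadruples (elements Γ)`.
    (subst₂ (λ g σ → (length X * g) ² ≤ σ * E⁺ Γ) (sym (∣∣≡length Γ)) (sym (∣∣≡length S))
      (energy-bound grp′ (unique-elements S) ΓS⊆S uniqX X⊆Γ 1-X⊆S))
    where
    open ℕ.≤-Reasoning
    regroup₁ : ∀ n m g → n * n * (m * m) * (g * g) ≡ n * m * (n * m) * (g * g)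
    regroup₁ = solve-∀
    regroup₂ : ∀ K Y a l g → K * (Y * (a * l)) * (K * (Y * (a * l))) * (g * g) ≡ K * K * (a * a * (l * l)) *
        (Y * g * (Y * g))
    regroup₂ = solve-∀
    regroup₃ : ∀ K a l σ e → K * K * (a * a * (l * l)) * (σ * e) ≡ K * K * (a * a * σ * e * (l * l))
    regroup₃ = solve-∀
    combine : ∀ K n m g a l Y {σ e} → n ^ 4 * m ^ 2 ≤ K * (Y * (a ^ 4 * l)) → (Y * g) ² ≤ σ * e →
      n ^ 8 * m ^ 4 * g ^ 2 ≤ K ² * (a ^ 8 * σ * e * l ^ 2)
    combine K n m g a l Y {σ} {e} h₁ h₂ = begin
      n ^ 8 * m ^ 4 * g ^ 2
        ≡⟨ cong₂ _*_ (cong₂ _*_ (n^8≡n^4² n) (n^4≡n²² m)) (n^2≡n² g) ⟩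
      (n ^ 4) ² * (m ²) ² * g ²                   ≡⟨ regroup₁ (n ^ 4) (m ²) g ⟩
      (n ^ 4 * m ²) ² * g ²                       ≡⟨ cong (λ k → (n ^ 4 * k) ² * g ²) (n^2≡n² m) ⟨
      (n ^ 4 * m ^ 2) ² * g ²                     ≤⟨ ℕ.*-monoˡ-≤ (g ²) (²-mono-≤ h₁) ⟩
      (K * (Y * (a ^ 4 * l))) ² * g ²             ≡⟨ regroup₂ K Y (a ^ 4) l g ⟩
      K ² * ((a ^ 4) ² * l ²) * (Y * g) ²         ≤⟨ ℕ.*-monoʳ-≤ (K ² * ((a ^ 4) ² * l ²)) h₂ ⟩
      K ² * ((a ^ 4) ² * l ²) * (σ * e)           ≡⟨ regroup₃ K (a ^ 4) l σ e ⟩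
      K ² * ((a ^ 4) ² * σ * e * l ²)
        ≡⟨ cong₂ (λ u v → K ² * (u * σ * e * v)) (n^8≡n^4² a) (n^2≡n² l) ⟨
      K ² * (a ^ 8 * σ * e * l ^ 2)               ∎

  -- The hypothesis and the conclusion are what `_≤_·_^ℚ_` unfolds to at the exponents 3/5 and 2/3.
  -- Cube `count-bound` and insert |X|³ ≪ |S|².
  second-bound : ∀ c → ∣ Γ ∣ ^ 5 ≤ c ^ 5 * p ^ 3 →
    (∣ C ∣ ^ 4 * ∣ D ∣ ^ 2) ^ 3 ≤ (81 * K₂ * K₃ (c ^ 5) * (∣ A ∣ ^ 4 * log ∣ A ∣)) ^ 3 * ∣ S ∣ ^ 2
  second-bound c ∣Γ∣⁵≤ = combine (81 * K₂) (K₃ (c ^ 5)) (∣ A ∣ ^ 4 * log ∣ A ∣) (length X) (∣ S ∣) count-bound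
    (subst (λ σ → length X ³ ≤ K₃ (c ^ 5) * σ ²) (sym (∣∣≡length S))
      (shift-bound grp′ (unique-elements S) ΓS⊆S uniqX X⊆Γ 1-X⊆S {c ^ 5}
        (subst (λ g → g ³ * g ² ≤ c ^ 5 * p ³) (∣∣≡length Γ)
          (subst₂ _≤_ (n^5≡n³n² ∣ Γ ∣) (cong (c ^ 5 *_) (n^3≡n³ p)) ∣Γ∣⁵≤))
        (subst (_≤ p) (∣∣≡length Γ) (Subset.∣p∣≤n Γ)) 0<S))
    where
    open ℕ.≤-Reasoning
    n≤n³ : ∀ n → n ≤ n ³
    n≤n³ zero    = z≤n
    n≤n³ (suc n) =
      ℕ.≤-trans (ℕ.m≤m*n (suc n) (suc n * suc n)) (ℕ.≤-reflexive (sym (ℕ.*-assoc (suc n) (suc n) (suc n))))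
    regroup₁ : ∀ K Y Q → K * (Y * Q) * (K * (Y * Q)) * (K * (Y * Q)) ≡ K * Q * (K * Q) * (K * Q) * (Y * Y * Y)
    regroup₁ = solve-∀
    regroup₂ : ∀ K L Q σ → K * Q * (K * Q) * (K * Q) * (L * L * L * (σ * σ)) ≡ K * L * Q * (K * L * Q) *
        (K * L * Q) * (σ * σ)
    regroup₂ = solve-∀
    combine : ∀ K L Q Y σ {P} → P ≤ K * (Y * Q) → Y ³ ≤ L * σ ² → P ^ 3 ≤ (K * L * Q) ^ 3 * σ ^ 2
    combine K L Q Y σ {P} h₁ h₂ = begin
      P ^ 3                          ≡⟨ n^3≡n³ P ⟩
      P ³                            ≤⟨ ³-mono-≤ h₁ ⟩
      (K * (Y * Q)) ³                ≡⟨ regroup₁ K Y Q ⟩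
      -- L ≤ L³ lets the constant go under the cube.
      (K * Q) ³ * Y ³                ≤⟨ ℕ.*-monoʳ-≤ ((K * Q) ³) (ℕ.≤-trans h₂ (ℕ.*-monoˡ-≤ (σ ²) (n≤n³ L))) ⟩
      (K * Q) ³ * (L ³ * σ ²)        ≡⟨ regroup₂ K L Q σ ⟩
      (K * L * Q) ³ * σ ²            ≡⟨ cong₂ _*_ (n^3≡n³ (K * L * Q)) (n^2≡n² σ) ⟨
      (K * L * Q) ^ 3 * σ ^ 2        ∎

-- δ = 0 suffices: when |Γ|⁵ ≤ c⁵ p³, Stepanov's bound for Γ can fail to apply only if
-- |S| ≫ |Γ|², and then |X|³ ≤ |Γ|³ ≪ |S|² is trivial.
theorem9 : Σ[ K ∈ ℕ ] Σ[ δ ∈ (ℕ → ℚ) ] (IsLittleO1 δ × (∀ (c : ℕ) → Σ[ K′ ∈ ℕ ]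
    (∀ (p : ℕ) .{{_ : NonZero p}} → Prime p →
    ∀ (A Γ : Subset p) → IsSubgroup A → IsSubgroup Γ → ∣ A ∣ ^ 2 < p →
    ∀ (C D : Subset p) → 0ₚ ∉ C → 0ₚ ∉ D →
    ∀ (ξ η s : Fin p) → ξ ≢ 0ₚ → η ≢ 0ₚ →
    C ⊆ affine ξ A s → D ⊆ affine η A s → 3 ≤ ∣ C ∣ →
    C ⊖ D ⊆ Γ ∪ ⁅ 0ₚ ⁆ →
    (∣ C ∣ ^ 8 * ∣ D ∣ ^ 4 * ∣ Γ ∣ ^ 2
    ≤ K * (∣ A ∣ ^ 8 * ∣ S[ Γ ] (C ⊖ C) ∣ * E⁺ Γ * log ∣ A ∣ ^ 2))
    ×
    (∣ Γ ∣ ≤ c · p ^ℚ (+ 3 / 5 - δ p) →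
    (∣ C ∣ ^ 4 * ∣ D ∣ ^ 2)
    ≤ (K′ * (∣ A ∣ ^ 4 * log ∣ A ∣)) · ∣ S[ Γ ] (C ⊖ C) ∣ ^ℚ (+ 2 / 3)))))
theorem9 = (81 * K₂) ² , (λ _ → 0ℚ) , (λ ε 0<ε → 0 , λ _ _ → ℚ.<⇒≤ 0<ε) , λ c →
  81 * K₂ * K₃ (c ^ 5) ,
  λ p pr A Γ grpA grpΓ ∣A∣²<p C D _ _ ξ η s ξ≢0 η≢0 C⊆ D⊆ 3≤∣C∣ C⊖D⊆ →
    let open ShiftedSubgroups pr grpA grpΓ ∣A∣²<p ξ≢0 η≢0 C⊆ D⊆ 3≤∣C∣ C⊖D⊆ in
    first-bound , second-bound c
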